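{- For the poset $\mathcal A_q(N,M)$, the matrix $A^*$ is a dual adjacency matrix for each of the following orderings of the eigenspaces of $A$: (i) $E_0V<E_1V<E_2V<\cdots<E_NV<E_{1/2}V<E_{3/2}V<\cdots<E_{N-1/2}V$; (ii) $E_{1/2}V<E_{3/2}V<\cdots<E_{N-1/2}V<E_0V<E_1V<E_2V<\cdots<E_NV$.
   Context: Let $\mathbb F_q$ be a finite field with $q$ elements, let $N,M$ be positive integers, let $H$ be a vector space over $\mathbb F_q$ of dimension $N+M$, and fix a subspace $h\subseteq H$ of dimension $M$. Let $X$ be the set of subspaces $y\subseteq H$ with $y\cap h=0$, partially ordered by inclusion (the Attenuated Space poset $\mathcal A_q(N,M)$). For $y,z\in X$, $z$ covers $y$ when $y\subseteq z$ and $\dim z-\dim y=1$; $y,z$ are adjacent when one of them covers the other. Let $\mathrm{Mat}_X(\mathbb C)$ be the algebra of complex matrices with rows and columns indexed by $X$, acting on $V=\mathbb C^X$ by left multiplication. The matrix $A\in\mathrm{Mat}_X(\mathbb C)$ has $(y,z)$-entry $1$ if $y$ covers $z$; $q^{\dim y}$ if $z$ covers $y$; and $0$ if $y,z$ are not adjacent. The matrix $A^*\in\mathrm{Mat}_X(\mathbb C)$ is diagonal with $(y,y)$-entry $q^{ -\dim y}$. Let $[N]=\{i: 2i\in\mathbb Z,\ 0\le i\le N\}=\{0,1/2,1,\ldots,N\}$. The matrix $A$ is diagonalizable with mutually distinct eigenvalues $\theta_i=\frac{q^{N-i}-q^i}{q-1}q^{M/2}$ $(i\in[N])$, where $q^{1/2}>0$.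 For $i\in[N]$, $E_i$ is the primitive idempotent of $A$ for $\theta_i$ (the projection acting as the identity on the $\theta_i$-eigenspace and as $0$ on the other eigenspaces), so $E_iV$ is the $\theta_i$-eigenspace of $A$. For $0\le i\le N$ let $E^*_i\in\mathrm{Mat}_X(\mathbb C)$ be the diagonal matrix with $(y,y)$-entry $1$ if $\dim y=i$ and $0$ otherwise. Let $\mathbf M^*$ be the commutative subalgebra of $\mathrm{Mat}_X(\mathbb C)$ with basis $\{E^*_i\}_{i=0}^N$. Set $D=2N$. For an ordering $\{V_i\}_{i=0}^D$ of the eigenspaces of $A$, a dual adjacency matrix for this ordering is a matrix $\mathbf A^*$ that generates $\mathbf M^*$ and satisfies $\mathbf A^*V_i\subseteq V_{i-1}+V_i+V_{i+1}$ for $0\le i\le D$, where $V_{ -1}=0$ and $V_{D+1}=0$. -}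

module Defs where

open import Algebra.Apartness.Bundles using (HeytingCommutativeRing; HeytingField)
open import Algebra.Bundles using (CommutativeMonoid; CommutativeRing)
import Algebra.Definitions.RawMonoid as RawMonoid
open import Algebra.Module.Bundles using (Module)
open import Data.Bool.Base using (Bool; T; if_then_else_)
open import Data.Bool.Properties using (T?)
open import Data.Fin.Base as Fin using (Fin; zero; suc; toℕ; finToFun; funToFin)
open import Data.Fin.Permutation using (cast-id)
import Data.Fin.Properties as Fin
open import Data.Integer.Base as ℤ using (ℤ; +_; -[1+_])
open import Data.List.Base as List using (List; _∷_; length; lookup)
open import Data.List.Membership.Propositional.Properties using (∈-lookup)
import Data.List.Membership.Setoid
import Data.List.Membership.Setoid.Properties as Membership
import Data.List.Relation.Unary.All as All
open import Data.List.Relation.Unary.AllPairs using (_∷_)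
open import Data.List.Relation.Unary.Any as Any using (Any)
import Data.List.Relation.Unary.Any.Properties as AnyProperties
open import Data.List.Relation.Unary.Unique.DecSetoid.Properties using (deduplicate-!)
import Data.List.Relation.Unary.Unique.Setoid as Unique
open import Data.Maybe.Base as Maybe using (Maybe)
open import Data.Maybe.Relation.Unary.Any using (just) renaming (Any to MaybeAny)
open import Data.Nat.Base as ℕ using (ℕ; zero; suc; _∸_; _≤_; _<_)
import Data.Nat.Properties as ℕ
open import Data.Product.Base using (∃; ∃₂; _×_; _,_; proj₁; proj₂)
import Data.Rational.Base
open import Data.Rational.Base as ℚ using (ℚ; 0ℚ; 1ℚ; ½; ∣_∣)
import Data.Rational.Properties as ℚ
open import Data.Sum.Algebra using (⊎-comm)
open import Data.Sum.Base using (_⊎_; [_,_]′)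
open import Data.Vec.Functional using (Vector) renaming (_∷_ to _◂_)
open import Function.Base using (_∘_; id)
open import Function.Bundles using (Inverse; _↔_; _⇔_)
open import Function.Construct.Composition using (_↔-∘_)
open import Level using (Level; _⊔_; 0ℓ)
open import Relation.Binary.Bundles using (Setoid; DecSetoid)
open import Relation.Binary.PropositionalEquality.Core as ≡ using (_≡_; refl)
import Relation.Binary.PropositionalEquality.Properties as ≡
import Relation.Binary.Reasoning.Setoid as SetoidReasoning
open import Relation.Nullary using (Dec; yes; no; does; ¬_; contradiction; map′)
open import Relation.Nullary.Decidable using (_×-dec_; _→-dec_; ¬?; dec⇒maybe; decidable-stable)
open import Relation.Unary using (Pred; Decidable; U)
open import Tactic.RingSolver using (solve-∀)
open import Tactic.RingSolver.Core.AlmostCommutativeRing using (fromCommutativeRing)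

infix 4 _≈ʳ_ _<ʳ_ _≈ᶜ_
infixl 6 _+ʳ_ _+ᶜ_
infixl 7 _*ʳ_ _*ᶜ_
infix 8 -ʳ_ -ᶜ_

IsCauchy : (ℕ → ℚ) → Set
IsCauchy x = ∀ ε → 0ℚ ℚ.< ε → ∃ λ n → ∀ i j → n ℕ.≤ i → n ℕ.≤ j → ∣ x i ℚ.- x j ∣ ℚ.< ε

-- Real numbers are Cauchy sequences of rationals, identified when their
-- difference tends to 0.
record ℝ : Set where
  constructor _,_
  field
    approx   : ℕ → ℚ
    isCauchy : IsCauchy approx

open ℝ

record _≈ʳ_ (x y : ℝ) : Set where
  constructor close
  field
    eventually : ∀ ε → 0ℚ ℚ.< ε → ∃ λ n → ∀ i → n ℕ.≤ i → ∣ approx x i ℚ.- approx y i ∣ ℚ.< ε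

open _≈ʳ_

_<ʳ_ : ℝ → ℝ → Set
x <ʳ y = ∃ λ ε → 0ℚ ℚ.< ε × ∃ λ n → ∀ i → n ℕ.≤ i → approx x i ℚ.+ ε ℚ.< approx y i

private
  ℚ-ring = fromCommutativeRing ℚ.+-*-commutativeRing λ p → dec⇒maybe (0ℚ ℚ.≟ p)

  telescope : ∀ a b c → (a ℚ.+ ℚ.- b) ℚ.+ (b ℚ.+ ℚ.- c) ≡ a ℚ.+ ℚ.- c
  telescope = solve-∀ ℚ-ring

  sum-difference : ∀ a b c d → (a ℚ.+ ℚ.- c) ℚ.+ (b ℚ.+ ℚ.- d) ≡ (a ℚ.+ b) ℚ.+ ℚ.- (c ℚ.+ d)
  sum-difference = solve-∀ ℚ-ring

  product-difference : ∀ a b c d → a ℚ.* (b ℚ.+ ℚ.- d) ℚ.+ d ℚ.* (a ℚ.+ ℚ.- c) ≡ a ℚ.* b ℚ.+ ℚ.- (c ℚ.* d)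
  product-difference = solve-∀ ℚ-ring

  swap-difference : ∀ a b → ℚ.- (a ℚ.+ ℚ.- b) ≡ b ℚ.+ ℚ.- a
  swap-difference = solve-∀ ℚ-ring

  neg-difference : ∀ a b → ℚ.- (a ℚ.+ ℚ.- b) ≡ ℚ.- a ℚ.+ ℚ.- ℚ.- b
  neg-difference = solve-∀ ℚ-ring

  recentre : ∀ a b → b ≡ a ℚ.+ (b ℚ.+ ℚ.- a)
  recentre = solve-∀ ℚ-ring

  ½ε : ∀ {ε} → 0ℚ ℚ.< ε → 0ℚ ℚ.< ½ ℚ.* ε
  ½ε {ε} 0<ε = ≡.subst (ℚ._< ½ ℚ.* ε) (ℚ.*-zeroʳ ½) (ℚ.*-monoʳ-<-pos ½ {0ℚ} {ε} 0<ε)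

  ½ε+½ε : ∀ ε → ½ ℚ.* ε ℚ.+ ½ ℚ.* ε ≡ ε
  ½ε+½ε ε = ≡.trans (≡.sym (ℚ.*-distribʳ-+ ε ½ ½)) (ℚ.*-identityˡ ε)

  ∣p-q∣≡∣q-p∣ : ∀ p q → ∣ p ℚ.- q ∣ ≡ ∣ q ℚ.- p ∣
  ∣p-q∣≡∣q-p∣ p q = ≡.trans (≡.sym (ℚ.∣-p∣≡∣p∣ (p ℚ.- q))) (≡.cong ∣_∣ (swap-difference p q))

  ∣p-p∣<ε : ∀ {p q ε} → p ≡ q → 0ℚ ℚ.< ε → ∣ p ℚ.- q ∣ ℚ.< ε
  ∣p-p∣<ε {p} {ε = ε} refl 0<ε = ≡.subst (λ r → ∣ r ∣ ℚ.< ε) (≡.sym (ℚ.+-inverseʳ p)) 0<ε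

  ∣a+b∣<ε : ∀ a b ε → ∣ a ∣ ℚ.< ½ ℚ.* ε → ∣ b ∣ ℚ.< ½ ℚ.* ε → ∣ a ℚ.+ b ∣ ℚ.< ε
  ∣a+b∣<ε a b ε a< b< = ℚ.≤-<-trans (ℚ.∣p+q∣≤∣p∣+∣q∣ a b)
    (≡.subst (∣ a ∣ ℚ.+ ∣ b ∣ ℚ.<_) (½ε+½ε ε) (ℚ.+-mono-< a< b<))

  triangle : ∀ a b c ε → ∣ a ℚ.- b ∣ ℚ.< ½ ℚ.* ε → ∣ b ℚ.- c ∣ ℚ.< ½ ℚ.* ε → ∣ a ℚ.- c ∣ ℚ.< ε
  triangle a b c ε a-b b-c = ≡.subst (λ r → ∣ r ∣ ℚ.< ε) (telescope a b c)
    (∣a+b∣<ε (a ℚ.- b) (b ℚ.- c) ε a-b b-c)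

  sum-close : ∀ a b c d ε → ∣ a ℚ.- c ∣ ℚ.< ½ ℚ.* ε → ∣ b ℚ.- d ∣ ℚ.< ½ ℚ.* ε →
              ∣ (a ℚ.+ b) ℚ.- (c ℚ.+ d) ∣ ℚ.< ε
  sum-close a b c d ε a-c b-d = ≡.subst (λ r → ∣ r ∣ ℚ.< ε) (sum-difference a b c d)
    (∣a+b∣<ε (a ℚ.- c) (b ℚ.- d) ε a-c b-d)

  neg-close : ∀ a b ε → ∣ a ℚ.- b ∣ ℚ.< ε → ∣ ℚ.- a ℚ.- ℚ.- b ∣ ℚ.< ε
  neg-close a b ε a-b = ≡.subst (ℚ._< ε)
    (≡.trans (≡.sym (ℚ.∣-p∣≡∣p∣ (a ℚ.- b))) (≡.cong ∣_∣ (neg-difference a b))) a-b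

  ∣ab∣<½ε : ∀ a b K δ ε → 0ℚ ℚ.< K → K ℚ.* δ ≡ ½ ℚ.* ε → ∣ a ∣ ℚ.< K → ∣ b ∣ ℚ.< δ → ∣ a ℚ.* b ∣ ℚ.< ½ ℚ.* ε
  ∣ab∣<½ε a b K δ ε 0<K Kδ a< b< = begin-strict
    ∣ a ℚ.* b ∣        ≡⟨ ℚ.∣p*q∣≡∣p∣*∣q∣ a b ⟩
    ∣ a ∣ ℚ.* ∣ b ∣    ≤⟨ ℚ.*-monoʳ-≤-nonNeg ∣ b ∣ {{ℚ.∣-∣-nonNeg b}} (ℚ.<⇒≤ a<) ⟩
    K ℚ.* ∣ b ∣        <⟨ ℚ.*-monoʳ-<-pos K {{ℚ.positive 0<K}} b< ⟩
    K ℚ.* δ            ≡⟨ Kδ ⟩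
    ½ ℚ.* ε            ∎
    where open ℚ.≤-Reasoning

  product-close : ∀ a b c d K δ ε → 0ℚ ℚ.< K → K ℚ.* δ ≡ ½ ℚ.* ε → ∣ a ∣ ℚ.< K → ∣ d ∣ ℚ.< K →
                  ∣ a ℚ.- c ∣ ℚ.< δ → ∣ b ℚ.- d ∣ ℚ.< δ → ∣ a ℚ.* b ℚ.- c ℚ.* d ∣ ℚ.< ε
  product-close a b c d K δ ε 0<K Kδ a< d< a-c b-d = ≡.subst (λ r → ∣ r ∣ ℚ.< ε)
    (product-difference a b c d)
    (∣a+b∣<ε (a ℚ.* (b ℚ.- d)) (d ℚ.* (a ℚ.- c)) ε
      (∣ab∣<½ε a (b ℚ.- d) K δ ε 0<K Kδ a< b-d) (∣ab∣<½ε d (a ℚ.- c) K δ ε 0<K Kδ d< a-c))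

  shrink : ∀ K ε → 0ℚ ℚ.< K → 0ℚ ℚ.< ε → ∃ λ δ → 0ℚ ℚ.< δ × K ℚ.* δ ≡ ½ ℚ.* ε
  shrink K ε 0<K 0<ε = δ , ℚ.positive⁻¹ δ {{ℚ.pos*pos⇒pos 1/K (½ ℚ.* ε) {{ℚ.positive (½ε 0<ε)}}}} , eq
    where
    instance
      K⁺ : ℚ.Positive K
      K⁺ = ℚ.positive 0<K
      K≢0 : ℚ.NonZero K
      K≢0 = ℚ.pos⇒nonZero K
    1/K : ℚ
    1/K = ℚ.1/ K
    instance
      1/K⁺ : ℚ.Positive 1/K
      1/K⁺ = ℚ.1/pos⇒pos K
    δ : ℚ
    δ = 1/K ℚ.* (½ ℚ.* ε)
    eq : K ℚ.* δ ≡ ½ ℚ.* ε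
    eq = ≡.trans (≡.sym (ℚ.*-assoc K 1/K (½ ℚ.* ε)))
         (≡.trans (≡.cong (ℚ._* (½ ℚ.* ε)) (ℚ.*-inverseʳ K)) (ℚ.*-identityˡ (½ ℚ.* ε)))

  0<1 : 0ℚ ℚ.< 1ℚ
  0<1 = ℚ.positive⁻¹ 1ℚ

  0<p+q : ∀ p q → 0ℚ ℚ.≤ p → 0ℚ ℚ.< q → 0ℚ ℚ.< p ℚ.+ q
  0<p+q p q 0≤p 0<q = ≡.subst (ℚ._< p ℚ.+ q) (ℚ.+-identityʳ 0ℚ) (ℚ.+-mono-≤-< 0≤p 0<q)

  p≤p+q : ∀ p q → 0ℚ ℚ.< q → p ℚ.≤ p ℚ.+ q
  p≤p+q p q 0<q = ≡.subst (ℚ._≤ p ℚ.+ q) (ℚ.+-identityʳ p) (ℚ.+-monoʳ-≤ p (ℚ.<⇒≤ 0<q))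

  q≤p+q : ∀ p q → 0ℚ ℚ.< p → q ℚ.≤ p ℚ.+ q
  q≤p+q p q 0<p = ≡.subst (q ℚ.≤_) (ℚ.+-comm q p) (p≤p+q q p 0<p)

  ∣b∣<∣a∣+ε : ∀ a b ε → ∣ b ℚ.- a ∣ ℚ.< ε → ∣ b ∣ ℚ.< ∣ a ∣ ℚ.+ ε
  ∣b∣<∣a∣+ε a b ε b-a = ≡.subst (λ r → ∣ r ∣ ℚ.< ∣ a ∣ ℚ.+ ε) (≡.sym (recentre a b))
    (ℚ.≤-<-trans (ℚ.∣p+q∣≤∣p∣+∣q∣ a (b ℚ.- a)) (ℚ.+-monoʳ-< ∣ a ∣ b-a))

  Bounded : (ℕ → ℚ) → Set
  Bounded x = ∃₂ λ K n → 0ℚ ℚ.< K × (∀ i → n ℕ.≤ i → ∣ x i ∣ ℚ.< K)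

  abstract
    bound : ∀ x → IsCauchy x → ∀ ε → 0ℚ ℚ.< ε → Bounded x
    bound x x-cauchy ε 0<ε = let n , x< = x-cauchy ε 0<ε in
      ∣ x n ∣ ℚ.+ ε , n , 0<p+q ∣ x n ∣ ε (ℚ.0≤∣p∣ (x n)) 0<ε ,
      λ i ≤i → ∣b∣<∣a∣+ε (x n) (x i) ε (x< i n ≤i ℕ.≤-refl)

    bound₂ : ∀ x y → IsCauchy x → IsCauchy y →
             ∃₂ λ K n → 0ℚ ℚ.< K × (∀ i → n ℕ.≤ i → ∣ x i ∣ ℚ.< K × ∣ y i ∣ ℚ.< K)
    bound₂ x y x-cauchy y-cauchy =
      let K , m , 0<K , <K = bound x x-cauchy 1ℚ 0<1
          L , n , 0<L , <L = bound y y-cauchy 1ℚ 0<1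
      in K ℚ.+ L , m ℕ.⊔ n , 0<p+q K L (ℚ.<⇒≤ 0<K) 0<L ,
         λ i ≤i → ℚ.<-≤-trans (<K i (ℕ.m⊔n≤o⇒m≤o m n ≤i)) (p≤p+q K L 0<L)
                , ℚ.<-≤-trans (<L i (ℕ.m⊔n≤o⇒n≤o m n ≤i)) (q≤p+q K L 0<K)

    const-cauchy : ∀ p → IsCauchy λ _ → p
    const-cauchy p ε 0<ε = 0 , λ _ _ _ _ → ∣p-p∣<ε {p} refl 0<ε

    +-cauchy : ∀ x y → IsCauchy x → IsCauchy y → IsCauchy λ i → x i ℚ.+ y i
    +-cauchy x y x-cauchy y-cauchy ε 0<ε =
      let m , x< = x-cauchy (½ ℚ.* ε) (½ε 0<ε)
          n , y< = y-cauchy (½ ℚ.* ε) (½ε 0<ε)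
      in m ℕ.⊔ n , λ i j ≤i ≤j → sum-close (x i) (y i) (x j) (y j) ε
        (x< i j (ℕ.m⊔n≤o⇒m≤o m n ≤i) (ℕ.m⊔n≤o⇒m≤o m n ≤j))
        (y< i j (ℕ.m⊔n≤o⇒n≤o m n ≤i) (ℕ.m⊔n≤o⇒n≤o m n ≤j))

    neg-cauchy : ∀ x → IsCauchy x → IsCauchy λ i → ℚ.- x i
    neg-cauchy x x-cauchy ε 0<ε =
      let n , x< = x-cauchy ε 0<ε
      in n , λ i j ≤i ≤j → neg-close (x i) (x j) ε (x< i j ≤i ≤j)

    *-cauchy : ∀ x y → IsCauchy x → IsCauchy y → IsCauchy λ i → x i ℚ.* y i
    *-cauchy x y x-cauchy y-cauchy ε 0<ε =
      let K , k , 0<K , <K = bound₂ x y x-cauchy y-cauchy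
          δ , 0<δ , Kδ = shrink K ε 0<K 0<ε
          m , x< = x-cauchy δ 0<δ
          n , y< = y-cauchy δ 0<δ
          l = m ℕ.⊔ n
      in k ℕ.⊔ l , λ i j ≤i ≤j → product-close (x i) (y i) (x j) (y j) K δ ε 0<K Kδ
           (proj₁ (<K i (ℕ.m⊔n≤o⇒m≤o k l ≤i))) (proj₂ (<K j (ℕ.m⊔n≤o⇒m≤o k l ≤j)))
           (x< i j (ℕ.m⊔n≤o⇒m≤o m n (ℕ.m⊔n≤o⇒n≤o k l ≤i)) (ℕ.m⊔n≤o⇒m≤o m n (ℕ.m⊔n≤o⇒n≤o k l ≤j)))
           (y< i j (ℕ.m⊔n≤o⇒n≤o m n (ℕ.m⊔n≤o⇒n≤o k l ≤i)) (ℕ.m⊔n≤o⇒n≤o m n (ℕ.m⊔n≤o⇒n≤o k l ≤j)))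

fromℚ : ℚ → ℝ
fromℚ p = (λ _ → p) , const-cauchy p

_+ʳ_ : ℝ → ℝ → ℝ
(x , x-cauchy) +ʳ (y , y-cauchy) = (λ i → x i ℚ.+ y i) , +-cauchy x y x-cauchy y-cauchy

-ʳ_ : ℝ → ℝ
-ʳ (x , x-cauchy) = (λ i → ℚ.- x i) , neg-cauchy x x-cauchy

_*ʳ_ : ℝ → ℝ → ℝ
(x , x-cauchy) *ʳ (y , y-cauchy) = (λ i → x i ℚ.* y i) , *-cauchy x y x-cauchy y-cauchy

pointwise : ∀ {x y} → (∀ i → approx x i ≡ approx y i) → x ≈ʳ y
pointwise {x} {y} x≗y .eventually ε 0<ε = 0 , λ i _ → ∣p-p∣<ε {approx x i} {approx y i} (x≗y i) 0<ε

private
  ≈ʳ-sym : ∀ {x y} → x ≈ʳ y → y ≈ʳ x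
  ≈ʳ-sym {x} {y} x≈y .eventually ε 0<ε =
    let n , x< = eventually x≈y ε 0<ε
    in n , λ i ≤i → ≡.subst (ℚ._< ε) (∣p-q∣≡∣q-p∣ (approx x i) (approx y i)) (x< i ≤i)

  ≈ʳ-trans : ∀ {x y z} → x ≈ʳ y → y ≈ʳ z → x ≈ʳ z
  ≈ʳ-trans {x} {y} {z} x≈y y≈z .eventually ε 0<ε =
    let m , x< = eventually x≈y (½ ℚ.* ε) (½ε 0<ε)
        n , y< = eventually y≈z (½ ℚ.* ε) (½ε 0<ε)
    in m ℕ.⊔ n , λ i ≤i → triangle (approx x i) (approx y i) (approx z i) ε
         (x< i (ℕ.m⊔n≤o⇒m≤o m n ≤i)) (y< i (ℕ.m⊔n≤o⇒n≤o m n ≤i))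

  +ʳ-cong : ∀ {x y u v} → x ≈ʳ y → u ≈ʳ v → (x +ʳ u) ≈ʳ (y +ʳ v)
  +ʳ-cong {x} {y} {u} {v} x≈y u≈v .eventually ε 0<ε =
    let m , x< = eventually x≈y (½ ℚ.* ε) (½ε 0<ε)
        n , u< = eventually u≈v (½ ℚ.* ε) (½ε 0<ε)
    in m ℕ.⊔ n , λ i ≤i → sum-close (approx x i) (approx u i) (approx y i) (approx v i) ε
         (x< i (ℕ.m⊔n≤o⇒m≤o m n ≤i)) (u< i (ℕ.m⊔n≤o⇒n≤o m n ≤i))

  -ʳ-cong : ∀ {x y} → x ≈ʳ y → (-ʳ x) ≈ʳ (-ʳ y)
  -ʳ-cong {x} {y} x≈y .eventually ε 0<ε =
    let n , x< = eventually x≈y ε 0<ε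
    in n , λ i ≤i → neg-close (approx x i) (approx y i) ε (x< i ≤i)

  *ʳ-cong : ∀ {x y u v} → x ≈ʳ y → u ≈ʳ v → (x *ʳ u) ≈ʳ (y *ʳ v)
  *ʳ-cong {x} {y} {u} {v} x≈y u≈v .eventually ε 0<ε =
    let K , k , 0<K , <K = bound₂ (approx x) (approx v) (isCauchy x) (isCauchy v)
        δ , 0<δ , Kδ = shrink K ε 0<K 0<ε
        m , x< = eventually x≈y δ 0<δ
        n , u< = eventually u≈v δ 0<δ
        l = m ℕ.⊔ n
    in k ℕ.⊔ l , λ i ≤i → product-close (approx x i) (approx u i) (approx y i) (approx v i) K δ ε 0<K Kδ
         (proj₁ (<K i (ℕ.m⊔n≤o⇒m≤o k l ≤i))) (proj₂ (<K i (ℕ.m⊔n≤o⇒m≤o k l ≤i)))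
         (x< i (ℕ.m⊔n≤o⇒m≤o m n (ℕ.m⊔n≤o⇒n≤o k l ≤i)))
         (u< i (ℕ.m⊔n≤o⇒n≤o m n (ℕ.m⊔n≤o⇒n≤o k l ≤i)))

ℝ-commutativeRing : CommutativeRing 0ℓ 0ℓ
ℝ-commutativeRing = record
  { Carrier = ℝ ; _≈_ = _≈ʳ_ ; _+_ = _+ʳ_ ; _*_ = _*ʳ_ ; -_ = -ʳ_
  ; 0# = fromℚ 0ℚ ; 1# = fromℚ 1ℚ
  ; isCommutativeRing = record
    { isRing = record
      { +-isAbelianGroup = record
        { isGroup = record
          { isMonoid = record
            { isSemigroup = record
              { isMagma = record
                { isEquivalence = record
                  { refl = pointwise λ _ → refl ; sym = ≈ʳ-sym ; trans = ≈ʳ-trans }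
                ; ∙-cong = +ʳ-cong }
              ; assoc = λ x y z → pointwise λ i → ℚ.+-assoc (approx x i) (approx y i) (approx z i) }
            ; identity = (λ x → pointwise λ i → ℚ.+-identityˡ (approx x i))
                       , (λ x → pointwise λ i → ℚ.+-identityʳ (approx x i)) }
          ; inverse = (λ x → pointwise λ i → ℚ.+-inverseˡ (approx x i))
                    , (λ x → pointwise λ i → ℚ.+-inverseʳ (approx x i))
          ; ⁻¹-cong = -ʳ-cong }
        ; comm = λ x y → pointwise λ i → ℚ.+-comm (approx x i) (approx y i) }
      ; *-cong = *ʳ-cong
      ; *-assoc = λ x y z → pointwise λ i → ℚ.*-assoc (approx x i) (approx y i) (approx z i)
      ; *-identity = (λ x → pointwise λ i → ℚ.*-identityˡ (approx x i))
                   , (λ x → pointwise λ i → ℚ.*-identityʳ (approx x i))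
      ; distrib = (λ x y z → pointwise λ i → ℚ.*-distribˡ-+ (approx x i) (approx y i) (approx z i))
                , (λ x y z → pointwise λ i → ℚ.*-distribʳ-+ (approx x i) (approx y i) (approx z i)) }
    ; *-comm = λ x y → pointwise λ i → ℚ.*-comm (approx x i) (approx y i) } }

module ℝ-Ring = CommutativeRing ℝ-commutativeRing

record ℂ : Set where
  constructor _+i_
  field
    re im : ℝ

open ℂ

record _≈ᶜ_ (x y : ℂ) : Set where
  constructor _,_
  field
    re-≈ : re x ≈ʳ re y
    im-≈ : im x ≈ʳ im y

open _≈ᶜ_

fromℝ : ℝ → ℂ
fromℝ x = x +i fromℚ 0ℚ

_+ᶜ_ : ℂ → ℂ → ℂ
(a +i b) +ᶜ (c +i d) = (a +ʳ c) +i (b +ʳ d)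

-ᶜ_ : ℂ → ℂ
-ᶜ (a +i b) = (-ʳ a) +i (-ʳ b)

_*ᶜ_ : ℂ → ℂ → ℂ
(a +i b) *ᶜ (c +i d) = (a *ʳ c +ʳ -ʳ (b *ʳ d)) +i (a *ʳ d +ʳ b *ʳ c)

private
  module ℂ-Laws where
    open Data.Rational.Base using (_+_; _*_; -_)

    assoc-re : ∀ a b c d e f → (a * c + - (b * d)) * e + - ((a * d + b * c) * f) ≡ a * (c * e + - (d * f)) + - (b * (c * f + d * e))
    assoc-re = solve-∀ ℚ-ring

    assoc-im : ∀ a b c d e f → (a * c + - (b * d)) * f + (a * d + b * c) * e ≡ a * (c * f + d * e) + b * (c * e + - (d * f))
    assoc-im = solve-∀ ℚ-ring

    distribˡ-re : ∀ a b c d e f → a * (c + e) + - (b * (d + f)) ≡ (a * c + - (b * d)) + (a * e + - (b * f))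
    distribˡ-re = solve-∀ ℚ-ring

    distribˡ-im : ∀ a b c d e f → a * (d + f) + b * (c + e) ≡ (a * d + b * c) + (a * f + b * e)
    distribˡ-im = solve-∀ ℚ-ring

    distribʳ-re : ∀ a b c d e f → (c + e) * a + - ((d + f) * b) ≡ (c * a + - (d * b)) + (e * a + - (f * b))
    distribʳ-re = solve-∀ ℚ-ring

    distribʳ-im : ∀ a b c d e f → (c + e) * b + (d + f) * a ≡ (c * b + d * a) + (e * b + f * a)
    distribʳ-im = solve-∀ ℚ-ring

    comm-re : ∀ a b c d → a * c + - (b * d) ≡ c * a + - (d * b)
    comm-re = solve-∀ ℚ-ring

    comm-im : ∀ a b c d → a * d + b * c ≡ c * b + d * a
    comm-im = solve-∀ ℚ-ring

    identityˡ-re : ∀ a b → 1ℚ * a + - (0ℚ * b) ≡ a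
    identityˡ-re = solve-∀ ℚ-ring

    identityˡ-im : ∀ a b → 1ℚ * b + 0ℚ * a ≡ b
    identityˡ-im = solve-∀ ℚ-ring

    identityʳ-re : ∀ a b → a * 1ℚ + - (b * 0ℚ) ≡ a
    identityʳ-re = solve-∀ ℚ-ring

    identityʳ-im : ∀ a b → a * 0ℚ + b * 1ℚ ≡ b
    identityʳ-im = solve-∀ ℚ-ring

ℂ-commutativeRing : CommutativeRing 0ℓ 0ℓ
ℂ-commutativeRing = record
  { Carrier = ℂ ; _≈_ = _≈ᶜ_ ; _+_ = _+ᶜ_ ; _*_ = _*ᶜ_ ; -_ = -ᶜ_
  ; 0# = fromℝ 0# ; 1# = fromℝ 1#
  ; isCommutativeRing = record
    { isRing = record
      { +-isAbelianGroup = record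
        { isGroup = record
          { isMonoid = record
            { isSemigroup = record
              { isMagma = record
                { isEquivalence = record
                  { refl = ℝ-Ring.refl , ℝ-Ring.refl
                  ; sym = λ x≈y → sym (re-≈ x≈y) , sym (im-≈ x≈y)
                  ; trans = λ x≈y y≈z → trans (re-≈ x≈y) (re-≈ y≈z) , trans (im-≈ x≈y) (im-≈ y≈z) }
                ; ∙-cong = λ x≈y u≈v → +-cong (re-≈ x≈y) (re-≈ u≈v) , +-cong (im-≈ x≈y) (im-≈ u≈v) }
              ; assoc = λ { (a +i b) (c +i d) (e +i f) → +-assoc a c e , +-assoc b d f } }
            ; identity = (λ { (a +i b) → +-identityˡ a , +-identityˡ b })
                       , (λ { (a +i b) → +-identityʳ a , +-identityʳ b }) }
          ; inverse = (λ { (a +i b) → -‿inverseˡ a , -‿inverseˡ b })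
                    , (λ { (a +i b) → -‿inverseʳ a , -‿inverseʳ b })
          ; ⁻¹-cong = λ x≈y → -‿cong (re-≈ x≈y) , -‿cong (im-≈ x≈y) }
        ; comm = λ { (a +i b) (c +i d) → +-comm a c , +-comm b d } }
      ; *-cong = λ x≈y u≈v →
          +-cong (*-cong (re-≈ x≈y) (re-≈ u≈v)) (-‿cong (*-cong (im-≈ x≈y) (im-≈ u≈v)))
        , +-cong (*-cong (re-≈ x≈y) (im-≈ u≈v)) (*-cong (im-≈ x≈y) (re-≈ u≈v))
      ; *-assoc = λ { (a +i b) (c +i d) (e +i f) →
            (pointwise λ i → assoc-re (approx a i) (approx b i) (approx c i) (approx d i) (approx e i) (approx f i))
          , (pointwise λ i → assoc-im (approx a i) (approx b i) (approx c i) (approx d i) (approx e i) (approx f i)) }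
      ; *-identity = (λ { (a +i b) →
            (pointwise λ i → identityˡ-re (approx a i) (approx b i))
          , (pointwise λ i → identityˡ-im (approx a i) (approx b i)) })
                   , (λ { (a +i b) →
                         (pointwise λ i → identityʳ-re (approx a i) (approx b i))
                       , (pointwise λ i → identityʳ-im (approx a i) (approx b i)) })
      ; distrib = (λ { (a +i b) (c +i d) (e +i f) →
            (pointwise λ i → distribˡ-re (approx a i) (approx b i) (approx c i) (approx d i) (approx e i) (approx f i))
          , (pointwise λ i → distribˡ-im (approx a i) (approx b i) (approx c i) (approx d i) (approx e i) (approx f i)) })
                , (λ { (a +i b) (c +i d) (e +i f) →
                      (pointwise λ i → distribʳ-re (approx a i) (approx b i) (approx c i) (approx d i) (approx e i) (approx f i))
                    , (pointwise λ i → distribʳ-im (approx a i) (approx b i) (approx c i) (approx d i) (approx e i) (approx f i)) }) }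
    ; *-comm = λ { (a +i b) (c +i d) →
          (pointwise λ i → comm-re (approx a i) (approx b i) (approx c i) (approx d i))
        , (pointwise λ i → comm-im (approx a i) (approx b i) (approx c i) (approx d i)) } } }
  where
  open ℝ-Ring hiding (refl)
  open ℂ-Laws

module ℂ-Ring = CommutativeRing ℂ-commutativeRing

private variable
  c ℓ₁ ℓ₂ m ℓm p : Level

-- A finite field is a Heyting field in bijection with Fin q; over a finite
-- carrier, equality is decidable and apartness is its negation.
scalars : HeytingField c ℓ₁ ℓ₂ → CommutativeRing c ℓ₁
scalars F = HeytingCommutativeRing.commutativeRing (HeytingField.heytingCommutativeRing F)

VectorSpace : (F : HeytingField c ℓ₁ ℓ₂) (m ℓm : Level) → Set (c ⊔ ℓ₁ ⊔ Level.suc (m ⊔ ℓm))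
VectorSpace F = Module (scalars F)

_HasOrder_ : HeytingField c ℓ₁ ℓ₂ → ℕ → Set _
F HasOrder q = Inverse (HeytingField.setoid F) (≡.setoid (Fin q))

module LinearAlgebra (F : HeytingField c ℓ₁ ℓ₂) (H : VectorSpace F m ℓm) where
  open HeytingField F
  open Module H
  open RawMonoid +ᴹ-rawMonoid using (sum)

  linearCombination : ∀ {k} → Vector Carrier k → Vector Carrierᴹ k → Carrierᴹ
  linearCombination a v = sum λ i → a i *ₗ v i

  LinearlyIndependent : ∀ {k} → Vector Carrierᴹ k → Set _
  LinearlyIndependent v = ∀ a → linearCombination a v ≈ᴹ 0ᴹ → ∀ i → a i ≈ 0#

  _∈Span_ : ∀ {k} → Carrierᴹ → Vector Carrierᴹ k → Set _
  x ∈Span v = ∃ λ a → x ≈ᴹ linearCombination a v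

  record IsBasisOf {k} (P : Pred Carrierᴹ p) (v : Vector Carrierᴹ k) : Set (c ⊔ ℓ₁ ⊔ m ⊔ ℓm ⊔ p) where
    field
      inside      : ∀ i → P (v i)
      independent : LinearlyIndependent v
      spanning    : ∀ {x} → P x → x ∈Span v

  HasDimension : Pred Carrierᴹ p → ℕ → Set _
  HasDimension P k = ∃ λ (v : Vector Carrierᴹ k) → IsBasisOf P v

  -- Subspaces of a finite space are decidable, so membership is Bool-valued.
  record Subspace : Set (c ⊔ m ⊔ ℓm) where
    field
      member?   : Carrierᴹ → Bool
      resp      : ∀ {x y} → x ≈ᴹ y → T (member? x) → T (member? y)
      0-closed  : T (member? 0ᴹ)
      +-closed  : ∀ {x y} → T (member? x) → T (member? y) → T (member? (x +ᴹ y))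
      *ₗ-closed : ∀ a {x} → T (member? x) → T (member? (a *ₗ x))

  infix 4 _∈_ _⊆_ _≐_

  _∈_ : Carrierᴹ → Subspace → Set
  x ∈ y = T (Subspace.member? y x)

  _⊆_ : Subspace → Subspace → Set m
  y ⊆ z = ∀ {x} → x ∈ y → x ∈ z

  record _≐_ (y z : Subspace) : Set m where
    constructor _,_
    field
      ⊆-to   : y ⊆ z
      ⊆-from : z ⊆ y

  MeetTrivially : Subspace → Subspace → Set (m ⊔ ℓm)
  MeetTrivially y z = ∀ x → x ∈ y → x ∈ z → x ≈ᴹ 0ᴹ

  ≐-setoid : Setoid _ _
  ≐-setoid = record
    { _≈_ = _≐_
    ; isEquivalence = record
      { refl  = id , id
      ; sym   = λ (f , g) → g , f
      ; trans = λ (f , g) (h , k) → (λ x∈ → h (f x∈)) , (λ x∈ → g (k x∈)) } }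

module FiniteLinearAlgebra
  (F : HeytingField c ℓ₁ ℓ₂) {q : ℕ} (∣F∣≡q : F HasOrder q)
  (H : VectorSpace F m ℓm) {n : ℕ} (dimH : LinearAlgebra.HasDimension F H U n)
  where

  open HeytingField F hiding (zero) renaming (refl to ≈-refl; sym to ≈-sym; trans to ≈-trans; setoid to ≈-setoid)
  open CommutativeRing (scalars F) using (ring)
  open Module H
  open LinearAlgebra F H
  open Inverse ∣F∣≡q using (to; from; to-cong; strictlyInverseˡ; strictlyInverseʳ)
  open import Algebra.Properties.Ring ring using (-1*x≈-x; -‿distribˡ-*; -0#≈0#; x∙y⁻¹≈ε⇒x≈y)
  open import Algebra.Properties.CommutativeMonoid.Sum +ᴹ-commutativeMonoid using (sum-cong-≋)
  open CommutativeMonoid +ᴹ-commutativeMonoid using (commutativeSemigroup)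
  open import Algebra.Properties.CommutativeSemigroup commutativeSemigroup using (interchange)
  open SetoidReasoning ≈ᴹ-setoid

  e : Vector Carrierᴹ n
  e = proj₁ dimH

  open IsBasisOf (proj₂ dimH) renaming (independent to e-independent; spanning to e-spanning)

  1#0 : 1# # 0#
  1#0 = invertible⇒# (1# , ≈-trans (*-identityˡ _) 1-0≈1 , ≈-trans (*-identityʳ _) 1-0≈1)
    where
    1-0≈1 : 1# - 0# ≈ 1#
    1-0≈1 = ≈-trans (+-congˡ -0#≈0#) (+-identityʳ 1#)

  0≉1 : ¬ 0# ≈ 1#
  0≉1 0≈1 = #-irrefl (≈-sym 0≈1) 1#0

  lc-cong : ∀ {k} {a b : Vector Carrier k} (v : Vector Carrierᴹ k) → (∀ i → a i ≈ b i) →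
            linearCombination a v ≈ᴹ linearCombination b v
  lc-cong v a≈b = sum-cong-≋ λ i → *ₗ-congʳ (a≈b i)

  lc-+ : ∀ {k} (a b : Vector Carrier k) (v : Vector Carrierᴹ k) →
         linearCombination (λ i → a i + b i) v ≈ᴹ linearCombination a v +ᴹ linearCombination b v
  lc-+ {zero}  a b v = ≈ᴹ-sym (+ᴹ-identityˡ 0ᴹ)
  lc-+ {suc k} a b v = ≈ᴹ-trans
    (+ᴹ-cong (*ₗ-distribʳ (v zero) (a zero) (b zero)) (lc-+ (a ∘ suc) (b ∘ suc) (v ∘ suc)))
    (interchange _ _ _ _)

  lc-* : ∀ {k} s (a : Vector Carrier k) (v : Vector Carrierᴹ k) →
         linearCombination (λ i → s * a i) v ≈ᴹ s *ₗ linearCombination a v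
  lc-* {zero}  s a v = ≈ᴹ-sym (*ₗ-zeroʳ s)
  lc-* {suc k} s a v = ≈ᴹ-trans
    (+ᴹ-cong (*ₗ-assoc s (a zero) (v zero)) (lc-* s (a ∘ suc) (v ∘ suc)))
    (≈ᴹ-sym (*ₗ-distribˡ s _ _))

  x+-1x≈0 : ∀ x → x +ᴹ (- 1#) *ₗ x ≈ᴹ 0ᴹ
  x+-1x≈0 x = begin
    x +ᴹ (- 1#) *ₗ x          ≈⟨ +ᴹ-congʳ (*ₗ-identityˡ x) ⟨
    1# *ₗ x +ᴹ (- 1#) *ₗ x    ≈⟨ *ₗ-distribʳ x 1# (- 1#) ⟨
    (1# - 1#) *ₗ x            ≈⟨ *ₗ-congʳ (-‿inverseʳ 1#) ⟩
    0# *ₗ x                   ≈⟨ *ₗ-zeroˡ x ⟩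
    0ᴹ                        ∎

  lc-injective : ∀ {k} {v : Vector Carrierᴹ k} → LinearlyIndependent v → ∀ {a b} →
                 linearCombination a v ≈ᴹ linearCombination b v → ∀ i → a i ≈ b i
  lc-injective {v = v} v-independent {a} {b} eq i =
    x∙y⁻¹≈ε⇒x≈y (a i) (b i) (≈-trans (+-congˡ (≈-sym (-1*x≈-x (b i)))) (v-independent (λ i → a i + - 1# * b i) a-b≈0 i))
    where
    a-b≈0 : linearCombination (λ i → a i + - 1# * b i) v ≈ᴹ 0ᴹ
    a-b≈0 = begin
      linearCombination (λ i → a i + - 1# * b i) v                   ≈⟨ lc-+ a (λ i → - 1# * b i) v ⟩
      linearCombination a v +ᴹ linearCombination (λ i → - 1# * b i) v ≈⟨ +ᴹ-cong eq (lc-* (- 1#) b v) ⟩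
      linearCombination b v +ᴹ (- 1#) *ₗ linearCombination b v       ≈⟨ x+-1x≈0 _ ⟩
      0ᴹ                                                             ∎

  decode : ∀ {k} → Fin (q ℕ.^ k) → Vector Carrier k
  decode i = from ∘ finToFun i

  encode : ∀ {k} → Vector Carrier k → Fin (q ℕ.^ k)
  encode a = funToFin (to ∘ a)

  decode-encode : ∀ {k} (a : Vector Carrier k) i → decode (encode a) i ≈ a i
  decode-encode a i = ≈-trans (Inverse.from-cong ∣F∣≡q (Fin.finToFun-funToFin (to ∘ a) i)) (strictlyInverseʳ (a i))

  funToFin-cong : ∀ {j k} {f g : Fin j → Fin k} → (∀ i → f i ≡ g i) → funToFin f ≡ funToFin g
  funToFin-cong {zero}  f≗g = refl
  funToFin-cong {suc j} f≗g = ≡.cong₂ Fin.combine (f≗g zero) (funToFin-cong (f≗g ∘ suc))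

  encode-cong : ∀ {k} {a b : Vector Carrier k} → (∀ i → a i ≈ b i) → encode a ≡ encode b
  encode-cong a≈b = funToFin-cong (λ i → to-cong (a≈b i))

  encode-decode : ∀ {k} (i : Fin (q ℕ.^ k)) → encode {k} (decode i) ≡ i
  encode-decode {k} i = ≡.trans (funToFin-cong (λ j → strictlyInverseˡ (finToFun {q} {k} i j))) (Fin.funToFin-finToFin {k} {q} i)

  vector : Fin (q ℕ.^ n) → Carrierᴹ
  vector i = linearCombination (decode i) e

  index : Carrierᴹ → Fin (q ℕ.^ n)
  index x = encode (proj₁ (e-spanning {x} _))

  vector-index : ∀ x → vector (index x) ≈ᴹ x
  vector-index x = let a , x≈ = e-spanning {x} _ in
    ≈ᴹ-trans (lc-cong e (decode-encode a)) (≈ᴹ-sym x≈)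

  index-cong : ∀ {x y} → x ≈ᴹ y → index x ≡ index y
  index-cong {x} {y} x≈y = let a , x≈ = e-spanning {x} _ ; b , y≈ = e-spanning {y} _ in
    encode-cong (lc-injective e-independent (≈ᴹ-trans (≈ᴹ-sym x≈) (≈ᴹ-trans x≈y y≈)))

  index-injective : ∀ {x y} → index x ≡ index y → x ≈ᴹ y
  index-injective {x} {y} eq = ≈ᴹ-trans (≈ᴹ-sym (vector-index x))
    (≈ᴹ-trans (≈ᴹ-reflexive (≡.cong vector eq)) (vector-index y))

  index-vector : ∀ i → index (vector i) ≡ i
  index-vector i = let a , x≈ = e-spanning {vector i} _ in
    ≡.trans (encode-cong (lc-injective e-independent (≈ᴹ-sym x≈))) (encode-decode {n} i)

  _≟_ : ∀ a b → Dec (a ≈ b)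
  a ≟ b = map′
    (λ eq → ≈-trans (≈-sym (strictlyInverseʳ a)) (≈-trans (Inverse.from-cong ∣F∣≡q eq) (strictlyInverseʳ b)))
    to-cong (to a Fin.≟ to b)

  _≟ᴹ_ : ∀ x y → Dec (x ≈ᴹ y)
  x ≟ᴹ y = map′ index-injective index-cong (index x Fin.≟ index y)

  ∃ᴷ? : ∀ {k p} {P : Pred (Vector Carrier k) p} → (∀ {a b} → (∀ i → a i ≈ b i) → P a → P b) →
        Decidable P → Dec (∃ P)
  ∃ᴷ? P-resp P? = map′ (λ (i , Pi) → decode i , Pi)
    (λ (a , Pa) → encode a , P-resp (λ i → ≈-sym (decode-encode a i)) Pa) (Fin.any? (P? ∘ decode))

  ∃ᴹ? : ∀ {p} {P : Pred Carrierᴹ p} → (∀ {x y} → x ≈ᴹ y → P x → P y) → Decidable P → Dec (∃ P)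
  ∃ᴹ? P-resp P? = map′ (λ (i , Pi) → vector i , Pi)
    (λ (x , Px) → index x , P-resp (≈ᴹ-sym (vector-index x)) Px) (Fin.any? (P? ∘ vector))

  ∀ᴹ? : ∀ {p} {P : Pred Carrierᴹ p} → (∀ {x y} → x ≈ᴹ y → P x → P y) → Decidable P → Dec (∀ x → P x)
  ∀ᴹ? P-resp P? = map′ (λ ∀P x → P-resp (vector-index x) (∀P (index x))) (λ ∀P i → ∀P (vector i))
    (Fin.all? (P? ∘ vector))

  ∀? : ∀ {p} {P : Pred Carrier p} → (∀ {x y} → x ≈ y → P x → P y) → Decidable P → Dec (∀ x → P x)
  ∀? P-resp P? = map′ (λ ∀P x → P-resp (strictlyInverseʳ x) (∀P (to x))) (λ ∀P i → ∀P (from i))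
    (Fin.all? (P? ∘ from))

  _∈Span?_ : ∀ {k} x (v : Vector Carrierᴹ k) → Dec (x ∈Span v)
  x ∈Span? v = ∃ᴷ? (λ a≈b x≈ → ≈ᴹ-trans x≈ (lc-cong v a≈b)) (λ a → x ≟ᴹ linearCombination a v)

  1<q : 1 < q
  1<q = helper (to 0#) (to 1#) λ eq → 0≉1
    (≈-trans (≈-sym (strictlyInverseʳ 0#)) (≈-trans (Inverse.from-cong ∣F∣≡q eq) (strictlyInverseʳ 1#)))
    where
    helper : ∀ {q} (i j : Fin q) → ¬ i ≡ j → 1 < q
    helper {suc zero}    zero zero i≢j = contradiction refl i≢j
    helper {suc (suc _)} _    _    _   = ℕ.s≤s (ℕ.s≤s ℕ.z≤n)

  independent⇒≤ : ∀ {k} {v : Vector Carrierᴹ k} → LinearlyIndependent v → k ≤ n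
  independent⇒≤ {k} {v} v-independent = ℕ.≮⇒≥ λ n<k →
    ℕ.<⇒≱ (ℕ.^-monoʳ-< q 1<q n<k) (Fin.injective⇒≤ {f = f} f-injective)
    where
    f : Fin (q ℕ.^ k) → Fin (q ℕ.^ n)
    f i = index (linearCombination (decode i) v)
    f-injective : ∀ {i j} → f i ≡ f j → i ≡ j
    f-injective {i} {j} eq = ≡.trans (≡.sym (encode-decode {k} i))
      (≡.trans (encode-cong (lc-injective v-independent (index-injective eq))) (encode-decode {k} j))

  invert : ∀ {a} → ¬ a ≈ 0# → ∃ λ b → b * a ≈ 1#
  invert {a} a≉0 with Fin.any? (λ i → (from i * a) ≟ 1#)
  ... | yes (i , ia≈1) = from i , ia≈1
  ... | no ¬inv = contradiction (proj₁ (tight a 0#) ¬a#0) a≉0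
    where
    ¬a#0 : ¬ a # 0#
    ¬a#0 a#0 = let b , b*[a-0]≈1 , _ = #⇒invertible a#0 in
      ¬inv (to b , ≈-trans (*-cong (strictlyInverseʳ b) (≈-sym (≈-trans (+-congˡ -0#≈0#) (+-identityʳ a)))) b*[a-0]≈1)

  extend-independent : ∀ {k x} {v : Vector Carrierᴹ k} → LinearlyIndependent v → ¬ x ∈Span v →
                       LinearlyIndependent (x ◂ v)
  extend-independent {k} {x} {v} v-independent x∉ a eq = go (a zero ≟ 0#)
    where
    w : Carrierᴹ
    w = linearCombination (a ∘ suc) v
    go : Dec (a zero ≈ 0#) → ∀ i → a i ≈ 0#
    go (yes a₀≈0) zero    = a₀≈0
    go (yes a₀≈0) (suc i) = v-independent (a ∘ suc) (begin
      w                   ≈⟨ +ᴹ-identityˡ w ⟨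
      0ᴹ +ᴹ w             ≈⟨ +ᴹ-congʳ (≈ᴹ-trans (*ₗ-congʳ a₀≈0) (*ₗ-zeroˡ x)) ⟨
      a zero *ₗ x +ᴹ w    ≈⟨ eq ⟩
      0ᴹ                  ∎) i
    go (no a₀≉0) = let b , ba₀≈1 = invert a₀≉0 in contradiction ((λ i → - b * a (suc i)) , (begin
      x                                                  ≈⟨ +ᴹ-identityʳ x ⟨
      x +ᴹ 0ᴹ                                            ≈⟨ +ᴹ-congˡ (*ₗ-zeroʳ (- b)) ⟨
      x +ᴹ (- b) *ₗ 0ᴹ                                   ≈⟨ +ᴹ-congˡ (*ₗ-congˡ eq) ⟨
      x +ᴹ (- b) *ₗ (a zero *ₗ x +ᴹ w)                   ≈⟨ +ᴹ-congˡ (*ₗ-distribˡ (- b) _ w) ⟩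
      x +ᴹ ((- b) *ₗ a zero *ₗ x +ᴹ (- b) *ₗ w)          ≈⟨ +ᴹ-congˡ (+ᴹ-congʳ (*ₗ-assoc (- b) (a zero) x)) ⟨
      x +ᴹ ((- b * a zero) *ₗ x +ᴹ (- b) *ₗ w)           ≈⟨ +ᴹ-congˡ (+ᴹ-congʳ (*ₗ-congʳ (≈-trans (≈-sym (-‿distribˡ-* b (a zero))) (-‿cong ba₀≈1)))) ⟩
      x +ᴹ ((- 1#) *ₗ x +ᴹ (- b) *ₗ w)                   ≈⟨ +ᴹ-assoc x _ _ ⟨
      (x +ᴹ (- 1#) *ₗ x) +ᴹ (- b) *ₗ w                   ≈⟨ +ᴹ-congʳ (x+-1x≈0 x) ⟩
      0ᴹ +ᴹ (- b) *ₗ w                                   ≈⟨ +ᴹ-identityˡ _ ⟩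
      (- b) *ₗ w                                         ≈⟨ lc-* (- b) (a ∘ suc) v ⟨
      linearCombination (λ i → - b * a (suc i)) v        ∎)) x∉

  grow : ∀ (y : Subspace) fuel {k} (v : Vector Carrierᴹ k) → n < k ℕ.+ fuel →
         (∀ i → v i ∈ y) → LinearlyIndependent v → ∃ (HasDimension (_∈ y))
  grow y zero {k} v n<k v∈y v-independent =
    contradiction (independent⇒≤ v-independent) (ℕ.<⇒≱ (≡.subst (n <_) (ℕ.+-identityʳ k) n<k))
  grow y (suc fuel) {k} v n<k v∈y v-independent with
    ∃ᴹ? (λ x≈x′ (x∈y , x∉) → Subspace.resp y x≈x′ x∈y , λ (a , x′≈) → x∉ (a , ≈ᴹ-trans x≈x′ x′≈))
        (λ x → T? (Subspace.member? y x) ×-dec ¬? (x ∈Span? v))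
  ... | yes (x , x∈y , x∉) =
    grow y fuel (x ◂ v) (≡.subst (n <_) (ℕ.+-suc k fuel) n<k)
      (λ { zero → x∈y ; (suc i) → v∈y i }) (extend-independent v-independent x∉)
  ... | no ¬∃ = k , v , record
    { inside      = v∈y
    ; independent = v-independent
    ; spanning    = λ {x} x∈y → decidable-stable (x ∈Span? v) λ x∉ → ¬∃ (x , x∈y , x∉)
    }

  abstract
    hasDimension : ∀ y → ∃ (HasDimension (_∈ y))
    hasDimension y = grow y (suc n) {0} (λ ()) ℕ.≤-refl (λ ()) (λ _ _ ())

    _⊆?_ : ∀ y z → Dec (y ⊆ z)
    y ⊆? z = map′ (λ f {x} → f x) (λ f x → f {x}) (∀ᴹ?
      (λ x≈x′ f x′∈y → Subspace.resp z x≈x′ (f (Subspace.resp y (≈ᴹ-sym x≈x′) x′∈y)))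
      (λ x → T? (Subspace.member? y x) →-dec T? (Subspace.member? z x)))

    meetTrivially? : ∀ y z → Dec (MeetTrivially y z)
    meetTrivially? y z = ∀ᴹ?
      (λ x≈x′ f x′∈y x′∈z → ≈ᴹ-trans (≈ᴹ-sym x≈x′)
        (f (Subspace.resp y (≈ᴹ-sym x≈x′) x′∈y) (Subspace.resp z (≈ᴹ-sym x≈x′) x′∈z)))
      (λ x → T? (Subspace.member? y x) →-dec (T? (Subspace.member? z x) →-dec x ≟ᴹ 0ᴹ))

  dim : Subspace → ℕ
  dim y = proj₁ (hasDimension y)

  dim-basis : ∀ y → HasDimension (_∈ y) (dim y)
  dim-basis y = proj₂ (hasDimension y)

  _≐?_ : ∀ y z → Dec (y ≐ z)
  y ≐? z with y ⊆? z | z ⊆? y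
  ... | yes y⊆z | yes z⊆y = yes (y⊆z , z⊆y)
  ... | no y⊈z  | _       = no λ y≐z → y⊈z (_≐_.⊆-to y≐z)
  ... | _       | no z⊈y  = no λ y≐z → z⊈y (_≐_.⊆-from y≐z)

  ≐-decSetoid : DecSetoid _ _
  ≐-decSetoid = record
    { isDecEquivalence = record
      { isEquivalence = Setoid.isEquivalence ≐-setoid
      ; _≟_ = _≐?_ } }

  subset : Fin (2 ℕ.^ (q ℕ.^ n)) → Carrierᴹ → Bool
  subset s x = Inverse.to Fin.2↔Bool (finToFun s (index x))

  subset-resp : ∀ s {x y} → x ≈ᴹ y → T (subset s x) → T (subset s y)
  subset-resp s x≈y = ≡.subst (λ i → T (Inverse.to Fin.2↔Bool (finToFun s i))) (index-cong x≈y)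

  Closed : (Carrierᴹ → Bool) → Set _
  Closed f = T (f 0ᴹ) × (∀ x y → T (f x) → T (f y) → T (f (x +ᴹ y))) × (∀ a x → T (f x) → T (f (a *ₗ x)))

  closed? : ∀ s → Dec (Closed (subset s))
  closed? s = T? _
    ×-dec ∀ᴹ? (λ x≈x′ f y x′∈ y∈ → subset-resp s (+ᴹ-congʳ x≈x′) (f y (subset-resp s (≈ᴹ-sym x≈x′) x′∈) y∈))
            (λ x → ∀ᴹ? (λ y≈y′ f x∈ y′∈ → subset-resp s (+ᴹ-congˡ y≈y′) (f x∈ (subset-resp s (≈ᴹ-sym y≈y′) y′∈)))
                     (λ y → T? _ →-dec (T? _ →-dec T? _)))
    ×-dec ∀? (λ a≈a′ f x x∈ → subset-resp s (*ₗ-congʳ a≈a′) (f x x∈))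
            (λ a → ∀ᴹ? (λ x≈x′ f x′∈ → subset-resp s (*ₗ-congˡ x≈x′) (f (subset-resp s (≈ᴹ-sym x≈x′) x′∈)))
                     (λ x → T? _ →-dec T? _))

  fromSubset : Fin (2 ℕ.^ (q ℕ.^ n)) → Maybe Subspace
  fromSubset s = Maybe.map
    (λ (0∈ , +∈ , *∈) → record
      { member? = subset s ; resp = subset-resp s ; 0-closed = 0∈
      ; +-closed = +∈ _ _ ; *ₗ-closed = λ a → *∈ a _ })
    (dec⇒maybe (closed? s))

  subspaces : List Subspace
  subspaces = List.mapMaybe fromSubset (List.allFin (2 ℕ.^ (q ℕ.^ n)))

  ∈-subspaces : ∀ y → Any (y ≐_) subspaces
  ∈-subspaces y = AnyProperties.mapMaybe⁺ fromSubset _ (AnyProperties.map⁺ (AnyProperties.tabulate⁺ s found))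
    where
    s : Fin (2 ℕ.^ (q ℕ.^ n))
    s = funToFin (λ i → Inverse.from Fin.2↔Bool (Subspace.member? y (vector i)))

    subset≡ : ∀ x → subset s x ≡ Subspace.member? y (vector (index x))
    subset≡ x = ≡.trans (≡.cong (Inverse.to Fin.2↔Bool) (Fin.finToFun-funToFin _ (index x)))
                        (Inverse.strictlyInverseˡ Fin.2↔Bool _)

    y⇒s : ∀ x → x ∈ y → T (subset s x)
    y⇒s x x∈y = ≡.subst T (≡.sym (subset≡ x)) (Subspace.resp y (≈ᴹ-sym (vector-index x)) x∈y)

    s⇒y : ∀ x → T (subset s x) → x ∈ y
    s⇒y x x∈s = Subspace.resp y (vector-index x) (≡.subst T (subset≡ x) x∈s)

    found : MaybeAny (y ≐_) (fromSubset s)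
    found with closed? s
    ... | yes _ = just (y⇒s _ , s⇒y _)
    ... | no ¬closed = contradiction
      ( y⇒s _ (Subspace.0-closed y)
      , (λ x x′ x∈ x′∈ → y⇒s _ (Subspace.+-closed y (s⇒y x x∈) (s⇒y x′ x′∈)))
      , (λ a x x∈ → y⇒s _ (Subspace.*ₗ-closed y a (s⇒y x x∈)))) ¬closed

module Matrices (n : ℕ) where
  open ℂ-Ring
  open import Algebra.Properties.Semiring.Sum semiring using (sum)

  Vec Mat : Set
  Vec = Fin n → ℂ
  Mat = Fin n → Fin n → ℂ

  infix 4 _≈ⱽ_ _≈ᴹ_
  infixl 6 _+ⱽ_ _+ᴹ_
  infixl 7 _*ᴹ_
  infixr 7 _·_ _∙ⱽ_ _∙ᴹ_

  _≈ⱽ_ : Vec → Vec → Set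
  u ≈ⱽ v = ∀ y → u y ≈ v y

  _≈ᴹ_ : Mat → Mat → Set
  B ≈ᴹ C = ∀ y z → B y z ≈ C y z

  0ⱽ : Vec
  0ⱽ y = 0#

  _+ⱽ_ : Vec → Vec → Vec
  (u +ⱽ v) y = u y + v y

  _∙ⱽ_ : ℂ → Vec → Vec
  (a ∙ⱽ v) y = a * v y

  _·_ : Mat → Vec → Vec
  (B · v) y = sum λ z → B y z * v z

  1ᴹ : Mat
  1ᴹ y z = if does (y Fin.≟ z) then 1# else 0#

  _+ᴹ_ _*ᴹ_ : Mat → Mat → Mat
  (B +ᴹ C) y z = B y z + C y z
  (B *ᴹ C) y z = sum λ x → B y x * C x z

  _∙ᴹ_ : ℂ → Mat → Mat
  (a ∙ᴹ B) y z = a * B y z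

  sumᴹ : ∀ {k} → (Fin k → Mat) → Mat
  sumᴹ B y z = sum λ i → B i y z

  diagonal : Vec → Mat
  diagonal d y z = if does (y Fin.≟ z) then d y else 0#

  Span : ∀ {k} → (Fin k → Mat) → Pred Mat 0ℓ
  Span {k} B C = ∃ λ (a : Fin k → ℂ) → C ≈ᴹ sumᴹ (λ i → a i ∙ᴹ B i)

  data Subalgebra⟨_⟩ (B : Mat) : Pred Mat 0ℓ where
    generator : Subalgebra⟨ B ⟩ B
    unit      : Subalgebra⟨ B ⟩ 1ᴹ
    add       : ∀ {C D} → Subalgebra⟨ B ⟩ C → Subalgebra⟨ B ⟩ D → Subalgebra⟨ B ⟩ (C +ᴹ D)
    multiply  : ∀ {C D} → Subalgebra⟨ B ⟩ C → Subalgebra⟨ B ⟩ D → Subalgebra⟨ B ⟩ (C *ᴹ D)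
    scale     : ∀ a {C} → Subalgebra⟨ B ⟩ C → Subalgebra⟨ B ⟩ (a ∙ᴹ C)
    respects  : ∀ {C D} → C ≈ᴹ D → Subalgebra⟨ B ⟩ C → Subalgebra⟨ B ⟩ D

  Eigenspace : Mat → ℂ → Pred Vec 0ℓ
  Eigenspace B θ v = B · v ≈ⱽ θ ∙ⱽ v

  IsZero : Pred Vec 0ℓ
  IsZero v = v ≈ⱽ 0ⱽ

  infixl 6 _⊞_
  _⊞_ : Pred Vec 0ℓ → Pred Vec 0ℓ → Pred Vec 0ℓ
  (V ⊞ W) v = ∃ λ u → ∃ λ w → V u × W w × v ≈ⱽ u +ⱽ w

  -- V₀, …, V₍ₖ₋₁₎ extended by the zero space to all integer indices.
  at : ∀ {k} → (Fin k → Pred Vec 0ℓ) → ℤ → Pred Vec 0ℓ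
  at {k} V (+ i) with i ℕ.<? k
  ... | yes i<k = V (Fin.fromℕ< i<k)
  ... | no _ = IsZero
  at V -[1+ _ ] = IsZero

  Generates : Mat → Pred Mat 0ℓ → Set
  Generates B 𝒞 = ∀ C → Subalgebra⟨ B ⟩ C ⇔ 𝒞 C

  ActsTridiagonally : ∀ {k} → Mat → (Fin k → Pred Vec 0ℓ) → Set
  ActsTridiagonally B V = ∀ i v → V i v → (at V (ℤ.pred (+ toℕ i)) ⊞ V i ⊞ at V (ℤ.suc (+ toℕ i))) (B · v)

-- The index set {0, 1/2, 1, …, N}: the left summand holds the integers i, the
-- right one the half-integers i + 1/2; `twice` is multiplication by 2.
HalfIntegers : ℕ → Set
HalfIntegers N = Fin (suc N) ⊎ Fin N

twice : ∀ {N} → HalfIntegers N → ℕ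
twice = [ (λ i → 2 ℕ.* toℕ i) , (λ i → suc (2 ℕ.* toℕ i)) ]′

Ordering : ℕ → Set
Ordering N = Fin (suc (2 ℕ.* N)) ↔ HalfIntegers N

-- 0 < 1 < ⋯ < N < 1/2 < 3/2 < ⋯ < N - 1/2, respectively
-- 1/2 < 3/2 < ⋯ < N - 1/2 < 0 < 1 < ⋯ < N.
integersFirst halvesFirst : ∀ N → Ordering N
integersFirst N = Fin.+↔⊎ ↔-∘ cast-id (≡.cong (λ n → suc (N ℕ.+ n)) (ℕ.+-identityʳ N))
halvesFirst N = ⊎-comm _ _ ↔-∘ (Fin.+↔⊎ ↔-∘ cast-id (≡.trans (≡.cong (λ n → suc (N ℕ.+ n)) (ℕ.+-identityʳ N)) (≡.sym (ℕ.+-suc N N))))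

module AttenuatedSpace
  (F : HeytingField c ℓ₁ ℓ₂) {q : ℕ} (∣F∣≡q : F HasOrder q)
  {N M : ℕ} (H : VectorSpace F m ℓm) (dimH : LinearAlgebra.HasDimension F H U (N ℕ.+ M))
  (h : LinearAlgebra.Subspace F H)
  where

  open LinearAlgebra F H
  open FiniteLinearAlgebra F ∣F∣≡q H dimH

  private
    lookup-injective : ∀ {xs} → Unique.Unique ≐-setoid xs → ∀ i j → lookup xs i ≐ lookup xs j → i ≡ j
    lookup-injective {_ ∷ _} (x∉ ∷ _) Fin.zero    Fin.zero    eq = refl
    lookup-injective {_ ∷ _} (x∉ ∷ _) Fin.zero    (Fin.suc j) eq = contradiction eq (All.lookup x∉ (∈-lookup j))
    lookup-injective {_ ∷ _} (x∉ ∷ _) (Fin.suc i) Fin.zero    eq = contradiction (Setoid.sym ≐-setoid eq) (All.lookup x∉ (∈-lookup i))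
    lookup-injective {_ ∷ _} (_ ∷ xs) (Fin.suc i) (Fin.suc j) eq = ≡.cong Fin.suc (lookup-injective xs i j eq)

    resp : ∀ {y z} → y ≐ z → MeetTrivially y h → MeetTrivially z h
    resp y≐z y∩h≡0 x x∈z x∈h = y∩h≡0 x (_≐_.⊆-from y≐z x∈z) x∈h

    module Mem = Data.List.Membership.Setoid ≐-setoid

  abstract
    members : List Subspace
    members = List.deduplicate _≐?_ (List.filter (λ y → meetTrivially? y h) subspaces)

  -- The poset is indexed by a duplicate-free enumeration of its elements, so
  -- that matrices and vectors indexed by it are functions on a finite type.
  X : Set
  X = Fin (length members)

  ⟦_⟧ : X → Subspace
  ⟦_⟧ = lookup members

  abstract
    ⟦⟧-injective : ∀ y z → ⟦ y ⟧ ≐ ⟦ z ⟧ → y ≡ z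
    ⟦⟧-injective = lookup-injective (deduplicate-! ≐-decSetoid (List.filter (λ y → meetTrivially? y h) subspaces))

    ⟦⟧-meets-trivially : ∀ y → MeetTrivially ⟦ y ⟧ h
    ⟦⟧-meets-trivially y = proj₂ (Membership.∈-filter⁻ ≐-setoid (λ z → meetTrivially? z h) resp {xs = subspaces}
      (Membership.∈-deduplicate⁻ ≐-setoid _≐?_ _ (Membership.∈-lookup ≐-setoid _ y)))

    ⟦⟧-surjective : ∀ y → MeetTrivially y h → ∃ λ z → ⟦ z ⟧ ≐ y
    ⟦⟧-surjective y y∩h≡0 = Any.index y∈ , Setoid.sym ≐-setoid (AnyProperties.lookup-index y∈)
      where
      y∈ : y Mem.∈ members
      y∈ = Membership.∈-deduplicate⁺ ≐-setoid _≐?_ (λ z≐y x≐y → Setoid.trans ≐-setoid x≐y (Setoid.sym ≐-setoid z≐y))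
             (Membership.∈-filter⁺ ≐-setoid (λ z → meetTrivially? z h) resp (∈-subspaces y) y∩h≡0)

  open Matrices (length members) public

  Covers : X → X → Set _
  Covers z y = ⟦ y ⟧ ⊆ ⟦ z ⟧ × dim ⟦ z ⟧ ≡ suc (dim ⟦ y ⟧)

  covers? : ∀ z y → Dec (Covers z y)
  covers? z y = ⟦ y ⟧ ⊆? ⟦ z ⟧ ×-dec dim ⟦ z ⟧ ℕ.≟ suc (dim ⟦ y ⟧)

  instance
    q≢0 : ℕ.NonZero q
    q≢0 = ℕ.>-nonZero (ℕ.<-trans (ℕ.s≤s ℕ.z≤n) 1<q)

    q∸1≢0 : ℕ.NonZero (q ∸ 1)
    q∸1≢0 = ℕ.>-nonZero (ℕ.m<n⇒0<n∸m 1<q)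

  open import Algebra.Properties.Semiring.Exp ℝ-Ring.semiring using (_^_)

  A : Mat
  A y z = if does (covers? y z) then ℂ-Ring.1#
          else if does (covers? z y) then fromℝ (fromℚ (+ (q ℕ.^ dim ⟦ y ⟧) ℚ./ 1))
          else ℂ-Ring.0#

  A* : Mat
  A* = diagonal λ y → fromℝ (fromℚ ((+ 1 ℚ./ (q ℕ.^ dim ⟦ y ⟧)) {{ℕ.m^n≢0 q (dim ⟦ y ⟧)}}))

  E* : Fin (suc N) → Mat
  E* i = diagonal λ y → if does (dim ⟦ y ⟧ ℕ.≟ toℕ i) then ℂ-Ring.1# else ℂ-Ring.0#

  M* : Pred Mat 0ℓ
  M* = Span E*

  module _ (√q : ℝ) where

    -- With k = twice i, the powers √q^(2N - k), √q^k and √q^M are q^(N - i), q^i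
    -- and q^(M/2).
    θ : HalfIntegers N → ℝ
    θ i = (√q ^ (2 ℕ.* N ∸ twice i) ℝ-Ring.- √q ^ twice i) ℝ-Ring.* fromℚ (+ 1 ℚ./ (q ∸ 1)) ℝ-Ring.* √q ^ M

    -- The mixfix name allows writing `E i V`.
    E_V : HalfIntegers N → Pred Vec 0ℓ
    E_V i = Eigenspace A (fromℝ (θ i))

    IsDualAdjacencyMatrix : Ordering N → Mat → Set
    IsDualAdjacencyMatrix σ B = Generates B M* × ActsTridiagonally B (E_V ∘ Inverse.to σ)

{-# OPTIONS --safe #-}

-- Write R and L for the raising and lowering operators of the poset, K for A* and
-- K⁻¹ for its inverse, so that A = R + K⁻¹ L. For a linear form φ on H vanishing on h
-- and e ∈ h the transvection x ↦ x + φ(x) e permutes X; hence the sum Ω of all these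
-- permutation matrices commutes with R, L and K. Comparing entries gives
--   (q - 1) (L R - R L) = q^(N + M) K - q^(-N) K⁻¹ Ω,
-- a U_q(sl₂) relation up to the central element Ω. It follows that
-- A² K - (q + q⁻¹) A K A + K A² - ρ K commutes with A for a scalar ρ, so for A v = θᵢ v the
-- vector (A - θᵢ₋₁) (A - θᵢ₊₁) K v is again a θᵢ-eigenvector, and Lagrange
-- interpolation splits K v over the formal eigenvalues θᵢ₋₁, θᵢ, θᵢ₊₁. At the ends of the
-- two chains of indices one of these exceeds θ₀ in absolute value; it is not an
-- eigenvalue, because A has a positive left eigenvector for θ₀.
module Submission where

open import Defs
open import Algebra.Apartness.Bundles using (HeytingField)
open import Algebra.Bundles using (CommutativeMonoid; CommutativeRing)
import Algebra.Properties.CommutativeMonoid.Sum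
import Algebra.Properties.CommutativeSemiring.Exp
import Algebra.Properties.Ring
import Algebra.Properties.Semiring.Exp
import Algebra.Properties.Semiring.Mult.TCOptimised
import Algebra.Properties.Semiring.Sum
import Algebra.Solver.Ring
open import Algebra.Module.Bundles using (Module)
open import Algebra.Solver.Ring.AlmostCommutativeRing using (fromCommutativeRing; _-Raw-AlmostCommutative⟶_)
open import Data.Bool.Base using (T; if_then_else_)
import Data.Bool.Properties as Bool
open import Data.Fin.Base as Fin using (Fin; zero; suc; toℕ; splitAt; _↑ˡ_; _↑ʳ_)
import Data.Fin.Properties as Fin
open import Data.Integer.Base as ℤ using (ℤ; +_; -[1+_]; _⊖_)
import Data.Integer.Properties as ℤ
open import Data.List.Base using (length)
open import Data.Maybe.Base using (Maybe; just; nothing)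
open import Data.Nat.Base as ℕ using (ℕ; zero; suc; _≤_; _<_)
import Data.Nat.Properties as ℕ
open import Data.Nat.Tactic.RingSolver using (solve-∀)
open import Data.Product.Base using (∃; ∃₂; _×_; _,_; proj₁; proj₂)
open import Data.Rational.Base as ℚ using (ℚ; 0ℚ; 1ℚ; ½)
import Data.Rational.Properties as ℚ
import Data.Rational.Unnormalised.Base as ℚᵘ
import Data.Rational.Unnormalised.Properties as ℚᵘ
open import Data.Sum.Base as Sum using (_⊎_; inj₁; inj₂)
open import Data.Vec.Functional using (Vector; _++_) renaming (_∷_ to _◂_)
open import Function.Base using (_∘_; id)
open import Function.Bundles using (Inverse; Equivalence; mk⇔)
open import Level using (Level; _⊔_; 0ℓ)
open import Relation.Binary.Bundles using (Setoid)
open import Relation.Binary.PropositionalEquality as ≡ using (_≡_; refl)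
import Relation.Binary.Reasoning.Setoid as SetoidReasoning
open import Relation.Nullary using (Dec; yes; no; does; ¬_; contradiction)
open import Relation.Nullary.Decidable using (_×-dec_; ¬?; decidable-stable)
open import Relation.Unary using (Pred; U)

-- What keeps L R - R L from being diagonal are the pairs y, w of equal dimension with a common
-- lower cover but no common upper cover: y + w then meets h outside 0, so R L has an entry 1 that L
-- R lacks. Such pairs, and no other distinct ones, are linked by transvections, and by a number of
-- them that depends only on dim y; this is why Ω repairs the relation. The quadratic polynomial in
-- A that interpolation needs factors because θᵢ₋₁ + θᵢ₊₁ = (q + q⁻¹) θᵢ and θᵢ₋₁ θᵢ₊₁ = θᵢ² - ρ.
-- The index moves by 1, so integers and half-integers never mix, and the two chains may be put in
-- either order. Over Cauchy reals neither equality nor sign can be decided. Inequalities are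
-- therefore carried as positive margins, which also provide the inverses for interpolation, and a
-- would-be eigenvector beyond θ₀ vanishes because two nonnegative quantities have sum 0. The
-- combinatorics stays in ℕ, in subtraction-free form, and enters ℝ and ℂ through `fromℕ`.

module SingleTerm {a ℓ : Level} (M : CommutativeMonoid a ℓ) where
  open CommutativeMonoid M renaming (_∙_ to _+_; ∙-cong to +-cong; ε to 0#; identityˡ to +-identityˡ; identityʳ to +-identityʳ) hiding (refl)
  open Algebra.Properties.CommutativeMonoid.Sum M using (sum; sum-cong-≋; sum-replicate-zero)

  sum-zero : ∀ {n} (f : Fin n → Carrier) → (∀ i → f i ≈ 0#) → sum f ≈ 0#
  sum-zero {n} f f≈0 = trans (sum-cong-≋ f≈0) (sum-replicate-zero n)

  sum-single : ∀ {n} (f : Fin n → Carrier) j → (∀ i → ¬ i ≡ j → f i ≈ 0#) → sum f ≈ f j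
  sum-single {suc n} f zero    f≈0 = trans (+-cong (CommutativeMonoid.refl M) (sum-zero (f ∘ suc) (λ i → f≈0 (suc i) λ ()))) (+-identityʳ _)
  sum-single {suc n} f (suc j) f≈0 = trans (+-cong (f≈0 zero λ ()) (sum-single (f ∘ suc) j (λ i i≢j → f≈0 (suc i) (i≢j ∘ Fin.suc-injective)))) (+-identityˡ _)

-- Counting in ℕ with sums of indicators

module Counting where
  open Algebra.Properties.Semiring.Sum ℕ.+-*-semiring public
    using (∑-comm; ∑-distrib-+; *-distribˡ-sum; *-distribʳ-sum)
    renaming (sum to ∑; sum-cong-≗ to ∑-cong)
  open SingleTerm ℕ.+-0-commutativeMonoid public renaming (sum-zero to ∑-zero; sum-single to ∑-single)

  ⟨_⟩ : ∀ {p} {P : Set p} → Dec P → ℕ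
  ⟨ P? ⟩ = if does P? then 1 else 0

  ⟨⟩-yes : ∀ {p} {P : Set p} (P? : Dec P) → P → ⟨ P? ⟩ ≡ 1
  ⟨⟩-yes (yes _) _ = refl
  ⟨⟩-yes (no ¬p) p = contradiction p ¬p

  ⟨⟩-no : ∀ {p} {P : Set p} (P? : Dec P) → ¬ P → ⟨ P? ⟩ ≡ 0
  ⟨⟩-no (yes p) ¬p = contradiction p ¬p
  ⟨⟩-no (no _)  _  = refl

  ⟨⟩-cong : ∀ {p q} {P : Set p} {Q : Set q} (P? : Dec P) (Q? : Dec Q) → (P → Q) → (Q → P) → ⟨ P? ⟩ ≡ ⟨ Q? ⟩
  ⟨⟩-cong (yes p) Q? f g = ≡.sym (⟨⟩-yes Q? (f p))
  ⟨⟩-cong (no ¬p) Q? f g = ≡.sym (⟨⟩-no Q? (¬p ∘ g))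

  ⟨⟩≡0⊎ : ∀ {p} {P : Set p} (P? : Dec P) → ⟨ P? ⟩ ≡ 0 ⊎ P
  ⟨⟩≡0⊎ (yes p) = inj₂ p
  ⟨⟩≡0⊎ (no _)  = inj₁ refl

  ⟨⟩-× : ∀ {p q} {P : Set p} {Q : Set q} (P? : Dec P) (Q? : Dec Q) → ⟨ P? ⟩ ℕ.* ⟨ Q? ⟩ ≡ ⟨ P? ×-dec Q? ⟩
  ⟨⟩-× (yes _) Q? = ℕ.*-identityˡ _
  ⟨⟩-× (no _)  Q? = refl

  ⟨⟩-∖ : ∀ {p q} {P : Set p} {Q : Set q} (P? : Dec P) (Q? : Dec Q) → (Q → P) → ⟨ P? ×-dec ¬? Q? ⟩ ℕ.+ ⟨ Q? ⟩ ≡ ⟨ P? ⟩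
  ⟨⟩-∖ P?      (yes q) Q⇒P = ≡.trans (≡.cong (ℕ._+ 1) (⟨⟩-no (P? ×-dec ¬? (yes q)) λ (_ , ¬q) → ¬q q)) (≡.sym (⟨⟩-yes P? (Q⇒P q)))
  ⟨⟩-∖ (yes _) (no ¬q) _   = refl
  ⟨⟩-∖ (no _)  (no ¬q) _   = refl

  ∑-unique : ∀ {n p} {P : Fin n → Set p} (P? : ∀ i → Dec (P i)) j → P j → (∀ i → P i → i ≡ j) → ∑ (λ i → ⟨ P? i ⟩) ≡ 1
  ∑-unique P? j Pj unique = ≡.trans (∑-single _ j λ i i≢j → ⟨⟩-no (P? i) (i≢j ∘ unique i)) (⟨⟩-yes (P? j) Pj)

  ∑-none : ∀ {n p} {P : Fin n → Set p} (P? : ∀ i → Dec (P i)) → (∀ i → ¬ P i) → ∑ (λ i → ⟨ P? i ⟩) ≡ 0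
  ∑-none P? ¬P = ∑-zero _ λ i → ⟨⟩-no (P? i) (¬P i)

  ∑-pick : ∀ {n p} {P : Fin n → Set p} (P? : ∀ i → Dec (P i)) (f : Fin n → ℕ) j → P j → (∀ i → P i → i ≡ j) →
           ∑ (λ i → ⟨ P? i ⟩ ℕ.* f i) ≡ f j
  ∑-pick P? f j Pj unique = ≡.trans
    (∑-single _ j λ i i≢j → ≡.cong (ℕ._* f i) (⟨⟩-no (P? i) (i≢j ∘ unique i)))
    (≡.trans (≡.cong (ℕ._* f j) (⟨⟩-yes (P? j) Pj)) (ℕ.*-identityˡ (f j)))

  ∑-1 : ∀ n → ∑ {n} (λ _ → 1) ≡ n
  ∑-1 zero    = refl
  ∑-1 (suc n) = ≡.cong suc (∑-1 n)

  -- Each indicator is replaced by the number of preimages under `f`, which is 0 or 1; exchanging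
  -- the two sums leaves one term per element of the domain.
  ∑-image : ∀ {m k p} {P : Fin m → Set p} (P? : ∀ i → Dec (P i)) (f : Fin k → Fin m) → (∀ {i j} → f i ≡ f j → i ≡ j) →
            (∀ j → P (f j)) → (∀ i → P i → ∃ λ j → f j ≡ i) → ∑ (λ i → ⟨ P? i ⟩) ≡ k
  ∑-image {m} {k} P? f f-injective f∈P surjective = begin
    ∑ (λ i → ⟨ P? i ⟩)                            ≡⟨ ∑-cong preimage ⟩
    ∑ (λ i → ∑ (λ j → ⟨ f j Fin.≟ i ⟩))           ≡⟨ ∑-comm (λ i j → ⟨ f j Fin.≟ i ⟩) ⟩
    ∑ (λ j → ∑ (λ i → ⟨ f j Fin.≟ i ⟩))           ≡⟨ ∑-cong (λ j → ∑-unique (λ i → f j Fin.≟ i) (f j) refl (λ _ → ≡.sym)) ⟩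
    ∑ {k} (λ _ → 1)                               ≡⟨ ∑-1 k ⟩
    k                                             ∎
    where
    open ≡.≡-Reasoning
    preimage : ∀ i → ⟨ P? i ⟩ ≡ ∑ (λ j → ⟨ f j Fin.≟ i ⟩)
    preimage i with P? i
    ... | yes Pi = let j , fj≡i = surjective i Pi in
      ≡.sym (∑-unique (λ j → f j Fin.≟ i) j fj≡i (λ j′ fj′≡i → f-injective (≡.trans fj′≡i (≡.sym fj≡i))))
    ... | no ¬Pi = ≡.sym (∑-none (λ j → f j Fin.≟ i) λ { j refl → ¬Pi (f∈P j) })

  -- Every row carries exactly one mark, in `P` or in `R`, so there are `k` marks; the columns
  -- merely recount those in `P`. Both cover counts are obtained this way, with forms or vectors as
  -- rows and elements of the poset as columns.
  double-count : ∀ {k l p r} {P : Fin k → Fin l → Set p} {R : Fin k → Set r} (P? : ∀ i j → Dec (P i j)) (R? : ∀ i → Dec (R i)) (w : Fin l → ℕ) →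
                 (∀ i → ∑ (λ j → ⟨ P? i j ⟩) ℕ.+ ⟨ R? i ⟩ ≡ 1) → (∀ j → ∑ (λ i → ⟨ P? i j ⟩) ≡ w j) → ∑ w ℕ.+ ∑ (λ i → ⟨ R? i ⟩) ≡ k
  double-count {k} P? R? w rows columns = begin
    ∑ w ℕ.+ ∑ (λ i → ⟨ R? i ⟩)                                     ≡⟨ ≡.cong (ℕ._+ _) (∑-cong columns) ⟨
    ∑ (λ j → ∑ (λ i → ⟨ P? i j ⟩)) ℕ.+ ∑ (λ i → ⟨ R? i ⟩)          ≡⟨ ≡.cong (ℕ._+ _) (∑-comm (λ i j → ⟨ P? i j ⟩)) ⟨
    ∑ (λ i → ∑ (λ j → ⟨ P? i j ⟩)) ℕ.+ ∑ (λ i → ⟨ R? i ⟩)          ≡⟨ ∑-distrib-+ (λ i → ∑ (λ j → ⟨ P? i j ⟩)) (λ i → ⟨ R? i ⟩) ⟨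
    ∑ (λ i → ∑ (λ j → ⟨ P? i j ⟩) ℕ.+ ⟨ R? i ⟩)                    ≡⟨ ∑-cong rows ⟩
    ∑ {k} (λ _ → 1)                                                ≡⟨ ∑-1 k ⟩
    k                                                              ∎
    where open ≡.≡-Reasoning

-- Polynomial identities in a commutative ring

module ℤ-Coefficients {a ℓ : Level} (R : CommutativeRing a ℓ) where
  open CommutativeRing R renaming (refl to ≈-refl; sym to ≈-sym; trans to ≈-trans)
  open Algebra.Properties.Semiring.Mult.TCOptimised semiring using (×-homo-+; ×1-homo-*; 1+×) renaming (_×_ to _·_)
  open Algebra.Properties.Ring ring using (-0#≈0#; -‿distribˡ-*; -‿distribʳ-*; -‿+-comm; -‿involutive)
  open import Relation.Binary.Reasoning.Setoid setoid

  fromℕ : ℕ → Carrier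
  fromℕ n = n · 1#

  fromℕ-+ : ∀ m n → fromℕ (m ℕ.+ n) ≈ fromℕ m + fromℕ n
  fromℕ-+ = ×-homo-+ 1#

  fromℕ-* : ∀ m n → fromℕ (m ℕ.* n) ≈ fromℕ m * fromℕ n
  fromℕ-* = ×1-homo-*

  fromℕ-suc : ∀ n → fromℕ (suc n) ≈ 1# + fromℕ n
  fromℕ-suc n = 1+× n 1#

  -- Equality of Cauchy reals cannot be decided, so the ring normaliser compares its coefficients in
  -- ℤ and transports them along this homomorphism.
  fromℤ : ℤ → Carrier
  fromℤ (+ n)    = fromℕ n
  fromℤ -[1+ n ] = - fromℕ (suc n)

  private
    [1+x]-[1+y] : ∀ x y → x - y ≈ (1# + x) - (1# + y)
    [1+x]-[1+y] x y = begin
      x - y                    ≈⟨ +-identityˡ _ ⟨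
      0# + (x - y)             ≈⟨ +-congʳ (-‿inverseʳ 1#) ⟨
      (1# - 1#) + (x - y)      ≈⟨ +-assoc _ _ _ ⟩
      1# + (- 1# + (x - y))    ≈⟨ +-congˡ (≈-trans (≈-sym (+-assoc _ _ _)) (≈-trans (+-congʳ (+-comm _ _)) (+-assoc _ _ _))) ⟩
      1# + (x + (- 1# - y))    ≈⟨ +-assoc _ _ _ ⟨
      (1# + x) + (- 1# - y)    ≈⟨ +-congˡ (-‿+-comm 1# y) ⟩
      (1# + x) - (1# + y)      ∎

    fromℤ-⊖ : ∀ m n → fromℤ (m ⊖ n) ≈ fromℕ m - fromℕ n
    fromℤ-⊖ m zero = ≈-sym (≈-trans (+-congˡ -0#≈0#) (+-identityʳ _))
    fromℤ-⊖ zero (suc n) = ≈-sym (+-identityˡ _)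
    fromℤ-⊖ (suc m) (suc n) = ≈-trans (reflexive (≡.cong fromℤ (ℤ.[1+m]⊖[1+n]≡m⊖n m n)))
      (≈-trans (fromℤ-⊖ m n) (≈-trans ([1+x]-[1+y] _ _) (≈-sym (+-cong (fromℕ-suc m) (-‿cong (fromℕ-suc n))))))

    fromℤ-+ : ∀ i j → fromℤ (i ℤ.+ j) ≈ fromℤ i + fromℤ j
    fromℤ-+ (+ m)    (+ n)    = fromℕ-+ m n
    fromℤ-+ (+ m)    -[1+ n ] = fromℤ-⊖ m (suc n)
    fromℤ-+ -[1+ m ] (+ n)    = ≈-trans (fromℤ-⊖ n (suc m)) (+-comm _ _)
    fromℤ-+ -[1+ m ] -[1+ n ] = ≈-trans (-‿cong (≈-trans (reflexive (≡.cong (fromℕ ∘ suc) (≡.sym (ℕ.+-suc m n))))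
      (fromℕ-+ (suc m) (suc n)))) (≈-sym (-‿+-comm _ _))

    fromℤ-neg : ∀ i → fromℤ (ℤ.- i) ≈ - fromℤ i
    fromℤ-neg (+ zero)  = ≈-sym -0#≈0#
    fromℤ-neg (+ suc n) = ≈-refl
    fromℤ-neg -[1+ n ]  = ≈-sym (-‿involutive _)

    fromℤ-*+ : ∀ i n → fromℤ (i ℤ.* + n) ≈ fromℤ i * fromℕ n
    fromℤ-*+ (+ m) n = ≈-trans (reflexive (≡.cong fromℤ (≡.sym (ℤ.pos-* m n)))) (fromℕ-* m n)
    fromℤ-*+ -[1+ m ] n = begin
      fromℤ (-[1+ m ] ℤ.* + n)       ≡⟨ ≡.cong fromℤ (ℤ.neg-distribˡ-* (+ suc m) (+ n)) ⟨
      fromℤ (ℤ.- (+ suc m ℤ.* + n))  ≈⟨ fromℤ-neg (+ suc m ℤ.* + n) ⟩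
      - fromℤ (+ suc m ℤ.* + n)      ≈⟨ -‿cong (fromℤ-*+ (+ suc m) n) ⟩
      - (fromℕ (suc m) * fromℕ n)    ≈⟨ -‿distribˡ-* _ _ ⟩
      - fromℕ (suc m) * fromℕ n      ∎

    fromℤ-* : ∀ i j → fromℤ (i ℤ.* j) ≈ fromℤ i * fromℤ j
    fromℤ-* i (+ n) = fromℤ-*+ i n
    fromℤ-* i -[1+ n ] = begin
      fromℤ (i ℤ.* -[1+ n ])         ≡⟨ ≡.cong fromℤ (ℤ.neg-distribʳ-* i (+ suc n)) ⟨
      fromℤ (ℤ.- (i ℤ.* + suc n))    ≈⟨ fromℤ-neg (i ℤ.* + suc n) ⟩
      - fromℤ (i ℤ.* + suc n)        ≈⟨ -‿cong (fromℤ-*+ i (suc n)) ⟩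
      - (fromℤ i * fromℕ (suc n))    ≈⟨ -‿distribʳ-* _ _ ⟩
      fromℤ i * - fromℕ (suc n)      ∎

    morphism : ℤ.+-*-rawRing -Raw-AlmostCommutative⟶ fromCommutativeRing R
    morphism = record
      { ⟦_⟧ = fromℤ ; +-homo = fromℤ-+ ; *-homo = fromℤ-* ; -‿homo = fromℤ-neg
      ; 0-homo = ≈-refl ; 1-homo = ≈-refl }

    decide : ∀ i j → Maybe (fromℤ i ≈ fromℤ j)
    decide i j with i ℤ.≟ j
    ... | yes i≡j = just (reflexive (≡.cong fromℤ i≡j))
    ... | no _    = nothing

  open Algebra.Solver.Ring ℤ.+-*-rawRing (fromCommutativeRing R) morphism decide public
    using (solve; _:=_; _:+_; _:*_; _:-_; :-_; con)

module LinearCombinations {a ℓ : Level} (R : CommutativeRing a ℓ) where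
  open CommutativeRing R renaming (refl to ≈-refl; sym to ≈-sym; trans to ≈-trans)
  open Algebra.Properties.Ring ring using (x∙y⁻¹≈ε⇒x≈y)

  infixl 6 _⊕_
  infix 7 _⊙_
  infix 2 _by_

  -- Later uses mostly leave `m` as `_`: it is read off from the identity given to `solve`, whose
  -- right-hand side is a certificate with one summand per equation.
  _⊙_ : ∀ m {x y} → x ≈ y → m * (x - y) ≈ 0#
  m ⊙ x≈y = ≈-trans (*-congˡ (≈-trans (+-congʳ x≈y) (-‿inverseʳ _))) (zeroʳ m)

  _⊕_ : ∀ {x y} → x ≈ 0# → y ≈ 0# → x + y ≈ 0#
  x≈0 ⊕ y≈0 = ≈-trans (+-cong x≈0 y≈0) (+-identityʳ 0#)

  -- An equation follows from others when the difference of its sides is a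
  -- linear combination of theirs.
  _by_ : ∀ {x y z} → x - y ≈ z → z ≈ 0# → x ≈ y
  x-y≈z by z≈0 = x∙y⁻¹≈ε⇒x≈y _ _ (≈-trans x-y≈z z≈0)

-- Linear operators given by matrices of natural numbers

module Operators {a ℓ : Level} (K : CommutativeRing a ℓ) (n : ℕ) where
  open CommutativeRing K hiding (zero) renaming (refl to ≈-refl; sym to ≈-sym; trans to ≈-trans)
  open Algebra.Properties.Semiring.Sum semiring using (sum; sum-cong-≋; ∑-distrib-+; ∑-comm; *-distribˡ-sum; *-distribʳ-sum)
  open SingleTerm +-commutativeMonoid
  open ℤ-Coefficients K
  open LinearCombinations K
  open Counting using (∑; ⟨_⟩; ⟨⟩-yes; ⟨⟩-no)
  open import Relation.Binary.Reasoning.Setoid setoid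

  Vec Operator : Set a
  Vec = Fin n → Carrier
  Operator = Vec → Vec

  infix 4 _≋_
  _≋_ : Vec → Vec → Set ℓ
  u ≋ v = ∀ y → u y ≈ v y

  record Linear (f : Operator) : Set (a ⊔ ℓ) where
    field
      cong : ∀ {u v} → u ≋ v → f u ≋ f v
      combine : ∀ a b u v → f (λ y → a * u y + b * v y) ≋ λ y → a * f u y + b * f v y

    add : ∀ u v → f (λ y → u y + v y) ≋ λ y → f u y + f v y
    add u v y = begin
      f (λ z → u z + v z) y                  ≈⟨ cong (λ z → +-cong (*-identityˡ (u z)) (*-identityˡ (v z))) y ⟨
      f (λ z → 1# * u z + 1# * v z) y        ≈⟨ combine 1# 1# u v y ⟩
      1# * f u y + 1# * f v y                ≈⟨ +-cong (*-identityˡ _) (*-identityˡ _) ⟩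
      f u y + f v y                          ∎

    scale : ∀ a u → f (λ y → a * u y) ≋ λ y → a * f u y
    scale a u y = begin
      f (λ z → a * u z) y                    ≈⟨ cong (λ z → ≈-trans (+-congˡ (zeroˡ (u z))) (+-identityʳ _)) y ⟨
      f (λ z → a * u z + 0# * u z) y         ≈⟨ combine a 0# u u y ⟩
      a * f u y + 0# * f u y                 ≈⟨ ≈-trans (+-congˡ (zeroˡ _)) (+-identityʳ _) ⟩
      a * f u y                              ∎

    combine₃ : ∀ a b c u v w → f (λ y → a * u y + b * v y + c * w y) ≋ λ y → a * f u y + b * f v y + c * f w y
    combine₃ a b c u v w y = ≈-trans (add _ _ y) (+-cong (combine a b u v y) (scale c w y))

  open Linear

  ∘-linear : ∀ {f g} → Linear f → Linear g → Linear (f ∘ g)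
  ∘-linear F G .cong u≋v = cong F (cong G u≋v)
  ∘-linear F G .combine a b u v y = ≈-trans (cong F (combine G a b u v) y) (combine F a b _ _ y)

  +-linear : ∀ {f g} → Linear f → Linear g → Linear (λ u y → f u y + g u y)
  +-linear F G .cong u≋v y = +-cong (cong F u≋v y) (cong G u≋v y)
  +-linear F G .combine a b u v y = ≈-trans (+-cong (combine F a b u v y) (combine G a b u v y))
    (solve 6 (λ a b c d e f → (a :* c :+ b :* d) :+ (a :* e :+ b :* f) := a :* (c :+ e) :+ b :* (d :+ f)) ≈-refl a b _ _ _ _)

  *-linear : ∀ {f} (g : Vec) → Linear f → Linear (λ u y → g y * f u y)
  *-linear g F .cong u≋v y = *-congˡ (cong F u≋v y)
  *-linear g F .combine a b u v y = ≈-trans (*-congˡ (combine F a b u v y))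
    (solve 5 (λ g a b c d → g :* (a :* c :+ b :* d) := a :* (g :* c) :+ b :* (g :* d)) ≈-refl (g y) a b _ _)

  id-linear : Linear id
  id-linear .cong u≋v = u≋v
  id-linear .combine a b u v y = ≈-refl

  apply : (Fin n → Fin n → Carrier) → Operator
  apply B v y = sum λ z → B y z * v z

  apply-linear : ∀ B → Linear (apply B)
  apply-linear B .cong u≋v y = sum-cong-≋ λ z → *-congˡ (u≋v z)
  apply-linear B .combine a b u v y = begin
    sum (λ z → B y z * (a * u z + b * v z))
      ≈⟨ sum-cong-≋ (λ z → solve 5 (λ m a b c d → m :* (a :* c :+ b :* d) := a :* (m :* c) :+ b :* (m :* d)) ≈-refl (B y z) a b (u z) (v z)) ⟩
    sum (λ z → a * (B y z * u z) + b * (B y z * v z))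
      ≈⟨ ∑-distrib-+ (λ z → a * (B y z * u z)) (λ z → b * (B y z * v z)) ⟩
    sum (λ z → a * (B y z * u z)) + sum (λ z → b * (B y z * v z))
      ≈⟨ +-cong (*-distribˡ-sum a (λ z → B y z * u z)) (*-distribˡ-sum b (λ z → B y z * v z)) ⟨
    a * apply B u y + b * apply B v y ∎

  fromℕ-∑ : ∀ {k} (f : Fin k → ℕ) → fromℕ (∑ f) ≈ sum (fromℕ ∘ f)
  fromℕ-∑ {zero}  f = ≈-refl
  fromℕ-∑ {suc k} f = ≈-trans (fromℕ-+ (f zero) _) (+-congˡ (fromℕ-∑ (f ∘ suc)))

  -- Incidence data stay in ℕ and are mapped into the ring only here, so that one combinatorial
  -- identity serves every ring of scalars.
  ∣_∣ᴷ : (Fin n → Fin n → ℕ) → Fin n → Fin n → Carrier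
  ∣ m ∣ᴷ y z = fromℕ (m y z)

  infixr 7 _·_
  _·_ : (Fin n → Fin n → ℕ) → Operator
  m · v = apply ∣ m ∣ᴷ v

  ·-linear : ∀ m → Linear (m ·_)
  ·-linear m = apply-linear ∣ m ∣ᴷ

  ·-congˡ : ∀ {m m′} → (∀ y z → m y z ≡ m′ y z) → ∀ v → m · v ≋ m′ · v
  ·-congˡ m≡m′ v y = sum-cong-≋ λ z → *-congʳ (reflexive (≡.cong fromℕ (m≡m′ y z)))

  infixl 7 _⊗_
  _⊗_ : (m m′ : Fin n → Fin n → ℕ) → Fin n → Fin n → ℕ
  (m ⊗ m′) y w = ∑ λ z → m y z ℕ.* m′ z w

  ·-· : ∀ m m′ v → m · m′ · v ≋ (m ⊗ m′) · v
  ·-· m m′ v y = begin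
    sum (λ z → fromℕ (m y z) * sum (λ w → fromℕ (m′ z w) * v w))
      ≈⟨ sum-cong-≋ (λ z → *-distribˡ-sum (fromℕ (m y z)) (λ w → fromℕ (m′ z w) * v w)) ⟩
    sum (λ z → sum λ w → fromℕ (m y z) * (fromℕ (m′ z w) * v w))
      ≈⟨ ∑-comm (λ z w → fromℕ (m y z) * (fromℕ (m′ z w) * v w)) ⟩
    sum (λ w → sum λ z → fromℕ (m y z) * (fromℕ (m′ z w) * v w))
      ≈⟨ sum-cong-≋ (λ w → ≈-trans (sum-cong-≋ λ z → ≈-trans (≈-sym (*-assoc _ _ _)) (*-congʳ (≈-sym (fromℕ-* (m y z) (m′ z w)))))
           (≈-sym (*-distribʳ-sum (v w) (λ z → fromℕ (m y z ℕ.* m′ z w))))) ⟩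
    sum (λ w → sum (λ z → fromℕ (m y z ℕ.* m′ z w)) * v w)
      ≈⟨ sum-cong-≋ (λ w → *-congʳ (fromℕ-∑ (λ z → m y z ℕ.* m′ z w))) ⟨
    sum (λ w → fromℕ (∑ λ z → m y z ℕ.* m′ z w) * v w) ∎

  -- An operator whose nonzero entries all join consecutive levels moves a weight past itself at the
  -- cost of one scalar. This yields the four relations of `c` and `cᵀ` with `up` and `down`.
  ·-weight : ∀ m (s : Carrier) (g g′ : Vec) → (∀ y z → m y z ≡ 0 ⊎ g z ≈ s * g′ y) →
             ∀ u y → (m · λ z → g z * u z) y ≈ s * (g′ y * (m · u) y)
  ·-weight m s g g′ graded u y = begin
    sum (λ z → fromℕ (m y z) * (g z * u z))              ≈⟨ sum-cong-≋ term ⟩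
    sum (λ z → (s * g′ y) * (fromℕ (m y z) * u z))       ≈⟨ *-distribˡ-sum (s * g′ y) (λ z → fromℕ (m y z) * u z) ⟨
    (s * g′ y) * (m · u) y                               ≈⟨ *-assoc _ _ _ ⟩
    s * (g′ y * (m · u) y)                               ∎
    where
    term : ∀ z → fromℕ (m y z) * (g z * u z) ≈ (s * g′ y) * (fromℕ (m y z) * u z)
    term z with m y z | graded y z
    ... | _ | inj₁ refl = ≈-trans (zeroˡ _) (≈-sym (≈-trans (*-congˡ (zeroˡ _)) (zeroʳ _)))
    ... | k | inj₂ gz≈ = ≈-trans (*-congˡ (*-congʳ gz≈))
      (solve 4 (λ k s g u → k :* (s :* g :* u) := s :* g :* (k :* u)) ≈-refl (fromℕ k) s (g′ y) (u z))

  fromℕ-*· : ∀ k m v y → fromℕ k * (m · v) y ≈ sum (λ z → fromℕ (k ℕ.* m y z) * v z)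
  fromℕ-*· k m v y = ≈-trans (*-distribˡ-sum (fromℕ k) (λ z → fromℕ (m y z) * v z))
    (sum-cong-≋ λ z → ≈-trans (≈-sym (*-assoc _ _ _)) (*-congʳ (≈-sym (fromℕ-* k (m y z)))))

  ⟨≟⟩-· : ∀ v → (λ y z → ⟨ y Fin.≟ z ⟩) · v ≋ v
  ⟨≟⟩-· v y = ≈-trans (sum-single _ y off) (≈-trans (*-congʳ (reflexive (≡.cong fromℕ (⟨⟩-yes (y Fin.≟ y) refl)))) (*-identityˡ _))
    where
    off : ∀ z → ¬ z ≡ y → fromℕ ⟨ y Fin.≟ z ⟩ * v z ≈ 0#
    off z z≢y = ≈-trans (*-congʳ (reflexive (≡.cong fromℕ (⟨⟩-no (y Fin.≟ z) (z≢y ∘ ≡.sym))))) (zeroˡ _)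

-- The incidence algebra of a graded poset whose raising and lowering operators
-- satisfy the U_q(sl₂) relation up to an operator ω commuting with both; that relation
-- is multiplied by q^(N + dim) to stay within ℕ.
module UniformPoset {a ℓ : Level} (K : CommutativeRing a ℓ) {n : ℕ}
  (c ω : Fin n → Fin n → ℕ) (d : Fin n → ℕ) (p N M : ℕ)
  (c-graded : ∀ y z → c y z ≡ 0 ⊎ d y ≡ suc (d z))
  (cω≡ωc : ∀ y w → Counting.∑ (λ z → c y z ℕ.* ω z w) ≡ Counting.∑ (λ z → ω y z ℕ.* c z w))
  (cᵀω≡ωcᵀ : ∀ y w → Counting.∑ (λ z → c z y ℕ.* ω z w) ≡ Counting.∑ (λ z → ω y z ℕ.* c w z))
  (commutator : ∀ y w →
    p ℕ.* suc p ℕ.^ (N ℕ.+ d y) ℕ.* Counting.∑ (λ z → c z y ℕ.* c z w) ℕ.+ suc p ℕ.^ (d y ℕ.+ d y) ℕ.* ω y w ≡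
    p ℕ.* suc p ℕ.^ (N ℕ.+ d y) ℕ.* Counting.∑ (λ z → c y z ℕ.* c w z) ℕ.+ suc p ℕ.^ (N ℕ.+ N ℕ.+ M) ℕ.* Counting.⟨ y Fin.≟ w ⟩)
  where
  open CommutativeRing K hiding (zero) renaming (refl to ≈-refl; sym to ≈-sym; trans to ≈-trans)
  open Algebra.Properties.Semiring.Sum semiring using (sum; sum-cong-≋; ∑-distrib-+)
  open import Algebra.Properties.Semiring.Exp semiring using (_^_; ^-homo-*)
  open ℤ-Coefficients K
  open LinearCombinations K
  open Counting using (⟨_⟩)
  open Operators K n
  open Linear
  open import Relation.Binary.Reasoning.Setoid setoid

  cᵀ : Fin n → Fin n → ℕ
  cᵀ y z = c z y

  x : Carrier
  x = fromℕ (suc p)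

  fromℕ-^ : ∀ k → fromℕ (suc p ℕ.^ k) ≈ x ^ k
  fromℕ-^ zero    = ≈-refl
  fromℕ-^ (suc k) = ≈-trans (fromℕ-* (suc p) (suc p ℕ.^ k)) (*-congˡ (fromℕ-^ k))

  x≈1+p : x ≈ 1# + fromℕ p
  x≈1+p = fromℕ-suc p

  up : Vec
  up y = x ^ d y

  Q : Carrier
  Q = x ^ (N ℕ.+ M)

  module _ (x⁻¹ : Carrier) (x⁻¹x≈1 : x⁻¹ * x ≈ 1#) where

    down : Vec
    down y = x⁻¹ ^ d y

    x⁻ᵏxᵏ≈1 : ∀ k → x⁻¹ ^ k * x ^ k ≈ 1#
    x⁻ᵏxᵏ≈1 zero    = *-identityˡ 1#
    x⁻ᵏxᵏ≈1 (suc k) = ≈-trans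
      (solve 4 (λ a b c d → a :* b :* (c :* d) := (a :* c) :* (b :* d)) ≈-refl x⁻¹ (x⁻¹ ^ k) x (x ^ k))
      (≈-trans (*-cong x⁻¹x≈1 (x⁻ᵏxᵏ≈1 k)) (*-identityˡ 1#))

    down*up≈1 : ∀ y → down y * up y ≈ 1#
    down*up≈1 y = x⁻ᵏxᵏ≈1 (d y)

    ν : Carrier
    ν = x⁻¹ ^ N

    private
      xᵏ≈x⁻¹x¹⁺ᵏ : ∀ k → x ^ k ≈ x⁻¹ * x ^ suc k
      xᵏ≈x⁻¹x¹⁺ᵏ k = ≈-sym (≈-trans (≈-sym (*-assoc _ _ _)) (≈-trans (*-congʳ x⁻¹x≈1) (*-identityˡ _)))

      x⁻ᵏ≈xx⁻¹⁻ᵏ : ∀ k → x⁻¹ ^ k ≈ x * x⁻¹ ^ suc k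
      x⁻ᵏ≈xx⁻¹⁻ᵏ k = ≈-sym (≈-trans (≈-sym (*-assoc _ _ _)) (≈-trans (*-congʳ (≈-trans (*-comm _ _) x⁻¹x≈1)) (*-identityˡ _)))

      shift : ∀ {i j} (f : ℕ → Carrier) → i ≡ j → f i ≈ f j
      shift f i≡j = reflexive (≡.cong f i≡j)

    c-down : ∀ u y → (c · λ z → down z * u z) y ≈ x * (down y * (c · u) y)
    c-down = ·-weight c x down down λ y z → Sum.map₂
      (λ dy≡1+dz → ≈-trans (x⁻ᵏ≈xx⁻¹⁻ᵏ (d z)) (*-congˡ (shift (x⁻¹ ^_) (≡.sym dy≡1+dz)))) (c-graded y z)

    c-up : ∀ u y → (c · λ z → up z * u z) y ≈ x⁻¹ * (up y * (c · u) y)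
    c-up = ·-weight c x⁻¹ up up λ y z → Sum.map₂
      (λ dy≡1+dz → ≈-trans (xᵏ≈x⁻¹x¹⁺ᵏ (d z)) (*-congˡ (shift (x ^_) (≡.sym dy≡1+dz)))) (c-graded y z)

    cᵀ-down : ∀ u y → (cᵀ · λ z → down z * u z) y ≈ x⁻¹ * (down y * (cᵀ · u) y)
    cᵀ-down = ·-weight cᵀ x⁻¹ down down λ y z → Sum.map₂ (shift (x⁻¹ ^_)) (c-graded z y)

    cᵀ-up : ∀ u y → (cᵀ · λ z → up z * u z) y ≈ x * (up y * (cᵀ · u) y)
    cᵀ-up = ·-weight cᵀ x up up λ y z → Sum.map₂ (shift (x ^_)) (c-graded z y)

    c-ω : ∀ v → c · ω · v ≋ ω · c · v
    c-ω v y = ≈-trans (·-· c ω v y) (≈-trans (·-congˡ cω≡ωc v y) (≈-sym (·-· ω c v y)))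

    cᵀ-ω : ∀ v → cᵀ · ω · v ≋ ω · cᵀ · v
    cᵀ-ω v y = ≈-trans (·-· cᵀ ω v y) (≈-trans (·-congˡ cᵀω≡ωcᵀ v y) (≈-sym (·-· ω cᵀ v y)))

    private
      -- The counting identity read as an identity of operators. It is stated one row at a time,
      -- because its coefficients depend on `d y`.
      commutator-scaled : ∀ v y →
        fromℕ p * (x ^ N * up y) * (cᵀ · c · v) y + up y * up y * (ω · v) y ≈
        fromℕ p * (x ^ N * up y) * (c · cᵀ · v) y + x ^ N * Q * v y
      commutator-scaled v y = begin
        fromℕ p * (x ^ N * up y) * (cᵀ · c · v) y + up y * up y * (ω · v) y
          ≈⟨ +-cong (*-cong coefficient (·-· cᵀ c v y)) (*-congʳ square) ⟩
        fromℕ k * ((cᵀ ⊗ c) · v) y + fromℕ l * (ω · v) y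
          ≈⟨ +-cong (fromℕ-*· k (cᵀ ⊗ c) v y) (fromℕ-*· l ω v y) ⟩
        sum (λ z → fromℕ (k ℕ.* (cᵀ ⊗ c) y z) * v z) + sum (λ z → fromℕ (l ℕ.* ω y z) * v z)
          ≈⟨ join (λ z → k ℕ.* (cᵀ ⊗ c) y z) (λ z → l ℕ.* ω y z) ⟩
        sum (λ z → fromℕ (k ℕ.* (cᵀ ⊗ c) y z ℕ.+ l ℕ.* ω y z) * v z)
          ≈⟨ sum-cong-≋ (λ z → *-congʳ (reflexive (≡.cong fromℕ (commutator y z)))) ⟩
        sum (λ z → fromℕ (k ℕ.* (c ⊗ cᵀ) y z ℕ.+ r ℕ.* ⟨ y Fin.≟ z ⟩) * v z)
          ≈⟨ join (λ z → k ℕ.* (c ⊗ cᵀ) y z) (λ z → r ℕ.* ⟨ y Fin.≟ z ⟩) ⟨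
        sum (λ z → fromℕ (k ℕ.* (c ⊗ cᵀ) y z) * v z) + sum (λ z → fromℕ (r ℕ.* ⟨ y Fin.≟ z ⟩) * v z)
          ≈⟨ +-cong (fromℕ-*· k (c ⊗ cᵀ) v y) (fromℕ-*· r (λ y z → ⟨ y Fin.≟ z ⟩) v y) ⟨
        fromℕ k * ((c ⊗ cᵀ) · v) y + fromℕ r * ((λ y z → ⟨ y Fin.≟ z ⟩) · v) y
          ≈⟨ +-cong (*-cong coefficient (·-· c cᵀ v y)) (*-cong constant (≈-sym (⟨≟⟩-· v y))) ⟨
        fromℕ p * (x ^ N * up y) * (c · cᵀ · v) y + x ^ N * Q * v y ∎
        where
        k l r : ℕ
        k = p ℕ.* suc p ℕ.^ (N ℕ.+ d y)
        l = suc p ℕ.^ (d y ℕ.+ d y)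
        r = suc p ℕ.^ (N ℕ.+ N ℕ.+ M)
        coefficient : fromℕ p * (x ^ N * up y) ≈ fromℕ k
        coefficient = ≈-sym (≈-trans (fromℕ-* p _) (*-congˡ (≈-trans (fromℕ-^ (N ℕ.+ d y)) (^-homo-* x N (d y)))))
        square : up y * up y ≈ fromℕ l
        square = ≈-sym (≈-trans (fromℕ-^ (d y ℕ.+ d y)) (^-homo-* x (d y) (d y)))
        constant : x ^ N * Q ≈ fromℕ r
        constant = ≈-sym (≈-trans (fromℕ-^ (N ℕ.+ N ℕ.+ M)) (≈-trans (shift (x ^_) (ℕ.+-assoc N N M)) (^-homo-* x N (N ℕ.+ M))))
        join : ∀ (f g : Fin n → ℕ) → sum (λ z → fromℕ (f z) * v z) + sum (λ z → fromℕ (g z) * v z) ≈ sum (λ z → fromℕ (f z ℕ.+ g z) * v z)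
        join f g = ≈-trans (≈-sym (∑-distrib-+ (λ z → fromℕ (f z) * v z) (λ z → fromℕ (g z) * v z)))
          (sum-cong-≋ λ z → ≈-trans (≈-sym (distribʳ _ _ _)) (*-congʳ (≈-sym (fromℕ-+ (f z) (g z)))))

    -- Row y of the scaled identity carries the factor q^(N + dim y), which `down y * ν` cancels.
    cᵀc-ccᵀ : ∀ v y → fromℕ p * (cᵀ · c · v) y ≈
              fromℕ p * (c · cᵀ · v) y + Q * (down y * v y) + - ν * (up y * (ω · v) y)
    cᵀc-ccᵀ v y =
      solve 10 (λ P XN U LR W RL Q V D ν →
          P :* LR :- (P :* RL :+ Q :* (D :* V) :+ :- ν :* (U :* W)) :=
          D :* ν :* ((P :* (XN :* U) :* LR :+ U :* U :* W) :- (P :* (XN :* U) :* RL :+ XN :* Q :* V))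
          :+ (:- (U :* W :* ν :+ P :* LR :* (ν :* XN) :- P :* RL :* (ν :* XN))) :* (D :* U :- con (+ 1))
          :+ (D :* V :* Q :- P :* LR :+ P :* RL) :* (ν :* XN :- con (+ 1)))
        ≈-refl (fromℕ p) (x ^ N) (up y) ((cᵀ · c · v) y) ((ω · v) y) ((c · cᵀ · v) y) Q (v y) (down y) ν
      by (down y * ν) ⊙ commutator-scaled v y ⊕ _ ⊙ down*up≈1 y ⊕ _ ⊙ x⁻ᵏxᵏ≈1 N

    -- Multiplied by γ this is A² K - (q + q⁻¹) A K A + K A² - ρ K.
    casimir : Operator
    casimir v y = fromℕ p * (cᵀ · c · v) y + - (x * fromℕ p) * (c · cᵀ · v) y + - ((x + 1#) * Q) * (down y * v y)

    casimir-linear : Linear casimir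
    casimir-linear = +-linear
      (+-linear (*-linear (λ _ → fromℕ p) (∘-linear (·-linear cᵀ) (·-linear c)))
                (*-linear (λ _ → - (x * fromℕ p)) (∘-linear (·-linear c) (·-linear cᵀ))))
      (*-linear (λ _ → - ((x + 1#) * Q)) (*-linear down id-linear))

    -- The commutation relation is used once with weight 1 and once with weight -q. The two Ω-terms
    -- cancel because q R K⁻¹ = K⁻¹ R and Ω is central; the K-terms left over are absorbed by the
    -- last summand of `casimir`, since R K = q K R.
    casimir-c : ∀ v → casimir (c · v) ≋ c · casimir v
    casimir-c v y = ≈-trans
      (solve 15 (λ P X X′ Q D U ν LRR RLR R RRL Rκ RU RΩ ΩR →
          (P :* LRR :+ :- (X :* P) :* RLR :+ :- ((X :+ con (+ 1)) :* Q) :* (D :* R))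
            :- (P :* RLR :+ :- (X :* P) :* RRL :+ :- ((X :+ con (+ 1)) :* Q) :* Rκ) :=
          con (+ 1) :* (P :* LRR :- (P :* RLR :+ Q :* (D :* R) :+ :- ν :* (U :* ΩR)))
          :+ :- X :* (P :* RLR :- (P :* RRL :+ Q :* Rκ :+ :- ν :* RU))
          :+ Q :* (Rκ :- X :* (D :* R))
          :+ ν :* X :* (RU :- X′ :* (U :* RΩ))
          :+ ν :* U :* RΩ :* (X′ :* X :- con (+ 1))
          :+ ν :* U :* (RΩ :- ΩR))
        ≈-refl (fromℕ p) x x⁻¹ Q (down y) (up y) ν ((cᵀ · c · c · v) y) ((c · cᵀ · c · v) y) ((c · v) y) ((c · c · cᵀ · v) y)
          ((c · λ z → down z * v z) y) ((c · λ z → up z * (ω · v) z) y) ((c · ω · v) y) ((ω · c · v) y)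
      by _ ⊙ cᵀc-ccᵀ (c · v) y
       ⊕ _ ⊙ ≈-trans (≈-sym (scale C (fromℕ p) (cᵀ · c · v) y)) (≈-trans (cong C (cᵀc-ccᵀ v) y)
               (combine₃ C (fromℕ p) Q (- ν) (c · cᵀ · v) (λ z → down z * v z) (λ z → up z * (ω · v) z) y))
       ⊕ _ ⊙ c-down v y ⊕ _ ⊙ c-up (ω · v) y ⊕ _ ⊙ x⁻¹x≈1 ⊕ _ ⊙ c-ω v y)
      (≈-sym (combine₃ C (fromℕ p) (- (x * fromℕ p)) (- ((x + 1#) * Q)) (cᵀ · c · v) (c · cᵀ · v) (λ z → down z * v z) y))
      where
      C : Linear (c ·_)
      C = ·-linear c

    -- The mirror computation. The weights of the two uses of the relation are now q and -1, since
    -- `cᵀ` gains a factor q in passing `up` where `c` loses one.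
    casimir-cᵀ : ∀ v → casimir (cᵀ · v) ≋ cᵀ · casimir v
    casimir-cᵀ v y = ≈-trans
      (solve 15 (λ P X X′ Q D U ν LRL RLL L LLR Lκ LU LΩ ΩL →
          (P :* LRL :+ :- (X :* P) :* RLL :+ :- ((X :+ con (+ 1)) :* Q) :* (D :* L))
            :- (P :* LLR :+ :- (X :* P) :* LRL :+ :- ((X :+ con (+ 1)) :* Q) :* Lκ) :=
          X :* (P :* LRL :- (P :* RLL :+ Q :* (D :* L) :+ :- ν :* (U :* ΩL)))
          :+ :- con (+ 1) :* (P :* LLR :- (P :* LRL :+ Q :* Lκ :+ :- ν :* LU))
          :+ X :* Q :* (Lκ :- X′ :* (D :* L))
          :+ ν :* (LU :- X :* (U :* LΩ))
          :+ Q :* D :* L :* (X′ :* X :- con (+ 1))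
          :+ ν :* X :* U :* (LΩ :- ΩL))
        ≈-refl (fromℕ p) x x⁻¹ Q (down y) (up y) ν ((cᵀ · c · cᵀ · v) y) ((c · cᵀ · cᵀ · v) y) ((cᵀ · v) y) ((cᵀ · cᵀ · c · v) y)
          ((cᵀ · λ z → down z * v z) y) ((cᵀ · λ z → up z * (ω · v) z) y) ((cᵀ · ω · v) y) ((ω · cᵀ · v) y)
      by _ ⊙ cᵀc-ccᵀ (cᵀ · v) y
       ⊕ _ ⊙ ≈-trans (≈-sym (scale C (fromℕ p) (cᵀ · c · v) y)) (≈-trans (cong C (cᵀc-ccᵀ v) y)
               (combine₃ C (fromℕ p) Q (- ν) (c · cᵀ · v) (λ z → down z * v z) (λ z → up z * (ω · v) z) y))
       ⊕ _ ⊙ cᵀ-down v y ⊕ _ ⊙ cᵀ-up (ω · v) y ⊕ _ ⊙ x⁻¹x≈1 ⊕ _ ⊙ cᵀ-ω v y)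
      (≈-sym (combine₃ C (fromℕ p) (- (x * fromℕ p)) (- ((x + 1#) * Q)) (cᵀ · c · v) (c · cᵀ · v) (λ z → down z * v z) y))
      where
      C : Linear (cᵀ ·_)
      C = ·-linear cᵀ

    -- Each of L R, R L and K preserves the dimension, so the factors q and q⁻¹ picked up on the way
    -- cancel.
    casimir-up : ∀ v → casimir (λ y → up y * v y) ≋ λ y → up y * casimir v y
    casimir-up v y =
      solve 11 (λ P X X′ Q D U LRU RLU LR RL V →
          (P :* LRU :+ :- (X :* P) :* RLU :+ :- ((X :+ con (+ 1)) :* Q) :* (D :* (U :* V)))
            :- U :* (P :* LR :+ :- (X :* P) :* RL :+ :- ((X :+ con (+ 1)) :* Q) :* (D :* V)) :=
          P :* (LRU :- X′ :* (X :* (U :* LR)))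
          :+ :- (X :* P) :* (RLU :- X :* (X′ :* (U :* RL)))
          :+ (P :* U :* LR :- X :* P :* U :* RL) :* (X′ :* X :- con (+ 1)))
        ≈-refl (fromℕ p) x x⁻¹ Q (down y) (up y) ((cᵀ · c · λ z → up z * v z) y) ((c · cᵀ · λ z → up z * v z) y)
          ((cᵀ · c · v) y) ((c · cᵀ · v) y) (v y)
      by _ ⊙ chain (·-linear cᵀ) x⁻¹ x (λ z → up z * (cᵀ · c · v) z) (c-up v) (cᵀ-up (c · v))
       ⊕ _ ⊙ chain (·-linear c) x x⁻¹ (λ z → up z * (c · cᵀ · v) z) (cᵀ-up v) (c-up (cᵀ · v))
       ⊕ _ ⊙ x⁻¹x≈1
      where
      chain : ∀ {f} {u w : Vec} → Linear f → ∀ a b (w′ : Vec) → (∀ z → u z ≈ a * w z) → (∀ z → f w z ≈ b * w′ z) → f u y ≈ a * (b * w′ y)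
      chain F a b w′ u≈ fw≈ = ≈-trans (cong F u≈ y) (≈-trans (scale F a _ y) (*-congˡ (fw≈ y)))

    𝒜 : Operator
    𝒜 v y = (c · v) y + up y * (cᵀ · v) y

    𝒜-linear : Linear 𝒜
    𝒜-linear = +-linear (·-linear c) (*-linear up (·-linear cᵀ))

    casimir-𝒜 : ∀ v → casimir (𝒜 v) ≋ 𝒜 (casimir v)
    casimir-𝒜 v y = begin
      casimir (𝒜 v) y                                        ≈⟨ add casimir-linear (c · v) (λ z → up z * (cᵀ · v) z) y ⟩
      casimir (c · v) y + casimir (λ z → up z * (cᵀ · v) z) y ≈⟨ +-cong (casimir-c v y) (casimir-up (cᵀ · v) y) ⟩
      (c · casimir v) y + up y * casimir (cᵀ · v) y           ≈⟨ +-congˡ (*-congˡ (casimir-cᵀ v y)) ⟩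
      𝒜 (casimir v) y                                        ∎

    𝒜-down : ∀ v y → 𝒜 (λ z → down z * v z) y ≈ x * (down y * (c · v) y) + x⁻¹ * (cᵀ · v) y
    𝒜-down v y =
      solve 8 (λ X X′ D U R L Rκ Lκ → Rκ :+ U :* Lκ :- (X :* (D :* R) :+ X′ :* L) :=
          con (+ 1) :* (Rκ :- X :* (D :* R)) :+ U :* (Lκ :- X′ :* (D :* L)) :+ X′ :* L :* (D :* U :- con (+ 1)))
        ≈-refl x x⁻¹ (down y) (up y) ((c · v) y) ((cᵀ · v) y) ((c · λ z → down z * v z) y) ((cᵀ · λ z → down z * v z) y)
      by _ ⊙ c-down v y ⊕ _ ⊙ cᵀ-down v y ⊕ _ ⊙ down*up≈1 y

    -- The coefficient of L R forces γ: it is 1 - q⁻² in A² K - (q + q⁻¹) A K A + K A² and q - 1 in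
    -- `casimir`. Then ρ K has to match the K-term of γ `casimir`.
    γ ρ : Carrier
    γ = (x + 1#) * (x⁻¹ * x⁻¹)
    ρ = γ * ((x + 1#) * Q)

    module _ {θ : Carrier} {v : Vec} (𝒜v≋θv : 𝒜 v ≋ λ y → θ * v y) where

      dual seed : Vec
      dual y = down y * v y
      seed y = γ * casimir v y

      seed-eigen : 𝒜 seed ≋ λ y → θ * seed y
      seed-eigen y = begin
        𝒜 seed y                            ≈⟨ scale 𝒜-linear γ (casimir v) y ⟩
        γ * 𝒜 (casimir v) y                 ≈⟨ *-congˡ (casimir-𝒜 v y) ⟨
        γ * casimir (𝒜 v) y                 ≈⟨ *-congˡ (≈-trans (cong casimir-linear 𝒜v≋θv y) (scale casimir-linear θ v y)) ⟩
        γ * (θ * casimir v y)               ≈⟨ solve 3 (λ a b c → a :* (b :* c) := b :* (a :* c)) ≈-refl γ θ _ ⟩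
        θ * seed y                          ∎

      private
        through : ∀ {f} → Linear f → ∀ y → f (c · v) y + f (λ z → up z * (cᵀ · v) z) y ≈ θ * f v y
        through F y = ≈-trans (≈-sym (add F (c · v) (λ z → up z * (cᵀ · v) z) y)) (≈-trans (cong F 𝒜v≋θv y) (scale F θ v y))

        c-eigen : ∀ y → (c · c · v) y + x⁻¹ * (up y * (c · cᵀ · v) y) ≈ θ * (c · v) y
        c-eigen y = ≈-trans (+-congˡ (≈-sym (c-up (cᵀ · v) y))) (through (·-linear c) y)

        cᵀ-eigen : ∀ y → (cᵀ · c · v) y + x * (up y * (cᵀ · cᵀ · v) y) ≈ θ * (cᵀ · v) y
        cᵀ-eigen y = ≈-trans (+-congˡ (≈-sym (cᵀ-up (cᵀ · v) y))) (through (·-linear cᵀ) y)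

        𝒜𝒜dual : ∀ y → 𝒜 (𝒜 dual) y ≈
          x * (x * (down y * (c · c · v) y)) + x⁻¹ * (c · cᵀ · v) y
            + up y * (x * (x⁻¹ * (down y * (cᵀ · c · v) y)) + x⁻¹ * (cᵀ · cᵀ · v) y)
        𝒜𝒜dual y = ≈-trans (cong 𝒜-linear (𝒜-down v) y) (+-cong
          (≈-trans (combine (·-linear c) x x⁻¹ (λ z → down z * (c · v) z) (cᵀ · v) y) (+-congʳ (*-congˡ (c-down (c · v) y))))
          (*-congˡ (≈-trans (combine (·-linear cᵀ) x x⁻¹ (λ z → down z * (c · v) z) (cᵀ · v) y) (+-congʳ (*-congˡ (cᵀ-down (c · v) y))))))

        p≈x-1 : fromℕ p ≈ x - 1#
        p≈x-1 = solve 2 (λ P X → P :- (X :- con (+ 1)) := :- con (+ 1) :* (X :- (con (+ 1) :+ P))) ≈-refl (fromℕ p) x by _ ⊙ x≈1+p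

      -- On an eigenvector the expression in A and K becomes a quadratic polynomial in A applied to
      -- K v. The terms R R v and L L v are eliminated by the images of the eigenvalue equation
      -- under `c` and `cᵀ`.
      dual-quadratic : ∀ y → 𝒜 (𝒜 dual) y + - ((x + x⁻¹) * θ) * 𝒜 dual y + (θ * θ - ρ) * dual y ≈ seed y
      dual-quadratic y = ≈-trans (+-congʳ (+-cong (𝒜𝒜dual y) (*-congˡ (𝒜-down v y))))
        (solve 14 (λ P X X′ Q D U θ RR RL LR LL R L V →
            let t = X′ :* X ; γ = (X :+ con (+ 1)) :* (X′ :* X′) in
            (X :* (X :* (D :* RR)) :+ X′ :* RL :+ U :* (X :* (X′ :* (D :* LR)) :+ X′ :* LL))
              :+ :- ((X :+ X′) :* θ) :* (X :* (D :* R) :+ X′ :* L)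
              :+ (θ :* θ :- γ :* ((X :+ con (+ 1)) :* Q)) :* (D :* V)
              :- γ :* (P :* LR :+ :- (X :* P) :* RL :+ :- ((X :+ con (+ 1)) :* Q) :* (D :* V)) :=
            :- (D :* θ) :* (R :+ U :* L :- θ :* V)
            :+ :- (D :- (X :+ X′) :* X :* D) :* (RR :+ X′ :* (U :* RL) :- θ :* R)
            :+ :- (D :* U :- (X :+ X′) :* X′) :* (LR :+ X :* (U :* LL) :- θ :* L)
            :+ (:- (D :* RR) :+ (X :* t :- con (+ 2) :* X′) :* RL :- (t :+ con (+ 1)) :* LR :- U :* (X :+ X′) :* LL) :* (t :- con (+ 1))
            :+ ((X′ :- (X :+ X′) :* t) :* RL :+ (t :+ con (+ 1)) :* LR :+ U :* X :* LL) :* (D :* U :- con (+ 1))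
            :+ ((X :+ con (+ 1)) :* X′ :* t :* RL :- γ :* LR) :* (P :- (X :- con (+ 1))))
          ≈-refl (fromℕ p) x x⁻¹ Q (down y) (up y) θ ((c · c · v) y) ((c · cᵀ · v) y) ((cᵀ · c · v) y) ((cᵀ · cᵀ · v) y)
            ((c · v) y) ((cᵀ · v) y) (v y)
        by _ ⊙ 𝒜v≋θv y ⊕ _ ⊙ c-eigen y ⊕ _ ⊙ cᵀ-eigen y ⊕ _ ⊙ x⁻¹x≈1 ⊕ _ ⊙ down*up≈1 y ⊕ _ ⊙ p≈x-1)

      -- Here `p₋`, `p₊` and `t` are the inverses of the gaps between the three values. The vector
      -- `u₀` solves (A - θ₋)(A - θ₊) u₀ = `seed`, so this quadratic kills `dual` - `u₀`. Applying t
      -- (A - θ₊) and -t (A - θ₋) to that remainder gives `u₋` and `u₊`.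
      dual-splits : ∀ θ₋ θ₊ p₋ p₊ t → (θ - θ₋) * p₋ ≈ 1# → (θ - θ₊) * p₊ ≈ 1# → (θ₋ - θ₊) * t ≈ 1# →
        θ₋ + θ₊ ≈ (x + x⁻¹) * θ → θ₋ * θ₊ ≈ θ * θ - ρ →
        ∃ λ u₋ → ∃ λ u₀ → ∃ λ u₊ → 𝒜 u₋ ≋ (λ y → θ₋ * u₋ y) × 𝒜 u₀ ≋ (λ y → θ * u₀ y) × 𝒜 u₊ ≋ (λ y → θ₊ * u₊ y) ×
          dual ≋ λ y → u₋ y + u₀ y + u₊ y
      dual-splits θ₋ θ₊ p₋ p₊ t e₋ e₊ eₜ sum≈ product≈ =
        u₋ , u₀ , u₊ , u₋-eigen , u₀-eigen , u₊-eigen , λ y →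
          solve 9 (λ θ θ₋ θ₊ p₋ p₊ t A u s →
              u :- ((t :* A :+ :- (t :* θ₊) :* u :+ :- (t :* p₋) :* s) :+ p₋ :* p₊ :* s :+ (:- t :* A :+ t :* θ₋ :* u :+ t :* p₊ :* s)) :=
              (:- (s :* t :* p₋)) :* ((θ :- θ₊) :* p₊ :- con (+ 1)) :+ s :* t :* p₊ :* ((θ :- θ₋) :* p₋ :- con (+ 1))
              :+ (s :* p₋ :* p₊ :- u) :* ((θ₋ :- θ₊) :* t :- con (+ 1)))
            ≈-refl θ θ₋ θ₊ p₋ p₊ t (𝒜 dual y) (dual y) (seed y)
          by _ ⊙ e₊ ⊕ _ ⊙ e₋ ⊕ _ ⊙ eₜ
        where
        u₋ u₀ u₊ : Vec
        u₋ y = t * 𝒜 dual y + - (t * θ₊) * dual y + - (t * p₋) * seed y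
        u₀ y = p₋ * p₊ * seed y
        u₊ y = - t * 𝒜 dual y + t * θ₋ * dual y + t * p₊ * seed y

        u₀-eigen : 𝒜 u₀ ≋ λ y → θ * u₀ y
        u₀-eigen y = ≈-trans (scale 𝒜-linear (p₋ * p₊) seed y) (≈-trans (*-congˡ (seed-eigen y))
          (solve 3 (λ a θ s → a :* (θ :* s) := θ :* (a :* s)) ≈-refl (p₋ * p₊) θ (seed y)))

        u₋-eigen : 𝒜 u₋ ≋ λ y → θ₋ * u₋ y
        u₋-eigen y = ≈-trans (combine₃ 𝒜-linear t (- (t * θ₊)) (- (t * p₋)) (𝒜 dual) dual seed y)
          (solve 12 (λ θ θ₋ θ₊ p t B ρ AA A u s sA →
              t :* AA :+ :- (t :* θ₊) :* A :+ :- (t :* p) :* sA :- θ₋ :* (t :* A :+ :- (t :* θ₊) :* u :+ :- (t :* p) :* s) :=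
              t :* (AA :+ :- (B :* θ) :* A :+ (θ :* θ :- ρ) :* u :- s)
              :+ :- (t :* A) :* (θ₋ :+ θ₊ :- B :* θ) :+ t :* u :* (θ₋ :* θ₊ :- (θ :* θ :- ρ))
              :+ :- (t :* p) :* (sA :- θ :* s) :+ :- (t :* s) :* ((θ :- θ₋) :* p :- con (+ 1)))
            ≈-refl θ θ₋ θ₊ p₋ t (x + x⁻¹) ρ (𝒜 (𝒜 dual) y) (𝒜 dual y) (dual y) (seed y) (𝒜 seed y)
          by _ ⊙ dual-quadratic y ⊕ _ ⊙ sum≈ ⊕ _ ⊙ product≈ ⊕ _ ⊙ seed-eigen y ⊕ _ ⊙ e₋)

        u₊-eigen : 𝒜 u₊ ≋ λ y → θ₊ * u₊ y
        u₊-eigen y = ≈-trans (combine₃ 𝒜-linear (- t) (t * θ₋) (t * p₊) (𝒜 dual) dual seed y)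
          (solve 12 (λ θ θ₋ θ₊ p t B ρ AA A u s sA →
              :- t :* AA :+ t :* θ₋ :* A :+ t :* p :* sA :- θ₊ :* (:- t :* A :+ t :* θ₋ :* u :+ t :* p :* s) :=
              :- t :* (AA :+ :- (B :* θ) :* A :+ (θ :* θ :- ρ) :* u :- s)
              :+ t :* A :* (θ₋ :+ θ₊ :- B :* θ) :+ :- (t :* u) :* (θ₋ :* θ₊ :- (θ :* θ :- ρ))
              :+ t :* p :* (sA :- θ :* s) :+ t :* s :* ((θ :- θ₊) :* p :- con (+ 1)))
            ≈-refl θ θ₋ θ₊ p₊ t (x + x⁻¹) ρ (𝒜 (𝒜 dual) y) (𝒜 dual y) (dual y) (seed y) (𝒜 seed y)
          by _ ⊙ dual-quadratic y ⊕ _ ⊙ sum≈ ⊕ _ ⊙ product≈ ⊕ _ ⊙ seed-eigen y ⊕ _ ⊙ e₊)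

-- Linear algebra in a finite vector space

T-does⁺ : ∀ {p} {P : Set p} (P? : Dec P) → P → T (does P?)
T-does⁺ (yes _) _ = _
T-does⁺ (no ¬p) p = contradiction p ¬p

T-does⁻ : ∀ {p} {P : Set p} (P? : Dec P) → T (does P?) → P
T-does⁻ (yes p) _ = p

module FiniteSpace {c ℓ₁ ℓ₂ m ℓm : Level}
  (F : HeytingField c ℓ₁ ℓ₂) {q : ℕ} (∣F∣≡q : F HasOrder q)
  (H : VectorSpace F m ℓm) {n : ℕ} (dimH : LinearAlgebra.HasDimension F H U n)
  where

  open HeytingField F using (Carrier; _≈_; _+_; _*_; -_; 0#; 1#)
  open Module H
  open LinearAlgebra F H
  open FiniteLinearAlgebra F ∣F∣≡q H dimH
  open Counting using (∑; ⟨_⟩; ∑-image)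
  open Algebra.Properties.CommutativeMonoid.Sum +ᴹ-commutativeMonoid using (sum; sum-cong-≋)
  open IsBasisOf
  private module 𝔽 = CommutativeRing (scalars F)
  open SetoidReasoning ≈ᴹ-setoid

  basis : ∀ y → Vector Carrierᴹ (dim y)
  basis y = proj₁ (dim-basis y)

  basis-isBasis : ∀ y → IsBasisOf (_∈ y) (basis y)
  basis-isBasis y = proj₂ (dim-basis y)

  lc-congʳ : ∀ {k} (a : Vector Carrier k) {v w : Vector Carrierᴹ k} → (∀ i → v i ≈ᴹ w i) →
             linearCombination a v ≈ᴹ linearCombination a w
  lc-congʳ a v≈w = sum-cong-≋ λ i → *ₗ-congˡ (v≈w i)

  lc-closed : ∀ (y : Subspace) {k} (a : Vector Carrier k) (v : Vector Carrierᴹ k) → (∀ i → v i ∈ y) → linearCombination a v ∈ y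
  lc-closed y {zero}  a v v∈y = Subspace.0-closed y
  lc-closed y {suc k} a v v∈y = Subspace.+-closed y (Subspace.*ₗ-closed y (a zero) (v∈y zero)) (lc-closed y (a ∘ suc) (v ∘ suc) (v∈y ∘ suc))

  independent-resp : ∀ {k} {v w : Vector Carrierᴹ k} → (∀ i → v i ≈ᴹ w i) → LinearlyIndependent v → LinearlyIndependent w
  independent-resp v≈w v-independent a aw≈0 = v-independent a (≈ᴹ-trans (lc-congʳ a v≈w) aw≈0)

  δ : ∀ {k} → Fin k → Vector Carrier k
  δ i j = if does (i Fin.≟ j) then 1# else 0#

  δ-refl : ∀ {k} (i : Fin k) → δ i i ≡ 1#
  δ-refl i with i Fin.≟ i
  ... | yes _ = refl
  ... | no i≢i = contradiction refl i≢i

  δ-≢ : ∀ {k} {i j : Fin k} → ¬ i ≡ j → δ i j ≡ 0#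
  δ-≢ {i = i} {j} i≢j with i Fin.≟ j
  ... | yes i≡j = contradiction i≡j i≢j
  ... | no _ = refl

  lc-δ : ∀ {k} i (v : Vector Carrierᴹ k) → linearCombination (δ i) v ≈ᴹ v i
  lc-δ i v = ≈ᴹ-trans
    (SingleTerm.sum-single +ᴹ-commutativeMonoid _ i λ j j≢i → ≈ᴹ-trans (*ₗ-congʳ (𝔽.reflexive (δ-≢ (j≢i ∘ ≡.sym)))) (*ₗ-zeroˡ (v j)))
    (≈ᴹ-trans (*ₗ-congʳ (𝔽.reflexive (δ-refl i))) (*ₗ-identityˡ (v i)))

  abstract
    span : ∀ {k} → Vector Carrierᴹ k → Subspace
    span v = record
      { member? = λ x → does (x ∈Span? v)
      ; resp = λ {x} {y} x≈y x∈ → let a , x≈ = T-does⁻ (x ∈Span? v) x∈ in T-does⁺ (y ∈Span? v) (a , ≈ᴹ-trans (≈ᴹ-sym x≈y) x≈)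
      ; 0-closed = T-does⁺ (0ᴹ ∈Span? v) ((λ _ → 0#) , ≈ᴹ-sym (≈ᴹ-trans (lc-cong v λ i → 𝔽.sym (𝔽.zeroˡ 0#)) (≈ᴹ-trans (lc-* 0# (λ _ → 0#) v) (*ₗ-zeroˡ _))))
      ; +-closed = λ {x} {y} x∈ y∈ → let a , x≈ = T-does⁻ (x ∈Span? v) x∈ ; b , y≈ = T-does⁻ (y ∈Span? v) y∈ in
          T-does⁺ ((x +ᴹ y) ∈Span? v) ((λ i → a i + b i) , ≈ᴹ-trans (+ᴹ-cong x≈ y≈) (≈ᴹ-sym (lc-+ a b v)))
      ; *ₗ-closed = λ s {x} x∈ → let a , x≈ = T-does⁻ (x ∈Span? v) x∈ in
          T-does⁺ ((s *ₗ x) ∈Span? v) ((λ i → s * a i) , ≈ᴹ-trans (*ₗ-congˡ x≈) (≈ᴹ-sym (lc-* s a v)))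
      }

    ∈span⁺ : ∀ {k x} (v : Vector Carrierᴹ k) → x ∈Span v → x ∈ span v
    ∈span⁺ {x = x} v = T-does⁺ (x ∈Span? v)

    ∈span⁻ : ∀ {k x} (v : Vector Carrierᴹ k) → x ∈ span v → x ∈Span v
    ∈span⁻ {x = x} v = T-does⁻ (x ∈Span? v)

  span-inside : ∀ {k} (v : Vector Carrierᴹ k) i → v i ∈ span v
  span-inside v i = ∈span⁺ v (δ i , ≈ᴹ-sym (lc-δ i v))

  span-least : ∀ {k} {v : Vector Carrierᴹ k} (y : Subspace) → (∀ i → v i ∈ y) → span v ⊆ y
  span-least {v = v} y v∈y x∈ = let a , x≈ = ∈span⁻ v x∈ in Subspace.resp y (≈ᴹ-sym x≈) (lc-closed y a v v∈y)

  span-isBasis : ∀ {k} {v : Vector Carrierᴹ k} → LinearlyIndependent v → IsBasisOf (_∈ span v) v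
  span-isBasis {v = v} v-independent = record { inside = span-inside v ; independent = v-independent ; spanning = ∈span⁻ v }

  -- The exchange lemma by counting: the q^k combinations of `v` are distinct, and each has a
  -- coefficient vector over `w`, of which there are q^l.
  independent-in-span⇒≤ : ∀ {k l} {v : Vector Carrierᴹ k} {w : Vector Carrierᴹ l} → LinearlyIndependent v → (∀ i → v i ∈Span w) → k ≤ l
  independent-in-span⇒≤ {k} {l} {v} {w} v-independent v∈w = ℕ.≮⇒≥ λ l<k →
    ℕ.<⇒≱ (ℕ.^-monoʳ-< q 1<q l<k) (Fin.injective⇒≤ {f = f} f-injective)
    where
    coefficients : (i : Fin (q ℕ.^ k)) → linearCombination (decode {k} i) v ∈Span w
    coefficients i = ∈span⁻ w (lc-closed (span w) (decode {k} i) v λ j → ∈span⁺ w (v∈w j))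
    f : Fin (q ℕ.^ k) → Fin (q ℕ.^ l)
    f i = encode (proj₁ (coefficients i))
    f-injective : ∀ {i j} → f i ≡ f j → i ≡ j
    f-injective {i} {j} eq = ≡.trans (≡.sym (encode-decode {k} i)) (≡.trans (encode-cong (lc-injective v-independent (begin
      linearCombination (decode {k} i) v              ≈⟨ proj₂ (coefficients i) ⟩
      linearCombination (proj₁ (coefficients i)) w    ≈⟨ lc-cong w (λ s → decode-encode {l} _ s) ⟨
      linearCombination (decode {l} (f i)) w          ≡⟨ ≡.cong (λ s → linearCombination (decode {l} s) w) eq ⟩
      linearCombination (decode {l} (f j)) w          ≈⟨ lc-cong w (λ s → decode-encode {l} _ s) ⟩
      linearCombination (proj₁ (coefficients j)) w    ≈⟨ proj₂ (coefficients j) ⟨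
      linearCombination (decode {k} j) v              ∎))) (encode-decode {k} j))

  independent-inside⇒≤dim : ∀ {k} {v : Vector Carrierᴹ k} y → LinearlyIndependent v → (∀ i → v i ∈ y) → k ≤ dim y
  independent-inside⇒≤dim y v-independent v∈y = independent-in-span⇒≤ v-independent λ i → spanning (basis-isBasis y) (v∈y i)

  isBasis⇒dim≡ : ∀ {k} {v : Vector Carrierᴹ k} y → IsBasisOf (_∈ y) v → dim y ≡ k
  isBasis⇒dim≡ y v-isBasis = ℕ.≤-antisym
    (independent-in-span⇒≤ (independent (basis-isBasis y)) λ i → spanning v-isBasis (inside (basis-isBasis y) i))
    (independent-inside⇒≤dim y (independent v-isBasis) (inside v-isBasis))

  dim-mono : ∀ {y z} → y ⊆ z → dim y ≤ dim z
  dim-mono {y} {z} y⊆z = independent-inside⇒≤dim z (independent (basis-isBasis y)) λ i → y⊆z (inside (basis-isBasis y) i)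

  dim-resp : ∀ {y z} → y ≐ z → dim y ≡ dim z
  dim-resp (y⊆z , z⊆y) = ℕ.≤-antisym (dim-mono y⊆z) (dim-mono z⊆y)

  ∉⇒∉Span : ∀ {y x} → ¬ x ∈ y → ¬ x ∈Span basis y
  ∉⇒∉Span {y} x∉y (a , x≈) = x∉y (Subspace.resp y (≈ᴹ-sym x≈) (lc-closed y a _ (inside (basis-isBasis y))))

  ∈? : ∀ x y → Dec (x ∈ y)
  ∈? x y = Bool.T? (Subspace.member? y x)

  -- A vector of z outside y would extend a basis of y to more than `dim z` independent vectors of
  -- z.
  ⊆∧dim≥⇒⊇ : ∀ {y z} → y ⊆ z → dim z ≤ dim y → z ⊆ y
  ⊆∧dim≥⇒⊇ {y} {z} y⊆z dim≥ {x} x∈z = decidable-stable (∈? x y) λ x∉y → ℕ.<⇒≱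
    (independent-inside⇒≤dim {v = x ◂ basis y} z (extend-independent (independent (basis-isBasis y)) (∉⇒∉Span {y} x∉y))
      λ { zero → x∈z ; (suc i) → y⊆z (inside (basis-isBasis y) i) }) dim≥

  ⊈⇒∃ : ∀ {y z} → ¬ z ⊆ y → ∃ λ x → x ∈ z × ¬ x ∈ y
  ⊈⇒∃ {y} {z} z⊈y with ∃ᴹ? (λ x≈x′ (x∈z , x∉y) → Subspace.resp z x≈x′ x∈z , λ x′∈y → x∉y (Subspace.resp y (≈ᴹ-sym x≈x′) x′∈y))
                             (λ x → ∈? x z ×-dec ¬? (∈? x y))
  ... | yes ∃x = ∃x
  ... | no ∄x = contradiction (λ {x} x∈z → decidable-stable (∈? x y) λ x∉y → ∄x (x , x∈z , x∉y)) z⊈y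

  adjoin : Subspace → Carrierᴹ → Subspace
  adjoin y x = span (x ◂ basis y)

  x∈adjoin : ∀ y x → x ∈ adjoin y x
  x∈adjoin y x = span-inside (x ◂ basis y) zero

  ⊆adjoin : ∀ y x → y ⊆ adjoin y x
  ⊆adjoin y x {t} t∈y = let a , t≈ = spanning (basis-isBasis y) t∈y in Subspace.resp (adjoin y x) (≈ᴹ-sym t≈)
    (lc-closed (adjoin y x) a (basis y) λ i → span-inside (x ◂ basis y) (suc i))

  adjoin-least : ∀ {y x} z → y ⊆ z → x ∈ z → adjoin y x ⊆ z
  adjoin-least {y} {x} z y⊆z x∈z = span-least {v = x ◂ basis y} z λ { zero → x∈z ; (suc i) → y⊆z (inside (basis-isBasis y) i) }

  ∈adjoin⁻ : ∀ {y x t} → t ∈ adjoin y x → ∃₂ λ a s → s ∈ y × t ≈ᴹ a *ₗ x +ᴹ s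
  ∈adjoin⁻ {y} {x} t∈ = let a , t≈ = ∈span⁻ (x ◂ basis y) t∈ in
    a zero , linearCombination (a ∘ suc) (basis y) , lc-closed y (a ∘ suc) (basis y) (inside (basis-isBasis y)) , t≈

  dim-adjoin : ∀ {y x} → ¬ x ∈ y → dim (adjoin y x) ≡ suc (dim y)
  dim-adjoin {y} {x} x∉y = isBasis⇒dim≡ (adjoin y x) (span-isBasis {v = x ◂ basis y} (extend-independent (independent (basis-isBasis y)) (∉⇒∉Span {y} x∉y)))

  cover⊆adjoin : ∀ {y z x} → y ⊆ z → dim z ≡ suc (dim y) → x ∈ z → ¬ x ∈ y → z ⊆ adjoin y x
  cover⊆adjoin {y} {z} {x} y⊆z dimz x∈z x∉y = ⊆∧dim≥⇒⊇ (adjoin-least z y⊆z x∈z) (ℕ.≤-reflexive (≡.trans dimz (≡.sym (dim-adjoin {y} x∉y))))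

  abstract
    _⊓_ : Subspace → Subspace → Subspace
    y ⊓ z = record
      { member? = λ x → does (∈? x y ×-dec ∈? x z)
      ; resp = λ {x} {x′} x≈x′ x∈ → let x∈y , x∈z = T-does⁻ (∈? x y ×-dec ∈? x z) x∈ in
          T-does⁺ (∈? x′ y ×-dec ∈? x′ z) (Subspace.resp y x≈x′ x∈y , Subspace.resp z x≈x′ x∈z)
      ; 0-closed = T-does⁺ (∈? 0ᴹ y ×-dec ∈? 0ᴹ z) (Subspace.0-closed y , Subspace.0-closed z)
      ; +-closed = λ {x} {x′} x∈ x′∈ → let x∈y , x∈z = T-does⁻ (∈? x y ×-dec ∈? x z) x∈ ; x′∈y , x′∈z = T-does⁻ (∈? x′ y ×-dec ∈? x′ z) x′∈ in
          T-does⁺ (∈? (x +ᴹ x′) y ×-dec ∈? (x +ᴹ x′) z) (Subspace.+-closed y x∈y x′∈y , Subspace.+-closed z x∈z x′∈z)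
      ; *ₗ-closed = λ a {x} x∈ → let x∈y , x∈z = T-does⁻ (∈? x y ×-dec ∈? x z) x∈ in
          T-does⁺ (∈? (a *ₗ x) y ×-dec ∈? (a *ₗ x) z) (Subspace.*ₗ-closed y a x∈y , Subspace.*ₗ-closed z a x∈z)
      }

    ∈⊓⁺ : ∀ {y z x} → x ∈ y → x ∈ z → x ∈ (y ⊓ z)
    ∈⊓⁺ {y} {z} {x} x∈y x∈z = T-does⁺ (∈? x y ×-dec ∈? x z) (x∈y , x∈z)

    ∈⊓⁻ : ∀ {y z x} → x ∈ (y ⊓ z) → x ∈ y × x ∈ z
    ∈⊓⁻ {y} {z} {x} = T-does⁻ (∈? x y ×-dec ∈? x z)

  card : Subspace → ℕ
  card y = ∑ λ i → ⟨ ∈? (vector i) y ⟩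

  card≡ : ∀ {k} {v : Vector Carrierᴹ k} y → IsBasisOf (_∈ y) v → card y ≡ q ℕ.^ k
  card≡ {k} {v} y v-isBasis = ∑-image (λ i → ∈? (vector i) y) f f-injective f∈y surjective
    where
    f : Fin (q ℕ.^ k) → Fin (q ℕ.^ n)
    f j = index (linearCombination (decode {k} j) v)
    f-injective : ∀ {i j} → f i ≡ f j → i ≡ j
    f-injective {i} {j} eq = ≡.trans (≡.sym (encode-decode {k} i))
      (≡.trans (encode-cong (lc-injective (independent v-isBasis) (index-injective eq))) (encode-decode {k} j))
    f∈y : ∀ j → vector (f j) ∈ y
    f∈y j = Subspace.resp y (≈ᴹ-sym (vector-index _)) (lc-closed y (decode {k} j) v (inside v-isBasis))
    surjective : ∀ i → vector i ∈ y → ∃ λ j → f j ≡ i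
    surjective i i∈y = let a , i≈ = spanning v-isBasis i∈y in encode a ,
      ≡.trans (index-cong (≈ᴹ-trans (lc-cong v (decode-encode {k} a)) (≈ᴹ-sym i≈))) (index-vector i)

  ++-suc : ∀ {k l} (v : Vector Carrierᴹ (suc k)) (w : Vector Carrierᴹ l) i → (v ++ w) (suc i) ≡ ((v ∘ suc) ++ w) i
  ++-suc {k} v w i with splitAt k i
  ... | inj₁ _ = refl
  ... | inj₂ _ = refl

  lc-++ : ∀ {k l} (a : Vector Carrier (k ℕ.+ l)) (v : Vector Carrierᴹ k) (w : Vector Carrierᴹ l) →
          linearCombination a (v ++ w) ≈ᴹ linearCombination (λ i → a (i ↑ˡ l)) v +ᴹ linearCombination (λ i → a (k ↑ʳ i)) w
  lc-++ {zero}  a v w = ≈ᴹ-sym (+ᴹ-identityˡ _)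
  lc-++ {suc k} a v w = ≈ᴹ-trans
    (+ᴹ-congˡ (≈ᴹ-trans (lc-congʳ (a ∘ suc) (λ i → ≈ᴹ-reflexive (++-suc v w i))) (lc-++ (a ∘ suc) (v ∘ suc) w)))
    (≈ᴹ-sym (+ᴹ-assoc _ _ _))

  ++-cases : ∀ {k l p} (P : Fin (k ℕ.+ l) → Set p) → (∀ i → P (i ↑ˡ l)) → (∀ i → P (k ↑ʳ i)) → ∀ i → P i
  ++-cases {k} {l} P left right i with splitAt k i in eq
  ... | inj₁ j = ≡.subst P (Fin.splitAt⁻¹-↑ˡ eq) (left j)
  ... | inj₂ j = ≡.subst P (Fin.splitAt⁻¹-↑ʳ eq) (right j)

  ++-left : ∀ {a} {A : Set a} {k l} (v : Vector A k) (w : Vector A l) i → (v ++ w) (i ↑ˡ l) ≡ v i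
  ++-left {k = k} {l} v w i = ≡.cong Sum.[ v , w ] (Fin.splitAt-↑ˡ k i l)

  ++-right : ∀ {a} {A : Set a} {k l} (v : Vector A k) (w : Vector A l) i → (v ++ w) (k ↑ʳ i) ≡ w i
  ++-right {k = k} {l} v w i = ≡.cong Sum.[ v , w ] (Fin.splitAt-↑ʳ k l i)

  x+y≈0∧y∈z⇒x∈z : ∀ {x y} z → x +ᴹ y ≈ᴹ 0ᴹ → y ∈ z → x ∈ z
  x+y≈0∧y∈z⇒x∈z {x} {y} z x+y≈0 y∈z = Subspace.resp z (begin
    (- 1#) *ₗ y                   ≈⟨ +ᴹ-identityˡ _ ⟨
    0ᴹ +ᴹ (- 1#) *ₗ y             ≈⟨ +ᴹ-congʳ x+y≈0 ⟨
    (x +ᴹ y) +ᴹ (- 1#) *ₗ y       ≈⟨ +ᴹ-assoc _ _ _ ⟩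
    x +ᴹ (y +ᴹ (- 1#) *ₗ y)       ≈⟨ +ᴹ-congˡ (x+-1x≈0 y) ⟩
    x +ᴹ 0ᴹ                       ≈⟨ +ᴹ-identityʳ x ⟩
    x                             ∎) (Subspace.*ₗ-closed z (- 1#) y∈z)

  -- In a vanishing combination the part over `v` is minus the part over `w`, so it lies in both y
  -- and z.
  ++-independent : ∀ {k l} {v : Vector Carrierᴹ k} {w : Vector Carrierᴹ l} y z → MeetTrivially y z →
                   LinearlyIndependent v → (∀ i → v i ∈ y) → LinearlyIndependent w → (∀ i → w i ∈ z) → LinearlyIndependent (v ++ w)
  ++-independent {k} {l} {v} {w} y z meet v-independent v∈y w-independent w∈z a a[v++w]≈0 =
    ++-cases (λ i → a i ≈ 0#) (v-independent a₁ left≈0) (w-independent a₂ right≈0)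
    where
    a₁ : Vector Carrier k
    a₁ i = a (i ↑ˡ l)
    a₂ : Vector Carrier l
    a₂ i = a (k ↑ʳ i)
    sum≈0 : linearCombination a₁ v +ᴹ linearCombination a₂ w ≈ᴹ 0ᴹ
    sum≈0 = ≈ᴹ-trans (≈ᴹ-sym (lc-++ a v w)) a[v++w]≈0
    left≈0 : linearCombination a₁ v ≈ᴹ 0ᴹ
    left≈0 = meet _ (lc-closed y a₁ v v∈y) (x+y≈0∧y∈z⇒x∈z z sum≈0 (lc-closed z a₂ w w∈z))
    right≈0 : linearCombination a₂ w ≈ᴹ 0ᴹ
    right≈0 = ≈ᴹ-trans (≈ᴹ-sym (+ᴹ-identityˡ _)) (≈ᴹ-trans (+ᴹ-congʳ (≈ᴹ-sym left≈0)) sum≈0)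

  -- Vectors outside the span are added one at a time. The invariant `n < (l + k) + fuel` means that
  -- exhausting the fuel would leave more than n independent vectors.
  complement : ∀ {k} (v : Vector Carrierᴹ k) → LinearlyIndependent v →
               ∃₂ λ l (w : Vector Carrierᴹ l) → IsBasisOf U (w ++ v) × l ℕ.+ k ≡ n
  complement {k} v v-independent = extend (suc n) {0} (λ ()) (ℕ.m≤n+m (suc n) k) v-independent
    where
    extend : ∀ fuel {l} (w : Vector Carrierᴹ l) → n < (l ℕ.+ k) ℕ.+ fuel → LinearlyIndependent (w ++ v) →
             ∃₂ λ l (w : Vector Carrierᴹ l) → IsBasisOf U (w ++ v) × l ℕ.+ k ≡ n
    extend zero {l} w n< wv-independent = contradiction (independent⇒≤ wv-independent) (ℕ.<⇒≱ (≡.subst (n <_) (ℕ.+-identityʳ (l ℕ.+ k)) n<))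
    extend (suc fuel) {l} w n< wv-independent with ∃ᴹ? (λ x≈x′ x∉ (a , x′≈) → x∉ (a , ≈ᴹ-trans x≈x′ x′≈)) (λ x → ¬? (x ∈Span? (w ++ v)))
    ... | yes (x , x∉) = extend fuel (x ◂ w) (≡.subst (n <_) (ℕ.+-suc (l ℕ.+ k) fuel) n<)
      (independent-resp {v = x ◂ (w ++ v)} {w = (x ◂ w) ++ v} (λ { zero → ≈ᴹ-refl ; (suc i) → ≈ᴹ-reflexive (≡.sym (++-suc (x ◂ w) v i)) }) (extend-independent wv-independent x∉))
    ... | no ∄x = l , w , record { inside = _ ; independent = wv-independent ; spanning = λ {x} _ → spans x } ,
        ℕ.≤-antisym (independent⇒≤ wv-independent) (independent-in-span⇒≤ (independent (proj₂ dimH)) λ i → spans _)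
      where
      spans : ∀ x → x ∈Span (w ++ v)
      spans x = decidable-stable (x ∈Span? (w ++ v)) λ x∉ → ∄x (x , x∉)

  open Algebra.Properties.Semiring.Sum 𝔽.semiring using (∑-distrib-+; *-distribˡ-sum) renaming (sum to sumᶠ; sum-cong-≋ to sumᶠ-cong)

  -- Linear forms, kernels and transvections

  record Form : Set (c ⊔ ℓ₁ ⊔ m ⊔ ℓm) where
    field
      at      : Carrierᴹ → Carrier
      at-cong : ∀ {x y} → x ≈ᴹ y → at x ≈ at y
      at-+    : ∀ x y → at (x +ᴹ y) ≈ at x + at y
      at-*    : ∀ a x → at (a *ₗ x) ≈ a * at x

    at-0 : at 0ᴹ ≈ 0#
    at-0 = 𝔽.trans (at-cong (≈ᴹ-sym (*ₗ-zeroˡ 0ᴹ))) (𝔽.trans (at-* 0# 0ᴹ) (𝔽.zeroˡ _))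

    at-lc : ∀ {k} (a : Vector Carrier k) (v : Vector Carrierᴹ k) → at (linearCombination a v) ≈ sumᶠ λ i → a i * at (v i)
    at-lc {zero}  a v = at-0
    at-lc {suc k} a v = 𝔽.trans (at-+ _ _) (𝔽.+-cong (at-* (a zero) (v zero)) (at-lc (a ∘ suc) (v ∘ suc)))

    at-Span≈0 : ∀ {k x} (v : Vector Carrierᴹ k) → (∀ i → at (v i) ≈ 0#) → x ∈Span v → at x ≈ 0#
    at-Span≈0 v v≈0 (a , x≈) = 𝔽.trans (at-cong x≈) (𝔽.trans (at-lc a v)
      (SingleTerm.sum-zero 𝔽.+-commutativeMonoid _ λ i → 𝔽.trans (𝔽.*-congˡ (v≈0 i)) (𝔽.zeroʳ (a i))))

  open Form

  form-ext : ∀ {k} {v : Vector Carrierᴹ k} → IsBasisOf U v → ∀ f g → (∀ i → at f (v i) ≈ at g (v i)) → ∀ x → at f x ≈ at g x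
  form-ext {v = v} v-isBasis f g f≈g x = let a , x≈ = spanning v-isBasis {x} _ in
    𝔽.trans (𝔽.trans (at-cong f x≈) (at-lc f a v)) (𝔽.trans (sumᶠ-cong λ i → 𝔽.*-congˡ (f≈g i))
      (𝔽.sym (𝔽.trans (at-cong g x≈) (at-lc g a v))))

  module _ {k} {v : Vector Carrierᴹ k} (v-isBasis : IsBasisOf U v) where

    coordinates : Carrierᴹ → Vector Carrier k
    coordinates x = proj₁ (spanning v-isBasis {x} _)

    coordinates-unique : ∀ {x a} → x ≈ᴹ linearCombination a v → ∀ i → coordinates x i ≈ a i
    coordinates-unique {x} x≈ = lc-injective (independent v-isBasis) (≈ᴹ-trans (≈ᴹ-sym (proj₂ (spanning v-isBasis {x} _))) x≈)

    private
      lc-coordinates : ∀ x → x ≈ᴹ linearCombination (coordinates x) v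
      lc-coordinates x = proj₂ (spanning v-isBasis {x} _)

    abstract
      formOf : Vector Carrier k → Form
      formOf a = record
        { at = λ x → sumᶠ λ i → coordinates x i * a i
        ; at-cong = λ {x} {y} x≈y → sumᶠ-cong λ i → 𝔽.*-congʳ (coordinates-unique (≈ᴹ-trans x≈y (lc-coordinates y)) i)
        ; at-+ = λ x y → 𝔽.trans (sumᶠ-cong λ i → 𝔽.trans
            (𝔽.*-congʳ (coordinates-unique (≈ᴹ-trans (+ᴹ-cong (lc-coordinates x) (lc-coordinates y)) (≈ᴹ-sym (lc-+ (coordinates x) (coordinates y) v))) i))
            (𝔽.distribʳ (a i) _ _)) (∑-distrib-+ (λ i → coordinates x i * a i) (λ i → coordinates y i * a i))
        ; at-* = λ s x → 𝔽.trans (sumᶠ-cong λ i → 𝔽.trans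
            (𝔽.*-congʳ (coordinates-unique (≈ᴹ-trans (*ₗ-congˡ (lc-coordinates x)) (≈ᴹ-sym (lc-* s (coordinates x) v))) i))
            (𝔽.*-assoc s _ _)) (𝔽.sym (*-distribˡ-sum s (λ i → coordinates x i * a i)))
        }

      formOf-basis : ∀ a i → at (formOf a) (v i) ≈ a i
      formOf-basis a i = 𝔽.trans (sumᶠ-cong λ j → 𝔽.*-congʳ (coordinates-unique (≈ᴹ-sym (lc-δ i v)) j))
        (𝔽.trans (SingleTerm.sum-single 𝔽.+-commutativeMonoid _ i λ j j≢i →
            𝔽.trans (𝔽.*-congʳ (𝔽.reflexive (δ-≢ (j≢i ∘ ≡.sym)))) (𝔽.zeroˡ (a j)))
          (𝔽.trans (𝔽.*-congʳ (𝔽.reflexive (δ-refl i))) (𝔽.*-identityˡ (a i))))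

  abstract
    kernel : Form → Subspace
    kernel f = record
      { member? = λ x → does (at f x ≟ 0#)
      ; resp = λ {x} {y} x≈y x∈ → T-does⁺ (at f y ≟ 0#) (𝔽.trans (at-cong f (≈ᴹ-sym x≈y)) (T-does⁻ (at f x ≟ 0#) x∈))
      ; 0-closed = T-does⁺ (at f 0ᴹ ≟ 0#) (at-0 f)
      ; +-closed = λ {x} {y} x∈ y∈ → T-does⁺ (at f (x +ᴹ y) ≟ 0#) (𝔽.trans (at-+ f x y)
          (𝔽.trans (𝔽.+-cong (T-does⁻ (at f x ≟ 0#) x∈) (T-does⁻ (at f y ≟ 0#) y∈)) (𝔽.+-identityˡ 0#)))
      ; *ₗ-closed = λ a {x} x∈ → T-does⁺ (at f (a *ₗ x) ≟ 0#) (𝔽.trans (at-* f a x) (𝔽.trans (𝔽.*-congˡ (T-does⁻ (at f x ≟ 0#) x∈)) (𝔽.zeroʳ a)))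
      }

    ∈kernel⁺ : ∀ f {x} → at f x ≈ 0# → x ∈ kernel f
    ∈kernel⁺ f {x} = T-does⁺ (at f x ≟ 0#)

    ∈kernel⁻ : ∀ f {x} → x ∈ kernel f → at f x ≈ 0#
    ∈kernel⁻ f {x} = T-does⁻ (at f x ≟ 0#)

  *ₗ≈0⇒≈0 : ∀ {a x} → ¬ a ≈ 0# → a *ₗ x ≈ᴹ 0ᴹ → x ≈ᴹ 0ᴹ
  *ₗ≈0⇒≈0 {a} {x} a≉0 ax≈0 = let b , ba≈1 = invert a≉0 in begin
    x                ≈⟨ *ₗ-identityˡ x ⟨
    1# *ₗ x          ≈⟨ *ₗ-congʳ ba≈1 ⟨
    (b * a) *ₗ x     ≈⟨ *ₗ-assoc b a x ⟩
    b *ₗ a *ₗ x      ≈⟨ *ₗ-congˡ ax≈0 ⟩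
    b *ₗ 0ᴹ          ≈⟨ *ₗ-zeroʳ b ⟩
    0ᴹ               ∎

  x+y∈z∧y∈z⇒x∈z : ∀ {x y} z → (x +ᴹ y) ∈ z → y ∈ z → x ∈ z
  x+y∈z∧y∈z⇒x∈z {x} {y} z x+y∈z y∈z = Subspace.resp z
    (≈ᴹ-trans (+ᴹ-assoc x y _) (≈ᴹ-trans (+ᴹ-congˡ (x+-1x≈0 y)) (+ᴹ-identityʳ x)))
    (Subspace.+-closed z x+y∈z (Subspace.*ₗ-closed z (- 1#) y∈z))

  x+y∈z∧x∈z⇒y∈z : ∀ {x y} z → (x +ᴹ y) ∈ z → x ∈ z → y ∈ z
  x+y∈z∧x∈z⇒y∈z z x+y∈z x∈z = x+y∈z∧y∈z⇒x∈z z (Subspace.resp z (+ᴹ-comm _ _) x+y∈z) x∈z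

  *ₗ∈⇒∈ : ∀ {a x} z → ¬ a ≈ 0# → (a *ₗ x) ∈ z → x ∈ z
  *ₗ∈⇒∈ {a} {x} z a≉0 ax∈z = let b , ba≈1 = invert a≉0 in
    Subspace.resp z (≈ᴹ-trans (≈ᴹ-sym (*ₗ-assoc b a x)) (≈ᴹ-trans (*ₗ-congʳ ba≈1) (*ₗ-identityˡ x))) (Subspace.*ₗ-closed z b ax∈z)

  shear : Form → Carrierᴹ → Carrierᴹ → Carrierᴹ
  shear f e x = x +ᴹ at f x *ₗ e

  module _ (f : Form) (e : Carrierᴹ) where

    shear-cong : ∀ {x y} → x ≈ᴹ y → shear f e x ≈ᴹ shear f e y
    shear-cong x≈y = +ᴹ-cong x≈y (*ₗ-congʳ (at-cong f x≈y))

    shear-+ : ∀ x y → shear f e (x +ᴹ y) ≈ᴹ shear f e x +ᴹ shear f e y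
    shear-+ x y = ≈ᴹ-trans (+ᴹ-congˡ (≈ᴹ-trans (*ₗ-congʳ (at-+ f x y)) (*ₗ-distribʳ e _ _))) (interchange _ _ _ _)
      where
      open CommutativeMonoid +ᴹ-commutativeMonoid using (commutativeSemigroup)
      open import Algebra.Properties.CommutativeSemigroup commutativeSemigroup using (interchange)

    shear-* : ∀ a x → shear f e (a *ₗ x) ≈ᴹ a *ₗ shear f e x
    shear-* a x = ≈ᴹ-trans (+ᴹ-congˡ (≈ᴹ-trans (*ₗ-congʳ (at-* f a x)) (*ₗ-assoc _ _ _))) (≈ᴹ-sym (*ₗ-distribˡ a _ _))

    shear-fixes : ∀ {x} → at f x ≈ 0# → shear f e x ≈ᴹ x
    shear-fixes {x} fx≈0 = ≈ᴹ-trans (+ᴹ-congˡ (≈ᴹ-trans (*ₗ-congʳ fx≈0) (*ₗ-zeroˡ e))) (+ᴹ-identityʳ x)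

    shear-lc : ∀ {k} (a : Vector Carrier k) (v : Vector Carrierᴹ k) → shear f e (linearCombination a v) ≈ᴹ linearCombination a (shear f e ∘ v)
    shear-lc {zero}  a v = shear-fixes (at-0 f)
    shear-lc {suc k} a v = ≈ᴹ-trans (shear-+ _ _) (+ᴹ-cong (shear-* (a zero) (v zero)) (shear-lc (a ∘ suc) (v ∘ suc)))

    abstract
      -- The preimage, not the image, under the transvection: membership of x is membership of
      -- `shear f e x`, with no witness to search for.
      move : Subspace → Subspace
      move y = record
        { member? = λ x → Subspace.member? y (shear f e x)
        ; resp = λ x≈x′ → Subspace.resp y (shear-cong x≈x′)
        ; 0-closed = Subspace.resp y (≈ᴹ-sym (shear-fixes (at-0 f))) (Subspace.0-closed y)
        ; +-closed = λ x∈ x′∈ → Subspace.resp y (≈ᴹ-sym (shear-+ _ _)) (Subspace.+-closed y x∈ x′∈)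
        ; *ₗ-closed = λ a x∈ → Subspace.resp y (≈ᴹ-sym (shear-* a _)) (Subspace.*ₗ-closed y a x∈)
        }

      ∈move⁺ : ∀ y {x} → shear f e x ∈ y → x ∈ move y
      ∈move⁺ y x∈ = x∈

      ∈move⁻ : ∀ y {x} → x ∈ move y → shear f e x ∈ y
      ∈move⁻ y x∈ = x∈

    move-mono : ∀ {y z} → y ⊆ z → move y ⊆ move z
    move-mono {y} {z} y⊆z x∈ = ∈move⁺ z (y⊆z (∈move⁻ y x∈))

    move-≐ : ∀ {y z} → y ≐ z → move y ≐ move z
    move-≐ (y⊆z , z⊆y) = move-mono y⊆z , move-mono z⊆y

  -- Because f(e) = 0, the form takes the same value before and after the first transvection, so the
  -- second one takes away exactly what the first has added.
  shear-cancel : ∀ f e e′ → e +ᴹ e′ ≈ᴹ 0ᴹ → at f e ≈ 0# → ∀ x → shear f e′ (shear f e x) ≈ᴹ x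
  shear-cancel f e e′ e+e′≈0 fe≈0 x = begin
    (x +ᴹ at f x *ₗ e) +ᴹ at f (x +ᴹ at f x *ₗ e) *ₗ e′
      ≈⟨ +ᴹ-congˡ (*ₗ-congʳ (𝔽.trans (at-+ f x _) (𝔽.trans (𝔽.+-congˡ (𝔽.trans (at-* f (at f x) e) (𝔽.trans (𝔽.*-congˡ fe≈0) (𝔽.zeroʳ _)))) (𝔽.+-identityʳ _)))) ⟩
    (x +ᴹ at f x *ₗ e) +ᴹ at f x *ₗ e′     ≈⟨ +ᴹ-assoc _ _ _ ⟩
    x +ᴹ (at f x *ₗ e +ᴹ at f x *ₗ e′)     ≈⟨ +ᴹ-congˡ (*ₗ-distribˡ (at f x) e e′) ⟨
    x +ᴹ at f x *ₗ (e +ᴹ e′)               ≈⟨ +ᴹ-congˡ (≈ᴹ-trans (*ₗ-congˡ e+e′≈0) (*ₗ-zeroʳ _)) ⟩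
    x +ᴹ 0ᴹ                                ≈⟨ +ᴹ-identityʳ x ⟩
    x                                      ∎

  module _ (f : Form) (e e′ : Carrierᴹ) (e+e′≈0 : e +ᴹ e′ ≈ᴹ 0ᴹ) (fe≈0 : at f e ≈ 0#) where

    move-cancel : ∀ y → move f e (move f e′ y) ≐ y
    move-cancel y = (λ x∈ → Subspace.resp y (shear-cancel f e e′ e+e′≈0 fe≈0 _) (∈move⁻ f e′ y (∈move⁻ f e (move f e′ y) x∈)))
                  , (λ x∈ → ∈move⁺ f e (move f e′ y) (∈move⁺ f e′ y (Subspace.resp y (≈ᴹ-sym (shear-cancel f e e′ e+e′≈0 fe≈0 _)) x∈)))

    dim-move≤ : ∀ y → dim (move f e y) ≤ dim y
    dim-move≤ y = independent-inside⇒≤dim {v = shear f e ∘ basis (move f e y)} y image-independent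
      (λ i → ∈move⁻ f e y (inside (basis-isBasis (move f e y)) i))
      where
      image-independent : LinearlyIndependent (shear f e ∘ basis (move f e y))
      image-independent a eq = independent (basis-isBasis (move f e y)) a (begin
        linearCombination a (basis (move f e y))                              ≈⟨ shear-cancel f e e′ e+e′≈0 fe≈0 _ ⟨
        shear f e′ (shear f e (linearCombination a (basis (move f e y))))     ≈⟨ shear-cong f e′ (≈ᴹ-trans (shear-lc f e a _) eq) ⟩
        shear f e′ 0ᴹ                                                         ≈⟨ shear-fixes f e′ (at-0 f) ⟩
        0ᴹ                                                                    ∎)

  -- The transvection carries a basis of the moved subspace to independent vectors of y; the reverse
  -- inequality is the same argument for the inverse transvection.
  dim-move : ∀ f e e′ → e +ᴹ e′ ≈ᴹ 0ᴹ → at f e ≈ 0# → at f e′ ≈ 0# → ∀ y → dim (move f e y) ≡ dim y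
  dim-move f e e′ e+e′≈0 fe≈0 fe′≈0 y = ℕ.≤-antisym (dim-move≤ f e e′ e+e′≈0 fe≈0 y)
    (≡.subst (_≤ dim (move f e y)) (dim-resp (move-cancel f e′ e e′+e≈0 fe′≈0 y)) (dim-move≤ f e′ e e′+e≈0 fe′≈0 (move f e y)))
    where
    e′+e≈0 : e′ +ᴹ e ≈ᴹ 0ᴹ
    e′+e≈0 = ≈ᴹ-trans (+ᴹ-comm e′ e) e+e′≈0

  -- Subtracting f(t) / f(x) times x from t leaves a vector of y on which f vanishes.
  ⊆adjoin-kernel : ∀ {y x} f → x ∈ y → ¬ at f x ≈ 0# → y ⊆ adjoin (y ⊓ kernel f) x
  ⊆adjoin-kernel {y} {x} f x∈y fx≉0 {t} t∈y = let b , bfx≈1 = invert fx≉0 ; a = at f t * b in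
    x+y∈z∧y∈z⇒x∈z (adjoin (y ⊓ kernel f) x)
      (⊆adjoin (y ⊓ kernel f) x (∈⊓⁺ {y} {kernel f} (Subspace.+-closed y t∈y (Subspace.*ₗ-closed y (- a) x∈y)) (∈kernel⁺ f
        (𝔽.trans (at-+ f t _) (𝔽.trans (𝔽.+-congˡ (𝔽.trans (at-* f (- a) x) (𝔽.trans (𝔽.sym (-‿distribˡ-* a (at f x)))
          (𝔽.-‿cong (𝔽.trans (𝔽.*-assoc _ _ _) (𝔽.trans (𝔽.*-congˡ bfx≈1) (𝔽.*-identityʳ _))))))) (𝔽.-‿inverseʳ (at f t)))))))
      (Subspace.*ₗ-closed (adjoin (y ⊓ kernel f) x) (- a) (x∈adjoin (y ⊓ kernel f) x))
    where open Algebra.Properties.Ring 𝔽.ring using (-‿distribˡ-*)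

-- The attenuated space poset and its transvections

module AttenuatedPoset {c ℓ₁ ℓ₂ m ℓm : Level}
  (F : HeytingField c ℓ₁ ℓ₂) {p : ℕ} (∣F∣≡q : F HasOrder (suc p)) {N M : ℕ}
  (H : VectorSpace F m ℓm) (dimH : LinearAlgebra.HasDimension F H U (N ℕ.+ M))
  (h : LinearAlgebra.Subspace F H) (dimh : LinearAlgebra.HasDimension F H (λ x → LinearAlgebra._∈_ F H x h) M)
  where

  open import Data.Nat.Base using (_+_; _*_; _^_)
  open HeytingField F using (Carrier; _≈_; -_; 0#; 1#)
  open Module H
  open LinearAlgebra F H
  open FiniteLinearAlgebra F ∣F∣≡q H dimH
  open FiniteSpace F ∣F∣≡q H dimH
  open AttenuatedSpace F ∣F∣≡q {N} {M} H dimH h using (X; ⟦_⟧; ⟦⟧-injective; ⟦⟧-meets-trivially; ⟦⟧-surjective; Covers; covers?)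
  open Counting
  open IsBasisOf
  open Form
  private module 𝔽 = CommutativeRing (scalars F)

  private
    q n : ℕ
    q = suc p
    n = N + M

    η : Vector Carrierᴹ M
    η = proj₁ dimh

    η-isBasis : IsBasisOf (_∈ h) η
    η-isBasis = proj₂ dimh

  abstract
    h-complement : ∃ λ (t : Vector Carrierᴹ N) → IsBasisOf U (t ++ η)
    h-complement with complement η (independent η-isBasis)
    ... | l , t , t-isBasis , l+M≡n with ℕ.+-cancelʳ-≡ M l N l+M≡n
    ... | refl = t , t-isBasis

  private
    t : Vector Carrierᴹ N
    t = proj₁ h-complement

    t-isBasis : IsBasisOf U (t ++ η)
    t-isBasis = proj₂ h-complement

  abstract
    -- This enumerates the forms vanishing on h, the dual of H/h: each is determined by its N values
    -- on the vectors `t` that complete a basis of h to one of H.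
    Φ : Fin (q ^ N) → Form
    Φ φ = formOf t-isBasis (decode {N} φ ++ λ _ → 0#)

    Φ-h : ∀ φ {x} → x ∈ h → at (Φ φ) x ≈ 0#
    Φ-h φ x∈h = at-Span≈0 (Φ φ) η (λ i → 𝔽.trans (at-cong (Φ φ) (≈ᴹ-reflexive (≡.sym (++-right t η i))))
      (𝔽.trans (formOf-basis t-isBasis _ (N ↑ʳ i)) (𝔽.reflexive (++-right (decode {N} φ) (λ _ → 0#) i)))) (spanning η-isBasis x∈h)

    Φ-t : ∀ φ j → at (Φ φ) (t j) ≈ decode {N} φ j
    Φ-t φ j = 𝔽.trans (at-cong (Φ φ) (≈ᴹ-reflexive (≡.sym (++-left t η j))))
      (𝔽.trans (formOf-basis t-isBasis _ (j ↑ˡ M)) (𝔽.reflexive (++-left (decode {N} φ) (λ _ → 0#) j)))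

  Φ-injective : ∀ {φ φ′} → (∀ x → at (Φ φ) x ≈ at (Φ φ′) x) → φ ≡ φ′
  Φ-injective {φ} {φ′} Φ≈ = ≡.trans (≡.sym (encode-decode {N} φ)) (≡.trans
    (encode-cong λ j → 𝔽.trans (𝔽.sym (Φ-t φ j)) (𝔽.trans (Φ≈ (t j)) (Φ-t φ′ j))) (encode-decode {N} φ′))

  Φ-complete : ∀ f → (∀ {x} → x ∈ h → at f x ≈ 0#) → ∀ x → at (Φ (encode (at f ∘ t))) x ≈ at f x
  Φ-complete f f-h = form-ext t-isBasis (Φ (encode (at f ∘ t))) f (++-cases (λ i → at (Φ (encode (at f ∘ t))) ((t ++ η) i) ≈ at f ((t ++ η) i))
    (λ i → 𝔽.trans (at-cong (Φ (encode (at f ∘ t))) (≈ᴹ-reflexive (++-left t η i))) (𝔽.trans (Φ-t _ i)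
      (𝔽.trans (decode-encode (at f ∘ t) i) (at-cong f (≈ᴹ-reflexive (≡.sym (++-left t η i)))))))
    (λ i → 𝔽.trans (at-cong (Φ (encode (at f ∘ t))) (≈ᴹ-reflexive (++-right t η i))) (𝔽.trans (Φ-h _ (inside η-isBasis i))
      (𝔽.sym (𝔽.trans (at-cong f (≈ᴹ-reflexive (++-right t η i))) (f-h (inside η-isBasis i)))))))

  Kills : Fin (q ^ N) → Subspace → Set ℓ₁
  Kills φ y = ∀ k → at (Φ φ) (basis y k) ≈ 0#

  kills? : ∀ φ y → Dec (Kills φ y)
  kills? φ y = Fin.all? λ k → at (Φ φ) (basis y k) ≟ 0#

  kills⇒ : ∀ {φ} y → Kills φ y → ∀ {x} → x ∈ y → at (Φ φ) x ≈ 0#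
  kills⇒ {φ} y kills x∈y = at-Span≈0 (Φ φ) (basis y) kills (spanning (basis-isBasis y) x∈y)

  ⇒kills : ∀ {φ} y → (∀ {x} → x ∈ y → at (Φ φ) x ≈ 0#) → Kills φ y
  ⇒kills y vanishes k = vanishes (inside (basis-isBasis y) k)

  ¬kills⇒∃ : ∀ {φ} y → ¬ Kills φ y → ∃ λ x → x ∈ y × ¬ at (Φ φ) x ≈ 0#
  ¬kills⇒∃ {φ} y ¬kills = let k , ≉0 = Fin.¬∀⟶∃¬ _ _ (λ k → at (Φ φ) (basis y k) ≟ 0#) ¬kills in
    basis y k , inside (basis-isBasis y) k , ≉0

  annihilators : Subspace → ℕ
  annihilators y = ∑ λ φ → ⟨ kills? φ y ⟩

  -- A basis of y followed by one of h is independent. If l further vectors complete it to a basis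
  -- of H, the forms vanishing on y and h correspond to arbitrary values on these, and l + dim y =
  -- N. The product form avoids a subtraction in the exponent.
  annihilators-count : ∀ y → MeetTrivially y h → annihilators y * q ^ dim y ≡ q ^ N
  annihilators-count y y∩h≡0 with complement (basis y ++ η) (++-independent y h y∩h≡0
    (independent (basis-isBasis y)) (inside (basis-isBasis y)) (independent η-isBasis) (inside η-isBasis))
  ... | l , s , s-isBasis , l+dim+M≡n = ≡.trans (≡.cong (_* q ^ dim y) (∑-image (λ φ → kills? φ y) f f-injective f-kills f-surjective))
    (≡.trans (≡.sym (ℕ.^-distribˡ-+-* q l (dim y)))
      (≡.cong (q ^_) (ℕ.+-cancelʳ-≡ M (l + dim y) N (≡.trans (ℕ.+-assoc l (dim y) M) l+dim+M≡n))))
    where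
    w : Vector Carrierᴹ (dim y + M)
    w = basis y ++ η
    g : Fin (q ^ l) → Form
    g α = formOf s-isBasis (decode {l} α ++ λ _ → 0#)
    g-s : ∀ α j → at (g α) (s j) ≈ decode {l} α j
    g-s α j = 𝔽.trans (at-cong (g α) (≈ᴹ-reflexive (≡.sym (++-left s w j))))
      (𝔽.trans (formOf-basis s-isBasis _ (j ↑ˡ (dim y + M))) (𝔽.reflexive (++-left (decode {l} α) (λ _ → 0#) j)))
    g-w : ∀ α j → at (g α) (w j) ≈ 0#
    g-w α j = 𝔽.trans (at-cong (g α) (≈ᴹ-reflexive (≡.sym (++-right s w j))))
      (𝔽.trans (formOf-basis s-isBasis _ (l ↑ʳ j)) (𝔽.reflexive (++-right (decode {l} α) (λ _ → 0#) j)))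
    g-y : ∀ α j → at (g α) (basis y j) ≈ 0#
    g-y α j = 𝔽.trans (at-cong (g α) (≈ᴹ-reflexive (≡.sym (++-left (basis y) η j)))) (g-w α (j ↑ˡ M))
    g-h : ∀ α {x} → x ∈ h → at (g α) x ≈ 0#
    g-h α x∈h = at-Span≈0 (g α) η (λ j → 𝔽.trans (at-cong (g α) (≈ᴹ-reflexive (≡.sym (++-right (basis y) η j)))) (g-w α (dim y ↑ʳ j)))
      (spanning η-isBasis x∈h)
    f : Fin (q ^ l) → Fin (q ^ N)
    f α = encode (at (g α) ∘ t)
    f-spec : ∀ α x → at (Φ (f α)) x ≈ at (g α) x
    f-spec α = Φ-complete (g α) (g-h α)
    f-injective : ∀ {α β} → f α ≡ f β → α ≡ β
    f-injective {α} {β} eq = ≡.trans (≡.sym (encode-decode {l} α)) (≡.trans (encode-cong λ j →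
      𝔽.trans (𝔽.sym (𝔽.trans (f-spec α (s j)) (g-s α j))) (𝔽.trans (𝔽.reflexive (≡.cong (λ φ → at (Φ φ) (s j)) eq))
        (𝔽.trans (f-spec β (s j)) (g-s β j)))) (encode-decode {l} β))
    f-kills : ∀ α → Kills (f α) y
    f-kills α k = 𝔽.trans (f-spec α _) (g-y α k)
    f-surjective : ∀ φ → Kills φ y → ∃ λ α → f α ≡ φ
    f-surjective φ kills = α , Φ-injective (form-ext s-isBasis (Φ (f α)) (Φ φ)
      (++-cases (λ i → at (Φ (f α)) ((s ++ w) i) ≈ at (Φ φ) ((s ++ w) i))
        (λ i → transport (++-left s w i) (𝔽.trans (f-spec α (s i)) (𝔽.trans (g-s α i) (decode-encode {l} _ i))))
        (λ i → transport (++-right s w i) (𝔽.trans (f-spec α (w i)) (𝔽.trans (g-w α i) (𝔽.sym (φ-w i)))))))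
      where
      α : Fin (q ^ l)
      α = encode (at (Φ φ) ∘ s)
      transport : ∀ {x x′} → x ≡ x′ → at (Φ (f α)) x′ ≈ at (Φ φ) x′ → at (Φ (f α)) x ≈ at (Φ φ) x
      transport refl eq = eq
      φ-w : ∀ i → at (Φ φ) (w i) ≈ 0#
      φ-w = ++-cases (λ i → at (Φ φ) (w i) ≈ 0#)
        (λ i → 𝔽.trans (at-cong (Φ φ) (≈ᴹ-reflexive (++-left (basis y) η i))) (kills i))
        (λ i → 𝔽.trans (at-cong (Φ φ) (≈ᴹ-reflexive (++-right (basis y) η i))) (Φ-h φ (inside η-isBasis i)))

  d : X → ℕ
  d y = dim ⟦ y ⟧

  ⊆∧d≡⇒≡ : ∀ {y w} → ⟦ y ⟧ ⊆ ⟦ w ⟧ → d y ≡ d w → y ≡ w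
  ⊆∧d≡⇒≡ {y} {w} y⊆w dy≡dw = ⟦⟧-injective y w ((λ {x} → y⊆w {x}) , ⊆∧dim≥⇒⊇ {⟦ y ⟧} {⟦ w ⟧} y⊆w (ℕ.≤-reflexive (≡.sym dy≡dw)))

  ≢⇒∃ : ∀ {y w} → ¬ y ≡ w → d y ≡ d w → ∃ λ x → x ∈ ⟦ y ⟧ × ¬ x ∈ ⟦ w ⟧
  ≢⇒∃ {y} {w} y≢w dy≡dw = ⊈⇒∃ {⟦ w ⟧} {⟦ y ⟧} λ y⊆w → y≢w (⊆∧d≡⇒≡ y⊆w dy≡dw)

  covers⇒∃ : ∀ {z y} → Covers z y → ∃ λ x → x ∈ ⟦ z ⟧ × ¬ x ∈ ⟦ y ⟧
  covers⇒∃ {z} {y} (y⊆z , dz) = ⊈⇒∃ {⟦ y ⟧} {⟦ z ⟧} λ z⊆y → ℕ.<⇒≱ (ℕ.≤-reflexive (≡.sym dz)) (dim-mono {⟦ z ⟧} {⟦ y ⟧} z⊆y)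

  d+M≤n : ∀ y → d y + M ≤ n
  d+M≤n y = independent⇒≤ (++-independent ⟦ y ⟧ h (⟦⟧-meets-trivially y)
    (independent (basis-isBasis ⟦ y ⟧)) (inside (basis-isBasis ⟦ y ⟧)) (independent η-isBasis) (inside η-isBasis))

  d≤N : ∀ y → d y ≤ N
  d≤N y = ℕ.+-cancelʳ-≤ M (d y) N (d+M≤n y)

  vec : Fin (q ^ M) → Carrierᴹ
  vec e = linearCombination (decode {M} e) η

  vec∈h : ∀ e → vec e ∈ h
  vec∈h e = lc-closed h (decode {M} e) η (inside η-isBasis)

  vec-injective : ∀ {e e′} → vec e ≈ᴹ vec e′ → e ≡ e′
  vec-injective {e} {e′} eq = ≡.trans (≡.sym (encode-decode {M} e))
    (≡.trans (encode-cong (lc-injective (independent η-isBasis) eq)) (encode-decode {M} e′))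

  vec-surjective : ∀ {x} → x ∈ h → ∃ λ e → vec e ≈ᴹ x
  vec-surjective x∈h = let a , x≈ = spanning η-isBasis x∈h in
    encode a , ≈ᴹ-trans (lc-cong η (decode-encode {M} a)) (≈ᴹ-sym x≈)

  module _ (φ : Fin (q ^ N)) {e : Carrierᴹ} (e∈h : e ∈ h) where

    -- The form vanishes on h, so the transvection fixes h pointwise.
    move-meets-trivially : ∀ y → MeetTrivially ⟦ y ⟧ h → MeetTrivially (move (Φ φ) e ⟦ y ⟧) h
    move-meets-trivially y y∩h≡0 x x∈ x∈h =
      y∩h≡0 x (Subspace.resp ⟦ y ⟧ (shear-fixes (Φ φ) e (Φ-h φ x∈h)) (∈move⁻ (Φ φ) e ⟦ y ⟧ x∈)) x∈h

    abstract
      act : X → X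
      act y = proj₁ (⟦⟧-surjective (move (Φ φ) e ⟦ y ⟧) (move-meets-trivially y (⟦⟧-meets-trivially y)))

      act-≐ : ∀ y → ⟦ act y ⟧ ≐ move (Φ φ) e ⟦ y ⟧
      act-≐ y = proj₂ (⟦⟧-surjective (move (Φ φ) e ⟦ y ⟧) (move-meets-trivially y (⟦⟧-meets-trivially y)))

    ∈act⁻ : ∀ {y w x} → act y ≡ w → x ∈ ⟦ w ⟧ → shear (Φ φ) e x ∈ ⟦ y ⟧
    ∈act⁻ {y} refl x∈w = ∈move⁻ (Φ φ) e ⟦ y ⟧ (_≐_.⊆-to (act-≐ y) x∈w)

  module _ (φ : Fin (q ^ N)) {e e′ : Carrierᴹ} (e∈h : e ∈ h) (e′∈h : e′ ∈ h) (e+e′≈0 : e +ᴹ e′ ≈ᴹ 0ᴹ) where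

    act-cancel : ∀ y → act φ e∈h (act φ e′∈h y) ≡ y
    act-cancel y = ⟦⟧-injective _ y (trans (act-≐ φ e∈h (act φ e′∈h y))
      (trans (move-≐ (Φ φ) e (act-≐ φ e′∈h y)) (move-cancel (Φ φ) e e′ e+e′≈0 (Φ-h φ e∈h) ⟦ y ⟧)))
      where open Setoid ≐-setoid using (trans)

    d-act : ∀ y → d (act φ e∈h y) ≡ d y
    d-act y = ≡.trans (dim-resp (act-≐ φ e∈h y)) (dim-move (Φ φ) e e′ e+e′≈0 (Φ-h φ e∈h) (Φ-h φ e′∈h) ⟦ y ⟧)

    act-covers : ∀ {z y} → Covers z y → Covers (act φ e∈h z) (act φ e∈h y)
    act-covers {z} {y} (y⊆z , dz) =
        (λ x∈ → _≐_.⊆-from (act-≐ φ e∈h z) (move-mono (Φ φ) e {⟦ y ⟧} {⟦ z ⟧} y⊆z (_≐_.⊆-to (act-≐ φ e∈h y) x∈)))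
      , ≡.trans (d-act z) (≡.trans dz (≡.cong suc (≡.sym (d-act y))))

    act⁺ : ∀ {y w} → d y ≡ d w → (∀ {x} → x ∈ ⟦ w ⟧ → shear (Φ φ) e x ∈ ⟦ y ⟧) → act φ e∈h y ≡ w
    act⁺ {y} {w} dy≡dw shears = ≡.sym (⊆∧d≡⇒≡
      (λ x∈w → _≐_.⊆-from (act-≐ φ e∈h y) (∈move⁺ (Φ φ) e ⟦ y ⟧ (shears x∈w))) (≡.trans (≡.sym dy≡dw) (≡.sym (d-act y))))

  neg : Carrierᴹ → Carrierᴹ
  neg e = (- 1#) *ₗ e

  neg∈h : ∀ {e} → e ∈ h → neg e ∈ h
  neg∈h e∈h = Subspace.*ₗ-closed h (- 1#) e∈h

  e+neg≈0 : ∀ e → e +ᴹ neg e ≈ᴹ 0ᴹ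
  e+neg≈0 = x+-1x≈0

  neg+e≈0 : ∀ e → neg e +ᴹ e ≈ᴹ 0ᴹ
  neg+e≈0 e = ≈ᴹ-trans (+ᴹ-comm _ e) (x+-1x≈0 e)

  C : X → X → ℕ
  C y z = ⟨ covers? y z ⟩

  C-graded : ∀ y z → C y z ≡ 0 ⊎ d y ≡ suc (d z)
  C-graded y z = Sum.map₂ proj₂ (⟨⟩≡0⊎ (covers? y z))

  acts acts⁻¹ : Fin (q ^ N) → Fin (q ^ M) → X → X
  acts φ e = act φ (vec∈h e)
  acts⁻¹ φ e = act φ (neg∈h (vec∈h e))

  -- Transvections are automorphisms of the poset, so one can be moved to the other side of the
  -- covering relation as its inverse.
  C-acts : ∀ φ e y w → C (acts φ e y) w ≡ C y (acts⁻¹ φ e w)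
  C-acts φ e y w = ⟨⟩-cong (covers? _ _) (covers? _ _)
    (λ cov → ≡.subst (λ s → Covers s (acts⁻¹ φ e w)) (act-cancel φ e⁻∈h e∈h (neg+e≈0 _) y) (act-covers φ e⁻∈h e∈h (neg+e≈0 _) cov))
    (λ cov → ≡.subst (Covers (acts φ e y)) (act-cancel φ e∈h e⁻∈h (e+neg≈0 _) w) (act-covers φ e∈h e⁻∈h (e+neg≈0 _) cov))
    where
    e∈h = vec∈h e
    e⁻∈h = neg∈h e∈h

  C-acts′ : ∀ φ e y w → C w (acts φ e y) ≡ C (acts⁻¹ φ e w) y
  C-acts′ φ e y w = ⟨⟩-cong (covers? _ _) (covers? _ _)
    (λ cov → ≡.subst (Covers (acts⁻¹ φ e w)) (act-cancel φ e⁻∈h e∈h (neg+e≈0 _) y) (act-covers φ e⁻∈h e∈h (neg+e≈0 _) cov))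
    (λ cov → ≡.subst (λ s → Covers s (acts φ e y)) (act-cancel φ e∈h e⁻∈h (e+neg≈0 _) w) (act-covers φ e∈h e⁻∈h (e+neg≈0 _) cov))
    where
    e∈h = vec∈h e
    e⁻∈h = neg∈h e∈h

  -- All q^N q^M pairs are counted, with repetition: the identity occurs whenever the form or the
  -- vector is zero. This is visible in `ω-diagonal`.
  ω : X → X → ℕ
  ω y w = ∑ λ φ → ∑ λ e → ⟨ acts φ e y Fin.≟ w ⟩

  ∑-orbit : ∀ (f : Fin (q ^ N) → Fin (q ^ M) → X) (g : X → ℕ) →
            ∑ (λ z → ∑ (λ φ → ∑ λ e → ⟨ f φ e Fin.≟ z ⟩) * g z) ≡ ∑ λ φ → ∑ λ e → g (f φ e)
  ∑-orbit f g = begin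
    ∑ (λ z → ∑ (λ φ → ∑ λ e → ⟨ f φ e Fin.≟ z ⟩) * g z)
      ≡⟨ ∑-cong (λ z → ≡.trans (*-distribʳ-sum (g z) (λ φ → ∑ λ e → ⟨ f φ e Fin.≟ z ⟩))
           (∑-cong λ φ → *-distribʳ-sum (g z) (λ e → ⟨ f φ e Fin.≟ z ⟩))) ⟩
    ∑ (λ z → ∑ λ φ → ∑ λ e → ⟨ f φ e Fin.≟ z ⟩ * g z)
      ≡⟨ ∑-comm (λ z φ → ∑ λ e → ⟨ f φ e Fin.≟ z ⟩ * g z) ⟩
    ∑ (λ φ → ∑ λ z → ∑ λ e → ⟨ f φ e Fin.≟ z ⟩ * g z)
      ≡⟨ ∑-cong (λ φ → ∑-comm (λ z e → ⟨ f φ e Fin.≟ z ⟩ * g z)) ⟩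
    ∑ (λ φ → ∑ λ e → ∑ λ z → ⟨ f φ e Fin.≟ z ⟩ * g z)
      ≡⟨ ∑-cong (λ φ → ∑-cong λ e → ∑-pick (λ z → f φ e Fin.≟ z) g (f φ e) refl (λ _ → ≡.sym)) ⟩
    ∑ (λ φ → ∑ λ e → g (f φ e)) ∎
    where open ≡.≡-Reasoning

  ω-left : ∀ (g : X → ℕ) y → ∑ (λ z → ω y z * g z) ≡ ∑ λ φ → ∑ λ e → g (acts φ e y)
  ω-left g y = ∑-orbit (λ φ e → acts φ e y) g

  ω-right : ∀ (g : X → ℕ) w → ∑ (λ z → g z * ω z w) ≡ ∑ λ φ → ∑ λ e → g (acts⁻¹ φ e w)
  ω-right g w = ≡.trans
    (∑-cong λ z → ≡.trans (ℕ.*-comm (g z) _) (≡.cong (_* g z) (∑-cong λ φ → ∑-cong λ e → swap φ e z)))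
    (∑-orbit (λ φ e → acts⁻¹ φ e w) g)
    where
    swap : ∀ φ e z → ⟨ acts φ e z Fin.≟ w ⟩ ≡ ⟨ acts⁻¹ φ e w Fin.≟ z ⟩
    swap φ e z = ⟨⟩-cong (acts φ e z Fin.≟ w) (acts⁻¹ φ e w Fin.≟ z)
      (λ { refl → act-cancel φ (neg∈h (vec∈h e)) (vec∈h e) (neg+e≈0 _) z })
      (λ { refl → act-cancel φ (vec∈h e) (neg∈h (vec∈h e)) (e+neg≈0 _) w })

  C-ω : ∀ y w → ∑ (λ z → C y z * ω z w) ≡ ∑ (λ z → ω y z * C z w)
  C-ω y w = ≡.trans (ω-right (C y) w) (≡.trans (∑-cong λ φ → ∑-cong λ e → ≡.sym (C-acts φ e y w)) (≡.sym (ω-left (λ z → C z w) y)))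

  Cᵀ-ω : ∀ y w → ∑ (λ z → C z y * ω z w) ≡ ∑ (λ z → ω y z * C w z)
  Cᵀ-ω y w = ≡.trans (ω-right (λ z → C z y) w) (≡.trans (∑-cong λ φ → ∑-cong λ e → ≡.sym (C-acts′ φ e y w)) (≡.sym (ω-left (C w) y)))

  -- Numbers of lower and upper covers

  cover-below : ∀ {y m x} → m ⊆ ⟦ y ⟧ → x ∈ ⟦ y ⟧ → ¬ x ∈ m → ⟦ y ⟧ ⊆ adjoin m x → ∃ λ b → ⟦ b ⟧ ≐ m × Covers y b
  cover-below {y} {m} {x} m⊆y x∈y x∉m y⊆m+x =
    let b , b≐m = ⟦⟧-surjective m (λ x x∈m x∈h → ⟦⟧-meets-trivially y x (m⊆y x∈m) x∈h) in
    b , b≐m , (λ x∈b → m⊆y (_≐_.⊆-to b≐m x∈b)) ,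
    ≡.trans (dim-resp ((λ {x} → y⊆m+x {x}) , adjoin-least {m} {x} ⟦ y ⟧ m⊆y x∈y)) (≡.trans (dim-adjoin {m} {x} x∉m) (≡.cong suc (≡.sym (dim-resp b≐m))))

  hyperplane : ∀ φ y → ¬ Kills φ ⟦ y ⟧ → ∃ λ b → ⟦ b ⟧ ≐ (⟦ y ⟧ ⊓ kernel (Φ φ)) × Covers y b
  hyperplane φ y ¬kills = let x , x∈y , φx≉0 = ¬kills⇒∃ ⟦ y ⟧ ¬kills in
    cover-below (λ x∈ → proj₁ (∈⊓⁻ {⟦ y ⟧} {kernel (Φ φ)} x∈)) x∈y
      (λ x∈ → φx≉0 (∈kernel⁻ (Φ φ) (proj₂ (∈⊓⁻ {⟦ y ⟧} {kernel (Φ φ)} x∈)))) (⊆adjoin-kernel {⟦ y ⟧} (Φ φ) x∈y φx≉0)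

  ann : X → ℕ
  ann y = annihilators ⟦ y ⟧

  ann-count : ∀ y → ann y * q ^ d y ≡ q ^ N
  ann-count y = annihilators-count ⟦ y ⟧ (⟦⟧-meets-trivially y)

  qᵏ≢0 : ∀ k → ℕ.NonZero (q ^ k)
  qᵏ≢0 k = ℕ.m^n≢0 q k

  ann≢0 : ∀ y → ℕ.NonZero (ann y)
  ann≢0 y = ℕ.m*n≢0⇒m≢0 (ann y) {{≡.subst ℕ.NonZero (≡.sym (ann-count y)) (qᵏ≢0 N)}}

  ann-cover : ∀ {y b} → Covers y b → ann b ≡ q * ann y
  ann-cover {y} {b} (_ , dy) = ℕ.*-cancelʳ-≡ (ann b) (q * ann y) (q ^ d b) {{qᵏ≢0 (d b)}} (begin
    ann b * q ^ d b             ≡⟨ ann-count b ⟩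
    q ^ N                         ≡⟨ ann-count y ⟨
    ann y * q ^ d y             ≡⟨ ≡.cong (λ k → ann y * q ^ k) dy ⟩
    ann y * (q * q ^ d b)     ≡⟨ rearrange (ann y) q (q ^ d b) ⟩
    q * ann y * q ^ d b       ∎)
    where
    open ≡.≡-Reasoning
    rearrange : ∀ a b c → a * (b * c) ≡ b * a * c
    rearrange = solve-∀

  kills-mono : ∀ {φ y b} → Covers y b → Kills φ ⟦ y ⟧ → Kills φ ⟦ b ⟧
  kills-mono {φ} {y} {b} (b⊆y , _) kills = ⇒kills ⟦ b ⟧ λ x∈b → kills⇒ ⟦ y ⟧ kills (b⊆y x∈b)

  -- Pairs (φ, b) are counted in which y covers b and φ vanishes on b but not on y. Such a φ
  -- determines b as the intersection of y with its kernel, and each b admits `ann b` minus `ann y`,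
  -- that is `p * ann y`, forms. The equation says that y has (q^dim y - 1)/(q - 1) hyperplanes.
  lower-count : ∀ y → ∑ (C y) * p + 1 ≡ q ^ d y
  lower-count y = ℕ.*-cancelˡ-≡ (∑ (C y) * p + 1) (q ^ d y) (ann y) {{ann≢0 y}} (begin
    ann y * (∑ (C y) * p + 1)                        ≡⟨ rearrange (ann y) (∑ (C y)) p ⟩
    ∑ (C y) * (p * ann y) + ann y                    ≡⟨ ≡.cong (_+ ann y) (*-distribʳ-sum (p * ann y) (C y)) ⟩
    ∑ (λ b → C y b * (p * ann y)) + ann y            ≡⟨ double-count P? (λ φ → kills? φ ⟦ y ⟧) _ (λ φ → row φ (kills? φ ⟦ y ⟧)) (λ b → column b (covers? y b)) ⟩
    q ^ N                                                ≡⟨ ann-count y ⟨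
    ann y * q ^ d y                                    ∎)
    where
    open ≡.≡-Reasoning
    rearrange : ∀ a b c → a * (b * c + 1) ≡ b * (c * a) + a
    rearrange = solve-∀
    P : Fin (q ^ N) → X → Set _
    P φ b = Covers y b × Kills φ ⟦ b ⟧ × ¬ Kills φ ⟦ y ⟧
    P? : ∀ φ b → Dec (P φ b)
    P? φ b = covers? y b ×-dec (kills? φ ⟦ b ⟧ ×-dec ¬? (kills? φ ⟦ y ⟧))
    row : ∀ φ → Dec (Kills φ ⟦ y ⟧) → ∑ (λ b → ⟨ P? φ b ⟩) + ⟨ kills? φ ⟦ y ⟧ ⟩ ≡ 1
    row φ (yes kills) = ≡.cong₂ _+_ (∑-none (P? φ) (λ b (_ , _ , ¬kills) → ¬kills kills)) (⟨⟩-yes (kills? φ ⟦ y ⟧) kills)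
    row φ (no ¬kills) = let b , b≐ , y⋗b@(_ , dy) = hyperplane φ y ¬kills in ≡.cong₂ _+_
      (∑-unique (P? φ) b
        (y⋗b , ⇒kills ⟦ b ⟧ (λ x∈b → ∈kernel⁻ (Φ φ) (proj₂ (∈⊓⁻ {⟦ y ⟧} {kernel (Φ φ)} (_≐_.⊆-to b≐ x∈b)))) , ¬kills)
        (λ { b′ ((b′⊆y , dy′) , kills , _) → ⊆∧d≡⇒≡
          (λ x∈b′ → _≐_.⊆-from b≐ (∈⊓⁺ {⟦ y ⟧} {kernel (Φ φ)} (b′⊆y x∈b′) (∈kernel⁺ (Φ φ) (kills⇒ ⟦ b′ ⟧ kills x∈b′))))
          (ℕ.suc-injective (≡.trans (≡.sym dy′) dy)) }))
      (⟨⟩-no (kills? φ ⟦ y ⟧) ¬kills)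
    column : ∀ b → Dec (Covers y b) → ∑ (λ φ → ⟨ P? φ b ⟩) ≡ C y b * (p * ann y)
    column b (no ¬y⋗b) = ≡.trans (∑-none (λ φ → P? φ b) (λ φ (y⋗b , _) → ¬y⋗b y⋗b)) (≡.sym (≡.cong (_* (p * ann y)) (⟨⟩-no (covers? y b) ¬y⋗b)))
    column b (yes y⋗b) = ≡.trans (ℕ.+-cancelʳ-≡ (ann y) (∑ (λ φ → ⟨ P? φ b ⟩)) (p * ann y) (begin
      ∑ (λ φ → ⟨ P? φ b ⟩) + ann y                             ≡⟨ ∑-distrib-+ (λ φ → ⟨ P? φ b ⟩) (λ φ → ⟨ kills? φ ⟦ y ⟧ ⟩) ⟨
      ∑ (λ φ → ⟨ P? φ b ⟩ + ⟨ kills? φ ⟦ y ⟧ ⟩)                ≡⟨ ∑-cong (λ φ → ≡.trans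
        (≡.cong (_+ ⟨ kills? φ ⟦ y ⟧ ⟩) (⟨⟩-cong (P? φ b) (kills? φ ⟦ b ⟧ ×-dec ¬? (kills? φ ⟦ y ⟧)) proj₂ (y⋗b ,_)))
        (⟨⟩-∖ (kills? φ ⟦ b ⟧) (kills? φ ⟦ y ⟧) (kills-mono {φ} y⋗b))) ⟩
      ann b                                                      ≡⟨ ann-cover y⋗b ⟩
      ann y + p * ann y                                      ≡⟨ ℕ.+-comm (ann y) _ ⟩
      p * ann y + ann y                                      ∎))
      (≡.sym (≡.trans (≡.cong (_* (p * ann y)) (⟨⟩-yes (covers? y b) y⋗b)) (ℕ.*-identityˡ _)))

  infix 6 _⊞h
  _⊞h : X → Subspace
  y ⊞h = span (basis ⟦ y ⟧ ++ η)

  ∈⊞h⁻ : ∀ y {x} → x ∈ (y ⊞h) → ∃₂ λ s e → s ∈ ⟦ y ⟧ × e ∈ h × x ≈ᴹ s +ᴹ e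
  ∈⊞h⁻ y x∈ = let a , x≈ = ∈span⁻ (basis ⟦ y ⟧ ++ η) x∈ in
    linearCombination (λ i → a (i ↑ˡ M)) (basis ⟦ y ⟧) , linearCombination (λ i → a (d y ↑ʳ i)) η ,
    lc-closed ⟦ y ⟧ _ (basis ⟦ y ⟧) (inside (basis-isBasis ⟦ y ⟧)) , lc-closed h _ η (inside η-isBasis) ,
    ≈ᴹ-trans x≈ (lc-++ a (basis ⟦ y ⟧) η)

  y⊆⊞h : ∀ y → ⟦ y ⟧ ⊆ (y ⊞h)
  y⊆⊞h y x∈y = let a , x≈ = spanning (basis-isBasis ⟦ y ⟧) x∈y in Subspace.resp (y ⊞h) (≈ᴹ-sym x≈)
    (lc-closed (y ⊞h) a (basis ⟦ y ⟧) λ i → ≡.subst (_∈ (y ⊞h)) (++-left (basis ⟦ y ⟧) η i) (span-inside (basis ⟦ y ⟧ ++ η) (i ↑ˡ M)))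

  h⊆⊞h : ∀ y → h ⊆ (y ⊞h)
  h⊆⊞h y x∈h = let a , x≈ = spanning η-isBasis x∈h in Subspace.resp (y ⊞h) (≈ᴹ-sym x≈)
    (lc-closed (y ⊞h) a η λ i → ≡.subst (_∈ (y ⊞h)) (++-right (basis ⟦ y ⟧) η i) (span-inside (basis ⟦ y ⟧ ++ η) (d y ↑ʳ i)))

  card-⊞h : ∀ y → card (y ⊞h) ≡ q ^ (d y + M)
  card-⊞h y = card≡ (y ⊞h) (span-isBasis (++-independent ⟦ y ⟧ h (⟦⟧-meets-trivially y)
    (independent (basis-isBasis ⟦ y ⟧)) (inside (basis-isBasis ⟦ y ⟧)) (independent η-isBasis) (inside η-isBasis)))

  -- The h-component of x is the difference of two vectors of z, hence lies in z and h and is 0.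
  modular : ∀ {y z x} → ⟦ y ⟧ ⊆ ⟦ z ⟧ → x ∈ ⟦ z ⟧ → x ∈ (y ⊞h) → x ∈ ⟦ y ⟧
  modular {y} {z} y⊆z x∈z x∈y+h = let s , e , s∈y , e∈h , x≈ = ∈⊞h⁻ y x∈y+h in
    Subspace.resp ⟦ y ⟧ (≈ᴹ-sym (≈ᴹ-trans x≈ (≈ᴹ-trans (+ᴹ-congˡ
      (⟦⟧-meets-trivially z e (x+y∈z∧x∈z⇒y∈z ⟦ z ⟧ (Subspace.resp ⟦ z ⟧ x≈ x∈z) (y⊆z s∈y)) e∈h)) (+ᴹ-identityʳ s)))) s∈y

  -- A vector a x + u of h with u in y and a nonzero would put x into y + h.
  cover-above : ∀ {y x} → ¬ x ∈ (y ⊞h) → ∃ λ z → ⟦ z ⟧ ≐ adjoin ⟦ y ⟧ x × Covers z y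
  cover-above {y} {x} x∉ = let z , z≐ = ⟦⟧-surjective (adjoin ⟦ y ⟧ x) meets in
    z , z≐ , (λ s∈y → _≐_.⊆-from z≐ (⊆adjoin ⟦ y ⟧ x s∈y)) , ≡.trans (dim-resp z≐) (dim-adjoin {⟦ y ⟧} λ x∈y → x∉ (y⊆⊞h y x∈y))
    where
    meets : MeetTrivially (adjoin ⟦ y ⟧ x) h
    meets s s∈ s∈h with ∈adjoin⁻ {⟦ y ⟧} s∈
    ... | a , u , u∈y , s≈ with a ≟ 0#
    ... | yes a≈0 = ⟦⟧-meets-trivially y s (Subspace.resp ⟦ y ⟧ (≈ᴹ-sym (≈ᴹ-trans s≈ (≈ᴹ-trans (+ᴹ-congʳ (≈ᴹ-trans (*ₗ-congʳ a≈0) (*ₗ-zeroˡ x))) (+ᴹ-identityˡ u)))) u∈y) s∈h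
    ... | no a≉0  = contradiction (*ₗ∈⇒∈ (y ⊞h) a≉0 (x+y∈z∧y∈z⇒x∈z (y ⊞h) (Subspace.resp (y ⊞h) s≈ (h⊆⊞h y s∈h)) (y⊆⊞h y u∈y))) x∉

  -- A vector outside y + h generates together with y exactly one cover. Conversely a cover z
  -- contains q^(dim y + 1) - q^dim y vectors outside y, and by `modular` none of these lies in y +
  -- h.
  upper-count : ∀ y → ∑ (λ z → C z y) * (p * q ^ d y) + q ^ (d y + M) ≡ q ^ (N + M)
  upper-count y = begin
    ∑ (λ z → C z y) * (p * q ^ d y) + q ^ (d y + M)
      ≡⟨ ≡.cong₂ _+_ (*-distribʳ-sum (p * q ^ d y) (λ z → C z y)) (≡.sym (card-⊞h y)) ⟩
    ∑ (λ z → C z y * (p * q ^ d y)) + card (y ⊞h)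
      ≡⟨ double-count P? (λ i → ∈? (vector i) (y ⊞h)) _ (λ i → row i (∈? (vector i) (y ⊞h))) (λ z → column z (covers? z y)) ⟩
    q ^ (N + M) ∎
    where
    open ≡.≡-Reasoning
    P : Fin (q ^ n) → X → Set _
    P i z = Covers z y × vector i ∈ ⟦ z ⟧ × ¬ vector i ∈ ⟦ y ⟧
    P? : ∀ i z → Dec (P i z)
    P? i z = covers? z y ×-dec (∈? (vector i) ⟦ z ⟧ ×-dec ¬? (∈? (vector i) ⟦ y ⟧))
    row : ∀ i → Dec (vector i ∈ (y ⊞h)) → ∑ (λ z → ⟨ P? i z ⟩) + ⟨ ∈? (vector i) (y ⊞h) ⟩ ≡ 1
    row i (yes i∈) = ≡.cong₂ _+_ (∑-none (P? i) (λ { z ((y⊆z , _) , i∈z , i∉y) → i∉y (modular {y} {z} y⊆z i∈z i∈) })) (⟨⟩-yes (∈? (vector i) (y ⊞h)) i∈)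
    row i (no i∉) = let z , z≐ , z⋗y@(_ , dz) = cover-above {y} i∉ in ≡.cong₂ _+_
      (∑-unique (P? i) z (z⋗y , _≐_.⊆-from z≐ (x∈adjoin ⟦ y ⟧ (vector i)) , (λ i∈y → i∉ (y⊆⊞h y i∈y)))
        (λ { z′ ((y⊆z′ , dz′) , i∈z′ , i∉y) → ⊆∧d≡⇒≡
          (λ x∈z′ → _≐_.⊆-from z≐ (cover⊆adjoin {⟦ y ⟧} {⟦ z′ ⟧} y⊆z′ dz′ i∈z′ i∉y x∈z′)) (≡.trans dz′ (≡.sym dz)) }))
      (⟨⟩-no (∈? (vector i) (y ⊞h)) i∉)
    column : ∀ z → Dec (Covers z y) → ∑ (λ i → ⟨ P? i z ⟩) ≡ C z y * (p * q ^ d y)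
    column z (no ¬z⋗y) = ≡.trans (∑-none (λ i → P? i z) (λ i (z⋗y , _) → ¬z⋗y z⋗y)) (≡.sym (≡.cong (_* (p * q ^ d y)) (⟨⟩-no (covers? z y) ¬z⋗y)))
    column z (yes z⋗y@(y⊆z , dz)) = ≡.trans (ℕ.+-cancelʳ-≡ (card ⟦ y ⟧) (∑ (λ i → ⟨ P? i z ⟩)) (p * q ^ d y) (begin
      ∑ (λ i → ⟨ P? i z ⟩) + card ⟦ y ⟧                          ≡⟨ ∑-distrib-+ (λ i → ⟨ P? i z ⟩) (λ i → ⟨ ∈? (vector i) ⟦ y ⟧ ⟩) ⟨
      ∑ (λ i → ⟨ P? i z ⟩ + ⟨ ∈? (vector i) ⟦ y ⟧ ⟩)             ≡⟨ ∑-cong (λ i → ≡.trans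
        (≡.cong (_+ ⟨ ∈? (vector i) ⟦ y ⟧ ⟩) (⟨⟩-cong (P? i z) (∈? (vector i) ⟦ z ⟧ ×-dec ¬? (∈? (vector i) ⟦ y ⟧)) proj₂ (z⋗y ,_)))
        (⟨⟩-∖ (∈? (vector i) ⟦ z ⟧) (∈? (vector i) ⟦ y ⟧) (λ i∈y → y⊆z i∈y))) ⟩
      card ⟦ z ⟧                                                   ≡⟨ card≡ ⟦ z ⟧ (basis-isBasis ⟦ z ⟧) ⟩
      q ^ d z                                                    ≡⟨ ≡.cong (q ^_) dz ⟩
      q ^ d y + p * q ^ d y                                ≡⟨ ℕ.+-comm (q ^ d y) _ ⟩
      p * q ^ d y + q ^ d y                                ≡⟨ ≡.cong (λ k → p * q ^ d y + k) (card≡ ⟦ y ⟧ (basis-isBasis ⟦ y ⟧)) ⟨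
      p * q ^ d y + card ⟦ y ⟧                               ∎))
      (≡.sym (≡.trans (≡.cong (_* (p * q ^ d y)) (⟨⟩-yes (covers? z y) z⋗y)) (ℕ.*-identityˡ _)))

  -- Common covers of two elements and transvections between them

  -- A common upper cover is generated by y and any vector of w outside y.
  unique-upper : ∀ {y w z z′} → ¬ y ≡ w → Covers z y × Covers z w → Covers z′ y × Covers z′ w → z′ ≡ z
  unique-upper {y} {w} {z} {z′} y≢w ((y⊆z , dz) , (w⊆z , dz₂)) ((y⊆z′ , dz′) , (w⊆z′ , _)) =
    let x , x∈w , x∉y = ≢⇒∃ {w} {y} (y≢w ∘ ≡.sym) (ℕ.suc-injective (≡.trans (≡.sym dz₂) dz)) in
    ⊆∧d≡⇒≡ (λ t∈z′ → adjoin-least {⟦ y ⟧} {x} ⟦ z ⟧ y⊆z (w⊆z x∈w) (cover⊆adjoin {⟦ y ⟧} {⟦ z′ ⟧} y⊆z′ dz′ (w⊆z′ x∈w) x∉y t∈z′))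
      (≡.trans dz′ (≡.sym dz))

  -- A vector of b′ outside b would, together with b, generate both y and w.
  unique-lower : ∀ {y w b b′} → ¬ y ≡ w → Covers y b × Covers w b → Covers y b′ × Covers w b′ → b′ ≡ b
  unique-lower {y} {w} {b} {b′} y≢w ((b⊆y , dy) , (b⊆w , dw)) ((b′⊆y , dy′) , (b′⊆w , dw′)) =
    ⊆∧d≡⇒≡ (λ {x} x∈b′ → decidable-stable (∈? x ⟦ b ⟧) λ x∉b → y≢w (⊆∧d≡⇒≡
        (λ t∈y → adjoin-least {⟦ b ⟧} {x} ⟦ w ⟧ b⊆w (b′⊆w x∈b′) (cover⊆adjoin {⟦ b ⟧} {⟦ y ⟧} b⊆y dy (b′⊆y x∈b′) x∉b t∈y)) (≡.trans dy (≡.sym dw))))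
      (ℕ.suc-injective (≡.trans (≡.sym dy′) dy))

  -- By modularity: y and w are hyperplanes of z, so their intersection is a hyperplane of each.
  upper⇒lower : ∀ {y w z} → ¬ y ≡ w → Covers z y × Covers z w → ∃ λ b → Covers y b × Covers w b
  upper⇒lower {y} {w} {z} y≢w ((y⊆z , dz) , (w⊆z , dz′)) = lower (≢⇒∃ y≢w dy≡dw)
    where
    dy≡dw : d y ≡ d w
    dy≡dw = ℕ.suc-injective (≡.trans (≡.sym dz) dz′)
    lower : (∃ λ x → x ∈ ⟦ y ⟧ × ¬ x ∈ ⟦ w ⟧) → ∃ λ b → Covers y b × Covers w b
    lower (x , x∈y , x∉w) =
      let b , b≐ , y⋗b@(_ , dy) = cover-below (λ x∈ → proj₁ (∈⊓⁻ {⟦ y ⟧} {⟦ w ⟧} x∈)) x∈y (λ x∈ → x∉w (proj₂ (∈⊓⁻ {⟦ y ⟧} {⟦ w ⟧} x∈))) y⊆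
      in b , y⋗b , (λ x∈b → proj₂ (∈⊓⁻ {⟦ y ⟧} {⟦ w ⟧} (_≐_.⊆-to b≐ x∈b))) , ≡.trans (≡.sym dy≡dw) dy
      where
      y⊆ : ⟦ y ⟧ ⊆ adjoin (⟦ y ⟧ ⊓ ⟦ w ⟧) x
      y⊆ t∈y = let a , s , s∈w , t≈ = ∈adjoin⁻ {⟦ w ⟧} {x} (cover⊆adjoin {⟦ w ⟧} {⟦ z ⟧} w⊆z dz′ (y⊆z x∈y) x∉w (y⊆z t∈y)) in
        Subspace.resp (adjoin (⟦ y ⟧ ⊓ ⟦ w ⟧) x) (≈ᴹ-sym t≈) (Subspace.+-closed (adjoin (⟦ y ⟧ ⊓ ⟦ w ⟧) x)
        (Subspace.*ₗ-closed (adjoin (⟦ y ⟧ ⊓ ⟦ w ⟧) x) a (x∈adjoin (⟦ y ⟧ ⊓ ⟦ w ⟧) x))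
        (⊆adjoin (⟦ y ⟧ ⊓ ⟦ w ⟧) x (∈⊓⁺ {⟦ y ⟧} {⟦ w ⟧} (x+y∈z∧x∈z⇒y∈z ⟦ y ⟧ (Subspace.resp ⟦ y ⟧ t≈ t∈y) (Subspace.*ₗ-closed ⟦ y ⟧ a x∈y)) s∈w)))

  d-acts : ∀ φ e y → d (acts φ e y) ≡ d y
  d-acts φ e = d-act φ (vec∈h e) (neg∈h (vec∈h e)) (e+neg≈0 (vec e))

  acts⁺ : ∀ φ e {y w} → d y ≡ d w → (∀ {x} → x ∈ ⟦ w ⟧ → shear (Φ φ) (vec e) x ∈ ⟦ y ⟧) → acts φ e y ≡ w
  acts⁺ φ e = act⁺ φ (vec∈h e) (neg∈h (vec∈h e)) (e+neg≈0 (vec e))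

  acts⁻ : ∀ φ e {y w x} → acts φ e y ≡ w → x ∈ ⟦ w ⟧ → shear (Φ φ) (vec e) x ∈ ⟦ y ⟧
  acts⁻ φ e = ∈act⁻ φ (vec∈h e)

  kills⇒fixes : ∀ φ e y → Kills φ ⟦ y ⟧ → acts φ e y ≡ y
  kills⇒fixes φ e y kills = acts⁺ φ e refl λ x∈y → Subspace.resp ⟦ y ⟧ (≈ᴹ-sym (shear-fixes (Φ φ) (vec e) (kills⇒ ⟦ y ⟧ kills x∈y))) x∈y

  -- The transvection fixes the intersection of y with the kernel of its form, which is a hyperplane
  -- of y unless the form vanishes on y.
  acts⇒lower : ∀ φ e {y w} → ¬ y ≡ w → acts φ e y ≡ w → ∃ λ b → Covers y b × Covers w b
  acts⇒lower φ e {y} {w} y≢w act≡w =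
    let b , b≐ , y⋗b@(b⊆y , dy) = hyperplane φ y (λ kills → y≢w (≡.trans (≡.sym (kills⇒fixes φ e y kills)) act≡w)) in
    b , y⋗b , (λ {x} x∈b → ≡.subst (λ s → x ∈ ⟦ s ⟧) act≡w (_≐_.⊆-from (act-≐ φ (vec∈h e) y) (∈move⁺ (Φ φ) (vec e) ⟦ y ⟧
      (Subspace.resp ⟦ y ⟧ (≈ᴹ-sym (shear-fixes (Φ φ) (vec e) (∈kernel⁻ (Φ φ) (proj₂ (∈⊓⁻ {⟦ y ⟧} {kernel (Φ φ)} (_≐_.⊆-to b≐ x∈b)))))) (b⊆y x∈b))))) ,
    ≡.trans (≡.sym (≡.trans (≡.sym (d-acts φ e y)) (≡.cong d act≡w))) dy

  -- For x in w but not in y, both x and x + φ(x) e would lie in z. Then φ(x) e lies in z and h, so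
  -- it is 0 and x is in y after all.
  upper⇒¬acts : ∀ φ e {y w z} → ¬ y ≡ w → Covers z y × Covers z w → ¬ acts φ e y ≡ w
  upper⇒¬acts φ e {y} {w} {z} y≢w ((y⊆z , dz) , (w⊆z , dz′)) act≡w =
    let x , x∈w , x∉y = ≢⇒∃ {w} {y} (y≢w ∘ ≡.sym) (ℕ.suc-injective (≡.trans (≡.sym dz′) dz))
        φxe≈0 = ⟦⟧-meets-trivially z _ (x+y∈z∧x∈z⇒y∈z ⟦ z ⟧ (y⊆z (acts⁻ φ e act≡w x∈w)) (w⊆z x∈w)) (Subspace.*ₗ-closed h _ (vec∈h e))
    in x∉y (Subspace.resp ⟦ y ⟧ (≈ᴹ-trans (+ᴹ-congˡ φxe≈0) (+ᴹ-identityʳ x)) (acts⁻ φ e act≡w x∈w))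

  neg-unique : ∀ {x y} → x +ᴹ y ≈ᴹ 0ᴹ → y ≈ᴹ neg x
  neg-unique {x} {y} x+y≈0 = ≈ᴹ-trans (≈ᴹ-sym (≈ᴹ-trans (+ᴹ-congʳ (neg+e≈0 x)) (+ᴹ-identityˡ y)))
    (≈ᴹ-trans (+ᴹ-assoc (neg x) x y) (≈ᴹ-trans (+ᴹ-congˡ x+y≈0) (+ᴹ-identityʳ _)))

  -- Here y = b + ⟨s⟩ and w = b + ⟨s + e⟩ with e ∈ h, so a transvection relating y
  -- and w is determined by any of the forms vanishing on b but not on y.
  ω-lower : ∀ {y w b} → ¬ y ≡ w → Covers y b × Covers w b → (∀ z → ¬ (Covers z y × Covers z w)) → ω y w ≡ p * ann y
  ω-lower {y} {w} {b} y≢w (y⋗b@(b⊆y , dy) , w⋗b@(b⊆w , dw)) ¬upper = ℕ.+-cancelʳ-≡ (ann y) (ω y w) (p * ann y) (begin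
    ω y w + ann y
      ≡⟨ ∑-distrib-+ (λ φ → ∑ λ e → ⟨ acts φ e y Fin.≟ w ⟩) (λ φ → ⟨ kills? φ ⟦ y ⟧ ⟩) ⟨
    ∑ (λ φ → ∑ (λ e → ⟨ acts φ e y Fin.≟ w ⟩) + ⟨ kills? φ ⟦ y ⟧ ⟩)
      ≡⟨ ∑-cong (λ φ → row φ (kills? φ ⟦ y ⟧) (kills? φ ⟦ b ⟧)) ⟩
    ann b                              ≡⟨ ann-cover y⋗b ⟩
    ann y + p * ann y              ≡⟨ ℕ.+-comm (ann y) _ ⟩
    p * ann y + ann y              ∎)
    where
    open ≡.≡-Reasoning
    dy≡dw : d y ≡ d w
    dy≡dw = ≡.trans dy (≡.sym dw)
    x : Carrierᴹ
    x = proj₁ (covers⇒∃ w⋗b)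
    x∈w : x ∈ ⟦ w ⟧
    x∈w = proj₁ (proj₂ (covers⇒∃ w⋗b))
    x∉b : ¬ x ∈ ⟦ b ⟧
    x∉b = proj₂ (proj₂ (covers⇒∃ w⋗b))
    w⊆b+x : ⟦ w ⟧ ⊆ adjoin ⟦ b ⟧ x
    w⊆b+x = cover⊆adjoin {⟦ b ⟧} {⟦ w ⟧} b⊆w dw x∈w x∉b
    x∉y : ¬ x ∈ ⟦ y ⟧
    x∉y x∈y = y≢w (⊆∧d≡⇒≡ (λ t∈y → adjoin-least {⟦ b ⟧} {x} ⟦ w ⟧ b⊆w x∈w (cover⊆adjoin {⟦ b ⟧} {⟦ y ⟧} b⊆y dy x∈y x∉b t∈y)) dy≡dw)
    -- Otherwise y + ⟨x⟩ would meet h trivially and cover both y and w.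
    x∈y+h : x ∈ (y ⊞h)
    x∈y+h = decidable-stable (∈? x (y ⊞h)) λ x∉ → let z , z≐ , z⋗y@(y⊆z , dz) = cover-above {y} x∉ in ¬upper z
      (z⋗y , (λ t∈w → adjoin-least {⟦ b ⟧} {x} ⟦ z ⟧ (λ u∈b → y⊆z (b⊆y u∈b)) (_≐_.⊆-from z≐ (x∈adjoin ⟦ y ⟧ x)) (w⊆b+x t∈w)) , ≡.trans dz (≡.cong suc dy≡dw))
    s e₀ : Carrierᴹ
    s = proj₁ (∈⊞h⁻ y x∈y+h)
    e₀ = proj₁ (proj₂ (∈⊞h⁻ y x∈y+h))
    s∈y : s ∈ ⟦ y ⟧
    s∈y = proj₁ (proj₂ (proj₂ (∈⊞h⁻ y x∈y+h)))
    e₀∈h : e₀ ∈ h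
    e₀∈h = proj₁ (proj₂ (proj₂ (proj₂ (∈⊞h⁻ y x∈y+h))))
    x≈s+e₀ : x ≈ᴹ s +ᴹ e₀
    x≈s+e₀ = proj₂ (proj₂ (proj₂ (proj₂ (∈⊞h⁻ y x∈y+h))))
    s∉b : ¬ s ∈ ⟦ b ⟧
    s∉b s∈b = x∉y (Subspace.resp ⟦ y ⟧ (≈ᴹ-sym (≈ᴹ-trans x≈s+e₀ (≈ᴹ-trans (+ᴹ-congˡ e₀≈0) (+ᴹ-identityʳ s)))) s∈y)
      where
      e₀≈0 : e₀ ≈ᴹ 0ᴹ
      e₀≈0 = ⟦⟧-meets-trivially w e₀ (x+y∈z∧x∈z⇒y∈z ⟦ w ⟧ (Subspace.resp ⟦ w ⟧ x≈s+e₀ x∈w) (b⊆w s∈b)) e₀∈h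
    φx≈φs : ∀ φ → at (Φ φ) x ≈ at (Φ φ) s
    φx≈φs φ = 𝔽.trans (at-cong (Φ φ) x≈s+e₀) (𝔽.trans (at-+ (Φ φ) s e₀) (𝔽.trans (𝔽.+-congˡ (Φ-h φ e₀∈h)) (𝔽.+-identityʳ _)))
    φx≉0 : ∀ φ → ¬ Kills φ ⟦ y ⟧ → Kills φ ⟦ b ⟧ → ¬ at (Φ φ) x ≈ 0#
    φx≉0 φ ¬kills kills φx≈0 = ¬kills (⇒kills ⟦ y ⟧ λ t∈y → ∈kernel⁻ (Φ φ) (adjoin-least {⟦ b ⟧} {s} (kernel (Φ φ))
      (λ u∈b → ∈kernel⁺ (Φ φ) (kills⇒ ⟦ b ⟧ kills u∈b)) (∈kernel⁺ (Φ φ) (𝔽.trans (𝔽.sym (φx≈φs φ)) φx≈0))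
      (cover⊆adjoin {⟦ b ⟧} {⟦ y ⟧} b⊆y dy s∈y s∉b t∈y)))
    shear-x : ∀ φ e → shear (Φ φ) (vec e) x ≈ᴹ s +ᴹ (e₀ +ᴹ at (Φ φ) x *ₗ vec e)
    shear-x φ e = ≈ᴹ-trans (+ᴹ-congʳ x≈s+e₀) (+ᴹ-assoc s e₀ _)
    acts⇒ : ∀ φ e → acts φ e y ≡ w → e₀ +ᴹ at (Φ φ) x *ₗ vec e ≈ᴹ 0ᴹ
    acts⇒ φ e act≡w = ⟦⟧-meets-trivially y _
      (x+y∈z∧x∈z⇒y∈z ⟦ y ⟧ (Subspace.resp ⟦ y ⟧ (shear-x φ e) (acts⁻ φ e act≡w x∈w)) s∈y)
      (Subspace.+-closed h e₀∈h (Subspace.*ₗ-closed h _ (vec∈h e)))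
    -- For u in b, the vectors u and u + φ(u) e both lie in y, so φ(u) e = 0. If φ(u) were nonzero,
    -- then e = 0, and x would be fixed and hence lie in y.
    acts⇒kills : ∀ φ e → acts φ e y ≡ w → Kills φ ⟦ b ⟧
    acts⇒kills φ e act≡w = ⇒kills ⟦ b ⟧ λ {u} u∈b → decidable-stable (at (Φ φ) u ≟ 0#) λ φu≉0 →
      let φue≈0 = ⟦⟧-meets-trivially y _ (x+y∈z∧x∈z⇒y∈z ⟦ y ⟧ (acts⁻ φ e act≡w (b⊆w u∈b)) (b⊆y u∈b)) (Subspace.*ₗ-closed h _ (vec∈h e))
      in x∉y (Subspace.resp ⟦ y ⟧ (≈ᴹ-trans (+ᴹ-congˡ (≈ᴹ-trans (*ₗ-congˡ (*ₗ≈0⇒≈0 φu≉0 φue≈0)) (*ₗ-zeroʳ _))) (+ᴹ-identityʳ x)) (acts⁻ φ e act≡w x∈w))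
    row : ∀ φ → Dec (Kills φ ⟦ y ⟧) → Dec (Kills φ ⟦ b ⟧) →
          ∑ (λ e → ⟨ acts φ e y Fin.≟ w ⟩) + ⟨ kills? φ ⟦ y ⟧ ⟩ ≡ ⟨ kills? φ ⟦ b ⟧ ⟩
    row φ (yes kills) _ = ≡.trans (≡.cong₂ _+_
        (∑-none (λ e → acts φ e y Fin.≟ w) (λ e act≡w → y≢w (≡.trans (≡.sym (kills⇒fixes φ e y kills)) act≡w)))
        (⟨⟩-yes (kills? φ ⟦ y ⟧) kills))
      (≡.sym (⟨⟩-yes (kills? φ ⟦ b ⟧) (kills-mono {φ} y⋗b kills)))
    row φ (no ¬killsʸ) (no ¬killsᵇ) = ≡.trans (≡.cong₂ _+_
        (∑-none (λ e → acts φ e y Fin.≟ w) (λ e act≡w → ¬killsᵇ (acts⇒kills φ e act≡w)))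
        (⟨⟩-no (kills? φ ⟦ y ⟧) ¬killsʸ))
      (≡.sym (⟨⟩-no (kills? φ ⟦ b ⟧) ¬killsᵇ))
    row φ (no ¬kills) (yes kills) = ≡.trans (≡.cong₂ _+_ exactly-one (⟨⟩-no (kills? φ ⟦ y ⟧) ¬kills)) (≡.sym (⟨⟩-yes (kills? φ ⟦ b ⟧) kills))
      where
      a a⁻¹ : Carrier
      a = at (Φ φ) x
      a⁻¹ = proj₁ (invert (φx≉0 φ ¬kills kills))
      a⁻¹a≈1 : a⁻¹ 𝔽.* a ≈ 1#
      a⁻¹a≈1 = proj₂ (invert (φx≉0 φ ¬kills kills))
      -- By `acts⇒` the vector e has to satisfy e₀ + φ(x) e = 0, with φ(x) invertible.
      solution : ∃ λ e → vec e ≈ᴹ a⁻¹ *ₗ neg e₀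
      solution = vec-surjective (Subspace.*ₗ-closed h a⁻¹ (neg∈h e₀∈h))
      e₁ : Fin (q ^ M)
      e₁ = proj₁ solution
      a*e₁≈ : a *ₗ vec e₁ ≈ᴹ neg e₀
      a*e₁≈ = ≈ᴹ-trans (*ₗ-congˡ (proj₂ solution)) (≈ᴹ-trans (≈ᴹ-sym (*ₗ-assoc a a⁻¹ _))
        (≈ᴹ-trans (*ₗ-congʳ (𝔽.trans (𝔽.*-comm a a⁻¹) a⁻¹a≈1)) (*ₗ-identityˡ _)))
      shear-x∈y : shear (Φ φ) (vec e₁) x ∈ ⟦ y ⟧
      shear-x∈y = Subspace.resp ⟦ y ⟧ (≈ᴹ-sym (≈ᴹ-trans (shear-x φ e₁) (≈ᴹ-trans (+ᴹ-congˡ (≈ᴹ-trans (+ᴹ-congˡ a*e₁≈) (e+neg≈0 e₀))) (+ᴹ-identityʳ s)))) s∈y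
      w⊆ : ⟦ w ⟧ ⊆ move (Φ φ) (vec e₁) ⟦ y ⟧
      w⊆ t∈w = adjoin-least {⟦ b ⟧} {x} (move (Φ φ) (vec e₁) ⟦ y ⟧)
        (λ u∈b → ∈move⁺ (Φ φ) (vec e₁) ⟦ y ⟧ (Subspace.resp ⟦ y ⟧ (≈ᴹ-sym (shear-fixes (Φ φ) (vec e₁) (kills⇒ ⟦ b ⟧ kills u∈b))) (b⊆y u∈b)))
        (∈move⁺ (Φ φ) (vec e₁) ⟦ y ⟧ shear-x∈y) (w⊆b+x t∈w)
      exactly-one : ∑ (λ e → ⟨ acts φ e y Fin.≟ w ⟩) ≡ 1
      exactly-one = ∑-unique (λ e → acts φ e y Fin.≟ w) e₁ (acts⁺ φ e₁ dy≡dw (λ t∈w → ∈move⁻ (Φ φ) (vec e₁) ⟦ y ⟧ (w⊆ t∈w)))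
        λ e act≡w → vec-injective (≈ᴹ-trans (≈ᴹ-sym (≈ᴹ-trans (≈ᴹ-sym (*ₗ-assoc a⁻¹ a _)) (≈ᴹ-trans (*ₗ-congʳ a⁻¹a≈1) (*ₗ-identityˡ _))))
          (≈ᴹ-trans (*ₗ-congˡ (neg-unique (acts⇒ φ e act≡w))) (≈ᴹ-sym (proj₂ solution))))

  -- A form vanishing on y contributes all q^M vectors. Any other form contributes only e = 0,
  -- because φ(x) e lies in y and h for some x in y with φ(x) nonzero.
  ω-diagonal : ∀ y → ω y y + ann y ≡ ann y * q ^ M + q ^ N
  ω-diagonal y = begin
    ω y y + ann y
      ≡⟨ ∑-distrib-+ (λ φ → ∑ λ e → ⟨ acts φ e y Fin.≟ y ⟩) (λ φ → ⟨ kills? φ ⟦ y ⟧ ⟩) ⟨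
    ∑ (λ φ → ∑ (λ e → ⟨ acts φ e y Fin.≟ y ⟩) + ⟨ kills? φ ⟦ y ⟧ ⟩)
      ≡⟨ ∑-cong (λ φ → row φ (kills? φ ⟦ y ⟧)) ⟩
    ∑ (λ φ → ⟨ kills? φ ⟦ y ⟧ ⟩ * q ^ M + 1)
      ≡⟨ ∑-distrib-+ (λ φ → ⟨ kills? φ ⟦ y ⟧ ⟩ * q ^ M) (λ _ → 1) ⟩
    ∑ (λ φ → ⟨ kills? φ ⟦ y ⟧ ⟩ * q ^ M) + ∑ {q ^ N} (λ _ → 1)
      ≡⟨ ≡.cong₂ _+_ (≡.sym (*-distribʳ-sum (q ^ M) (λ φ → ⟨ kills? φ ⟦ y ⟧ ⟩))) (∑-1 (q ^ N)) ⟩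
    ann y * q ^ M + q ^ N ∎
    where
    open ≡.≡-Reasoning
    row : ∀ φ → Dec (Kills φ ⟦ y ⟧) → ∑ (λ e → ⟨ acts φ e y Fin.≟ y ⟩) + ⟨ kills? φ ⟦ y ⟧ ⟩ ≡ ⟨ kills? φ ⟦ y ⟧ ⟩ * q ^ M + 1
    row φ (yes kills) = ≡.cong₂ _+_
      (≡.trans (∑-cong λ e → ⟨⟩-yes (acts φ e y Fin.≟ y) (kills⇒fixes φ e y kills)) (≡.trans (∑-1 (q ^ M))
        (≡.sym (≡.trans (≡.cong (_* q ^ M) (⟨⟩-yes (kills? φ ⟦ y ⟧) kills)) (ℕ.*-identityˡ _)))))
      (⟨⟩-yes (kills? φ ⟦ y ⟧) kills)
    row φ (no ¬kills) = ≡.trans (≡.cong₂ _+_ exactly-one (⟨⟩-no (kills? φ ⟦ y ⟧) ¬kills))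
      (≡.sym (≡.cong (λ k → k * q ^ M + 1) (⟨⟩-no (kills? φ ⟦ y ⟧) ¬kills)))
      where
      zeroᴴ : ∃ λ e → vec e ≈ᴹ 0ᴹ
      zeroᴴ = vec-surjective (Subspace.0-closed h)
      exactly-one : ∑ (λ e → ⟨ acts φ e y Fin.≟ y ⟩) ≡ 1
      exactly-one = let x , x∈y , φx≉0 = ¬kills⇒∃ ⟦ y ⟧ ¬kills in ∑-unique (λ e → acts φ e y Fin.≟ y) (proj₁ zeroᴴ)
        (acts⁺ φ (proj₁ zeroᴴ) refl λ {t} t∈y → Subspace.resp ⟦ y ⟧
          (≈ᴹ-sym (≈ᴹ-trans (+ᴹ-congˡ (≈ᴹ-trans (*ₗ-congˡ (proj₂ zeroᴴ)) (*ₗ-zeroʳ _))) (+ᴹ-identityʳ t))) t∈y)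
        λ e act≡y → vec-injective (≈ᴹ-trans (*ₗ≈0⇒≈0 φx≉0 (⟦⟧-meets-trivially y _
          (x+y∈z∧x∈z⇒y∈z ⟦ y ⟧ (acts⁻ φ e act≡y x∈y) x∈y) (Subspace.*ₗ-closed h _ (vec∈h e)))) (≈ᴹ-sym (proj₂ zeroᴴ)))

  -- The commutation relation, entry by entry

  Commutator : X → X → Set
  Commutator y w =
    p * q ^ (N + d y) * ∑ (λ z → C z y * C z w) + q ^ (d y + d y) * ω y w ≡
    p * q ^ (N + d y) * ∑ (λ z → C y z * C w z) + q ^ (N + N + M) * ⟨ y Fin.≟ w ⟩

  commutator-diagonal : ∀ y → Commutator y y
  commutator-diagonal y = begin
    p * q ^ (N + d y) * ∑ (λ z → C z y * C z y) + q ^ (d y + d y) * ω y y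
      ≡⟨ ≡.cong₂ _+_ (≡.cong₂ (λ a b → p * a * b) (ℕ.^-distribˡ-+-* q N (d y)) (∑-cong λ z → idem (covers? z y)))
           (≡.cong (_* ω y y) (ℕ.^-distribˡ-+-* q (d y) (d y))) ⟩
    p * (q ^ N * q ^ d y) * ∑ (λ z → C z y) + q ^ d y * q ^ d y * ω y y
      ≡⟨ arithmetic p (∑ λ z → C z y) (∑ (C y)) (ω y y) (ann y) (q ^ d y) (q ^ N) (q ^ M)
           (≡.trans (≡.cong (λ k → ∑ (λ z → C z y) * (p * q ^ d y) + k) (≡.sym (ℕ.^-distribˡ-+-* q (d y) M)))
             (≡.trans (upper-count y) (ℕ.^-distribˡ-+-* q N M)))
           (lower-count y) (ω-diagonal y) (ann-count y) ⟩
    p * (q ^ N * q ^ d y) * ∑ (C y) + q ^ N * q ^ N * q ^ M * 1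
      ≡⟨ ≡.cong₂ _+_ (≡.cong₂ (λ a b → p * a * b) (ℕ.^-distribˡ-+-* q N (d y)) (∑-cong λ z → idem (covers? y z)))
           (≡.cong₂ _*_ (≡.trans (ℕ.^-distribˡ-+-* q (N + N) M) (≡.cong (_* q ^ M) (ℕ.^-distribˡ-+-* q N N))) (⟨⟩-yes (y Fin.≟ y) refl)) ⟨
    p * q ^ (N + d y) * ∑ (λ z → C y z * C y z) + q ^ (N + N + M) * ⟨ y Fin.≟ y ⟩ ∎
    where
    open ≡.≡-Reasoning
    idem : ∀ {r} {P : Set r} (P? : Dec P) → ⟨ P? ⟩ * ⟨ P? ⟩ ≡ ⟨ P? ⟩
    idem (yes _) = refl
    idem (no _)  = refl
    arithmetic : ∀ p U D W B qᵈ qᴺ qᴹ → U * (p * qᵈ) + qᵈ * qᴹ ≡ qᴺ * qᴹ → D * p + 1 ≡ qᵈ →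
      W + B ≡ B * qᴹ + qᴺ → B * qᵈ ≡ qᴺ →
      p * (qᴺ * qᵈ) * U + qᵈ * qᵈ * W ≡ p * (qᴺ * qᵈ) * D + qᴺ * qᴺ * qᴹ * 1
    -- The same quantity is added on both sides, so that the four counts can be substituted without
    -- subtracting.
    arithmetic p U D W B qᵈ qᴺ qᴹ upper lower diagonal annihilator = ℕ.+-cancelʳ-≡ (qᴺ * (qᵈ * qᴹ) + qᵈ * qᵈ * B) _ _ (begin
      p * (qᴺ * qᵈ) * U + qᵈ * qᵈ * W + (qᴺ * (qᵈ * qᴹ) + qᵈ * qᵈ * B)
        ≡⟨ left p U W B qᵈ qᴺ qᴹ ⟩
      qᴺ * (U * (p * qᵈ) + qᵈ * qᴹ) + qᵈ * qᵈ * (W + B)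
        ≡⟨ ≡.cong₂ (λ a b → qᴺ * a + qᵈ * qᵈ * b) upper diagonal ⟩
      qᴺ * (qᴺ * qᴹ) + qᵈ * qᵈ * (B * qᴹ + qᴺ)
        ≡⟨ middle B qᵈ qᴺ qᴹ ⟩
      qᴺ * (qᴺ * qᴹ) + (B * qᵈ) * (qᵈ * qᴹ) + qᴺ * qᵈ * qᵈ
        ≡⟨ ≡.cong₂ (λ a b → qᴺ * (qᴺ * qᴹ) + a * (qᵈ * qᴹ) + qᴺ * qᵈ * b) annihilator (≡.sym lower) ⟩
      qᴺ * (qᴺ * qᴹ) + qᴺ * (qᵈ * qᴹ) + qᴺ * qᵈ * (D * p + 1)
        ≡⟨ right p D qᵈ qᴺ qᴹ ⟩
      p * (qᴺ * qᵈ) * D + qᴺ * qᴺ * qᴹ * 1 + (qᴺ * (qᵈ * qᴹ) + qᵈ * qᴺ)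
        ≡⟨ ≡.cong (λ a → p * (qᴺ * qᵈ) * D + qᴺ * qᴺ * qᴹ * 1 + (qᴺ * (qᵈ * qᴹ) + qᵈ * a)) annihilator ⟨
      p * (qᴺ * qᵈ) * D + qᴺ * qᴺ * qᴹ * 1 + (qᴺ * (qᵈ * qᴹ) + qᵈ * (B * qᵈ))
        ≡⟨ last p D B qᵈ qᴺ qᴹ ⟩
      p * (qᴺ * qᵈ) * D + qᴺ * qᴺ * qᴹ * 1 + (qᴺ * (qᵈ * qᴹ) + qᵈ * qᵈ * B) ∎)
      where
      left : ∀ p U W B qᵈ qᴺ qᴹ → p * (qᴺ * qᵈ) * U + qᵈ * qᵈ * W + (qᴺ * (qᵈ * qᴹ) + qᵈ * qᵈ * B) ≡
             qᴺ * (U * (p * qᵈ) + qᵈ * qᴹ) + qᵈ * qᵈ * (W + B)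
      left = solve-∀
      middle : ∀ B qᵈ qᴺ qᴹ → qᴺ * (qᴺ * qᴹ) + qᵈ * qᵈ * (B * qᴹ + qᴺ) ≡
             qᴺ * (qᴺ * qᴹ) + (B * qᵈ) * (qᵈ * qᴹ) + qᴺ * qᵈ * qᵈ
      middle = solve-∀
      right : ∀ p D qᵈ qᴺ qᴹ → qᴺ * (qᴺ * qᴹ) + qᴺ * (qᵈ * qᴹ) + qᴺ * qᵈ * (D * p + 1) ≡
              p * (qᴺ * qᵈ) * D + qᴺ * qᴺ * qᴹ * 1 + (qᴺ * (qᵈ * qᴹ) + qᵈ * qᴺ)
      right = solve-∀
      last : ∀ p D B qᵈ qᴺ qᴹ → p * (qᴺ * qᵈ) * D + qᴺ * qᴺ * qᴹ * 1 + (qᴺ * (qᵈ * qᴹ) + qᵈ * (B * qᵈ)) ≡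
             p * (qᴺ * qᵈ) * D + qᴺ * qᴺ * qᴹ * 1 + (qᴺ * (qᵈ * qᴹ) + qᵈ * qᵈ * B)
      last = solve-∀

  uppers? : ∀ y w z → Dec (Covers z y × Covers z w)
  uppers? y w z = covers? z y ×-dec covers? z w

  lowers? : ∀ y w z → Dec (Covers y z × Covers w z)
  lowers? y w z = covers? y z ×-dec covers? w z

  -- Common covers are unique, and an upper one forces a lower one. With neither, all terms vanish.
  -- With both, the entries of L R and R L are 1 and there is no transvection. With a lower one
  -- only, Ω contributes `p * ann y`, and `ann y * q ^ d y` = `q ^ N` makes up for the missing 1.
  commutator-off-diagonal : ∀ {y w} → ¬ y ≡ w → Commutator y w
  commutator-off-diagonal {y} {w} y≢w = go (Fin.any? (lowers? y w)) (Fin.any? (uppers? y w))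
    where
    open ≡.≡-Reasoning
    from : ∀ {u v o} → ∑ (λ z → ⟨ uppers? y w z ⟩) ≡ u → ∑ (λ z → ⟨ lowers? y w z ⟩) ≡ v → ω y w ≡ o →
           p * q ^ (N + d y) * u + q ^ (d y + d y) * o ≡ p * q ^ (N + d y) * v → Commutator y w
    from {u} {v} {o} u≡ v≡ o≡ eq = begin
      p * q ^ (N + d y) * ∑ (λ z → C z y * C z w) + q ^ (d y + d y) * ω y w
        ≡⟨ ≡.cong₂ (λ a b → p * q ^ (N + d y) * a + q ^ (d y + d y) * b)
             (≡.trans (∑-cong λ z → ⟨⟩-× (covers? z y) (covers? z w)) u≡) o≡ ⟩
      p * q ^ (N + d y) * u + q ^ (d y + d y) * o   ≡⟨ eq ⟩
      p * q ^ (N + d y) * v                                 ≡⟨ ℕ.+-identityʳ _ ⟨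
      p * q ^ (N + d y) * v + 0                           ≡⟨ ≡.cong (λ k → p * q ^ (N + d y) * v + k) (ℕ.*-zeroʳ (q ^ (N + N + M))) ⟨
      p * q ^ (N + d y) * v + q ^ (N + N + M) * 0
        ≡⟨ ≡.cong₂ (λ a b → p * q ^ (N + d y) * a + q ^ (N + N + M) * b)
             (≡.trans (∑-cong λ z → ⟨⟩-× (covers? y z) (covers? w z)) v≡) (⟨⟩-no (y Fin.≟ w) y≢w) ⟨
      p * q ^ (N + d y) * ∑ (λ z → C y z * C w z) + q ^ (N + N + M) * ⟨ y Fin.≟ w ⟩ ∎
    ω≡0 : (∀ φ e → ¬ acts φ e y ≡ w) → ω y w ≡ 0
    ω≡0 ¬acts = ∑-zero _ λ φ → ∑-none (λ e → acts φ e y Fin.≟ w) (¬acts φ)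
    0-absorbs : ∀ a b → a + b * 0 ≡ a
    0-absorbs = solve-∀
    counts-agree : ∀ p qᴺ qᵈ a → a * qᵈ ≡ qᴺ → p * (qᴺ * qᵈ) * 0 + qᵈ * qᵈ * (p * a) ≡ p * (qᴺ * qᵈ) * 1
    counts-agree p .(a * qᵈ) qᵈ a refl = lemma p qᵈ a
      where
      lemma : ∀ p qᵈ a → p * (a * qᵈ * qᵈ) * 0 + qᵈ * qᵈ * (p * a) ≡ p * (a * qᵈ * qᵈ) * 1
      lemma = solve-∀
    go : Dec (∃ λ b → Covers y b × Covers w b) → Dec (∃ λ z → Covers z y × Covers z w) → Commutator y w
    go (no ¬lower) _ = from {0} {0} {0}
      (∑-none (uppers? y w) λ z upper → ¬lower (upper⇒lower y≢w upper))
      (∑-none (lowers? y w) λ b lower → ¬lower (b , lower))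
      (ω≡0 λ φ e act≡w → ¬lower (acts⇒lower φ e y≢w act≡w)) (0-absorbs _ (q ^ (d y + d y)))
    go (yes (b , lower)) (yes (z , upper)) = from {1} {1} {0}
      (∑-unique (uppers? y w) z upper (λ z′ → unique-upper {y} {w} y≢w upper))
      (∑-unique (lowers? y w) b lower (λ b′ → unique-lower {y} {w} y≢w lower))
      (ω≡0 λ φ e → upper⇒¬acts φ e y≢w upper) (0-absorbs _ (q ^ (d y + d y)))
    go (yes (b , lower)) (no ¬upper) = from {0} {1} {p * ann y}
      (∑-none (uppers? y w) λ z upper → ¬upper (z , upper))
      (∑-unique (lowers? y w) b lower (λ b′ → unique-lower {y} {w} y≢w lower))
      (ω-lower y≢w lower (λ z upper → ¬upper (z , upper)))
      (≡.trans (≡.cong₂ (λ a b → p * a * 0 + b * (p * ann y)) (ℕ.^-distribˡ-+-* q N (d y)) (ℕ.^-distribˡ-+-* q (d y) (d y)))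
        (≡.trans (counts-agree p (q ^ N) (q ^ d y) (ann y) (ann-count y))
          (≡.cong (λ a → p * a * 1) (≡.sym (ℕ.^-distribˡ-+-* q N (d y))))))

  commutator : ∀ y w → Commutator y w
  commutator y w = cases (y Fin.≟ w)
    where
    cases : Dec (y ≡ w) → Commutator y w
    cases (yes refl) = commutator-diagonal y
    cases (no y≢w)   = commutator-off-diagonal y≢w

-- Absolute values and a bound on eigenvalues

record AbsoluteValue {a ℓ : Level} (K : CommutativeRing a ℓ) : Set (a ⊔ ℓ) where
  open CommutativeRing K
  field
    ∣_∣        : Carrier → Carrier
    ∣∣-cong    : ∀ {x y} → x ≈ y → ∣ x ∣ ≈ ∣ y ∣
    ∣xy∣       : ∀ x y → ∣ x * y ∣ ≈ ∣ x ∣ * ∣ y ∣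
    ∣-x∣       : ∀ x → ∣ - x ∣ ≈ ∣ x ∣
    ∣0∣        : ∣ 0# ∣ ≈ 0#
    ∣∣x∣∣      : ∀ x → ∣ ∣ x ∣ ∣ ≈ ∣ x ∣
    ∣∣x∣+∣y∣∣  : ∀ x y → ∣ ∣ x ∣ + ∣ y ∣ ∣ ≈ ∣ x ∣ + ∣ y ∣
    triangle   : ∀ x y → ∣ ∣ x ∣ + ∣ y ∣ - ∣ x + y ∣ ∣ ≈ ∣ x ∣ + ∣ y ∣ - ∣ x + y ∣
    ∣x∣≈0⇒x≈0  : ∀ {x} → ∣ x ∣ ≈ 0# → x ≈ 0#
    x+x≈0⇒x≈0  : ∀ {x} → x + x ≈ 0# → x ≈ 0#

module NonNegativity {a ℓ : Level} (K : CommutativeRing a ℓ) (abs : AbsoluteValue K) where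
  open CommutativeRing K hiding (zero) renaming (refl to ≈-refl; sym to ≈-sym; trans to ≈-trans)
  open AbsoluteValue abs
  open Algebra.Properties.Ring ring using (-0#≈0#)
  open Algebra.Properties.Semiring.Sum semiring using (sum; sum-cong-≋; ∑-distrib-+; ∑-comm; *-distribˡ-sum; *-distribʳ-sum)
  open ℤ-Coefficients K
  open LinearCombinations K
  open import Relation.Binary.Reasoning.Setoid setoid

  -- An equation instead of an order relation: it passes through ring identities, and no sign has to
  -- be decided.
  NonNegative : Carrier → Set ℓ
  NonNegative x = ∣ x ∣ ≈ x

  Invertible : Carrier → Set (a ⊔ ℓ)
  Invertible x = ∃ λ y → x * y ≈ 1#

  nonNegative-resp : ∀ {x y} → x ≈ y → NonNegative x → NonNegative y
  nonNegative-resp x≈y ∣x∣≈x = ≈-trans (∣∣-cong (≈-sym x≈y)) (≈-trans ∣x∣≈x x≈y)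

  nonNegative-+ : ∀ {x y} → NonNegative x → NonNegative y → NonNegative (x + y)
  nonNegative-+ {x} {y} ∣x∣≈x ∣y∣≈y = nonNegative-resp (+-cong ∣x∣≈x ∣y∣≈y) (∣∣x∣+∣y∣∣ x y)

  nonNegative-* : ∀ {x y} → NonNegative x → NonNegative y → NonNegative (x * y)
  nonNegative-* {x} {y} ∣x∣≈x ∣y∣≈y = ≈-trans (∣xy∣ x y) (*-cong ∣x∣≈x ∣y∣≈y)

  nonNegative-sum : ∀ {n} {f : Fin n → Carrier} → (∀ i → NonNegative (f i)) → NonNegative (sum f)
  nonNegative-sum {zero}  f≥0 = ∣0∣
  nonNegative-sum {suc n} f≥0 = nonNegative-+ (f≥0 zero) (nonNegative-sum (f≥0 ∘ suc))

  -- From x = -y follows |x| = |y|, that is x = y, so 2x = x + y = 0.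
  nonNegative-antisym : ∀ {x y} → NonNegative x → NonNegative y → x + y ≈ 0# → x ≈ 0#
  nonNegative-antisym {x} {y} ∣x∣≈x ∣y∣≈y x+y≈0 = x+x≈0⇒x≈0 (begin
    x + x            ≈⟨ +-congˡ ∣x∣≈x ⟨
    x + ∣ x ∣        ≈⟨ +-congˡ (∣∣-cong x≈-y) ⟩
    x + ∣ - y ∣      ≈⟨ +-congˡ (≈-trans (∣-x∣ y) ∣y∣≈y) ⟩
    x + y            ≈⟨ x+y≈0 ⟩
    0#               ∎)
    where
    x≈-y : x ≈ - y
    x≈-y = solve 2 (λ x y → x :- :- y := con (+ 1) :* (x :+ y :- con (+ 0))) ≈-refl x y by _ ⊙ x+y≈0

  sum≈0⇒≈0 : ∀ {n} (f : Fin n → Carrier) → (∀ i → NonNegative (f i)) → sum f ≈ 0# → ∀ i → f i ≈ 0#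
  sum≈0⇒≈0 {suc n} f f≥0 sum≈0 zero    = nonNegative-antisym (f≥0 zero) (nonNegative-sum (f≥0 ∘ suc)) sum≈0
  sum≈0⇒≈0 {suc n} f f≥0 sum≈0 (suc i) = sum≈0⇒≈0 (f ∘ suc) (f≥0 ∘ suc)
    (nonNegative-antisym (nonNegative-sum (f≥0 ∘ suc)) (f≥0 zero) (≈-trans (+-comm _ _) sum≈0)) i

  triangle-sum : ∀ {n} (f : Fin n → Carrier) → NonNegative (sum (λ i → ∣ f i ∣) - ∣ sum f ∣)
  triangle-sum {zero}  f = nonNegative-resp (≈-sym (≈-trans (+-congˡ (≈-trans (-‿cong ∣0∣) -0#≈0#)) (+-identityʳ 0#))) ∣0∣
  triangle-sum {suc n} f = nonNegative-resp
    (solve 4 (λ x s s′ t → (x :+ s′ :- t) :+ (s :- s′) := x :+ s :- t) ≈-refl (∣ f zero ∣) (sum λ i → ∣ f (suc i) ∣) (∣ sum (f ∘ suc) ∣) _)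
    (nonNegative-+ (triangle (f zero) (sum (f ∘ suc))) (triangle-sum (f ∘ suc)))

  invertible-*≈0 : ∀ {x y} → Invertible x → x * y ≈ 0# → y ≈ 0#
  invertible-*≈0 {x} {y} (x⁻¹ , xx⁻¹≈1) xy≈0 =
    solve 3 (λ x x⁻¹ y → y :- con (+ 0) := :- y :* (x :* x⁻¹ :- con (+ 1)) :+ x⁻¹ :* (x :* y :- con (+ 0))) ≈-refl x x⁻¹ y
    by _ ⊙ xx⁻¹≈1 ⊕ _ ⊙ xy≈0

  module _ {n : ℕ} (B : Fin n → Fin n → Carrier) (B≥0 : ∀ y z → NonNegative (B y z))
    (weight : Fin n → Carrier) (weight≥0 : ∀ y → NonNegative (weight y)) (weight-invertible : ∀ y → Invertible (weight y))
    (μ : Carrier) (weight-eigen : ∀ z → sum (λ y → weight y * B y z) ≈ μ * weight z) where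

    -- In the weighted ℓ¹-norm the matrix B has norm at most μ.
    eigenvalue-bound : ∀ {ν} → NonNegative (∣ ν ∣ - μ) → Invertible (∣ ν ∣ - μ) →
                       ∀ (w : Fin n → Carrier) → (∀ y → sum (λ z → B y z * w z) ≈ ν * w y) → ∀ y → w y ≈ 0#
    eigenvalue-bound {ν} ν>μ ν-μ-invertible w w-eigen y = ∣x∣≈0⇒x≈0 (invertible-*≈0 (weight-invertible y)
      (sum≈0⇒≈0 (λ y → weight y * ∣ w y ∣) term≥0 (invertible-*≈0 ν-μ-invertible norm≈0) y))
      where
      term≥0 : ∀ y → NonNegative (weight y * ∣ w y ∣)
      term≥0 y = nonNegative-* (weight≥0 y) (∣∣x∣∣ (w y))
      norm : Carrier
      norm = sum λ y → weight y * ∣ w y ∣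
      ∣ν∣norm : ∣ ν ∣ * norm ≈ sum λ y → weight y * ∣ sum (λ z → B y z * w z) ∣
      ∣ν∣norm = ≈-trans (*-distribˡ-sum (∣ ν ∣) (λ y → weight y * ∣ w y ∣)) (sum-cong-≋ λ y → ≈-trans
        (solve 3 (λ a b c → a :* (b :* c) := b :* (a :* c)) ≈-refl (∣ ν ∣) (weight y) (∣ w y ∣))
        (*-congˡ (≈-trans (≈-sym (∣xy∣ ν (w y))) (∣∣-cong (≈-sym (w-eigen y))))))
      μ*norm : μ * norm ≈ sum λ y → weight y * sum (λ z → ∣ B y z * w z ∣)
      μ*norm = begin
        μ * norm
          ≈⟨ *-distribˡ-sum μ (λ z → weight z * ∣ w z ∣) ⟩
        sum (λ z → μ * (weight z * ∣ w z ∣))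
          ≈⟨ sum-cong-≋ (λ z → ≈-trans (≈-sym (*-assoc μ (weight z) (∣ w z ∣))) (≈-trans (*-congʳ (≈-sym (weight-eigen z)))
               (*-distribʳ-sum (∣ w z ∣) (λ y → weight y * B y z)))) ⟩
        sum (λ z → sum λ y → weight y * B y z * ∣ w z ∣)
          ≈⟨ ∑-comm (λ z y → weight y * B y z * ∣ w z ∣) ⟩
        sum (λ y → sum λ z → weight y * B y z * ∣ w z ∣)
          ≈⟨ sum-cong-≋ (λ y → ≈-trans (sum-cong-≋ λ z → ≈-trans (*-assoc _ _ _) (*-congˡ (≈-trans (*-congʳ (≈-sym (B≥0 y z))) (≈-sym (∣xy∣ (B y z) (w z))))))
               (≈-sym (*-distribˡ-sum (weight y) (λ z → ∣ B y z * w z ∣)))) ⟩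
        sum (λ y → weight y * sum (λ z → ∣ B y z * w z ∣)) ∎
      -- The slack of the triangle inequality in row y. Its weighted sum and (|ν| - μ) `norm` are
      -- both nonnegative and add up to 0.
      excess : Fin n → Carrier
      excess y = sum (λ z → ∣ B y z * w z ∣) - ∣ sum (λ z → B y z * w z) ∣
      split : sum (λ y → weight y * excess y) + sum (λ y → weight y * ∣ sum (λ z → B y z * w z) ∣) ≈ sum (λ y → weight y * sum (λ z → ∣ B y z * w z ∣))
      split = ≈-trans (≈-sym (∑-distrib-+ (λ y → weight y * excess y) (λ y → weight y * ∣ sum (λ z → B y z * w z) ∣)))
        (sum-cong-≋ λ y → solve 3 (λ w a b → w :* (a :- b) :+ w :* b := w :* a) ≈-refl (weight y) _ _)
      norm≈0 : (∣ ν ∣ - μ) * norm ≈ 0#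
      norm≈0 = nonNegative-antisym (nonNegative-* ν>μ (nonNegative-sum term≥0))
        (nonNegative-sum λ y → nonNegative-* (weight≥0 y) (triangle-sum (λ z → B y z * w z)))
        (solve 6 (λ ν μ S T V W → (ν :- μ) :* S :+ T :- con (+ 0) :=
            con (+ 1) :* (ν :* S :- V) :+ :- con (+ 1) :* (μ :* S :- W) :+ con (+ 1) :* (T :+ V :- W))
          ≈-refl (∣ ν ∣) μ norm (sum λ y → weight y * excess y) _ _ by _ ⊙ ∣ν∣norm ⊕ _ ⊙ μ*norm ⊕ _ ⊙ split)

-- A positive left eigenvector of A

module ColumnSums {a ℓ : Level} (K : CommutativeRing a ℓ) {n : ℕ}
  (c : Fin n → Fin n → ℕ) (d : Fin n → ℕ) (p N M : ℕ)
  (c-graded : ∀ y z → c y z ≡ 0 ⊎ d y ≡ suc (d z))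
  (upper-count : ∀ y → Counting.∑ (λ z → c z y) ℕ.* (p ℕ.* suc p ℕ.^ d y) ℕ.+ suc p ℕ.^ (d y ℕ.+ M) ≡ suc p ℕ.^ (N ℕ.+ M))
  (lower-count : ∀ y → Counting.∑ (c y) ℕ.* p ℕ.+ 1 ≡ suc p ℕ.^ d y)
  where
  open CommutativeRing K hiding (zero) renaming (refl to ≈-refl; sym to ≈-sym; trans to ≈-trans)
  open Algebra.Properties.Semiring.Sum semiring using (sum; sum-cong-≋; ∑-distrib-+; *-distribˡ-sum)
  open import Algebra.Properties.Semiring.Exp semiring using (_^_; ^-homo-*)
  open ℤ-Coefficients K
  open LinearCombinations K
  open Counting using (∑)
  open Operators K n using (fromℕ-∑)
  open import Relation.Binary.Reasoning.Setoid setoid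

  private
    x : Carrier
    x = fromℕ (suc p)

    fromℕ-^ : ∀ k → fromℕ (suc p ℕ.^ k) ≈ x ^ k
    fromℕ-^ zero    = ≈-refl
    fromℕ-^ (suc k) = ≈-trans (fromℕ-* (suc p) (suc p ℕ.^ k)) (*-congˡ (fromℕ-^ k))

  -- With q = x and r = q^(-M/2), the Perron vector q^(binom(dim, 2) - M dim / 2).
  module _ (p⁻¹ r⁻¹ r : Carrier) (pp⁻¹≈1 : fromℕ p * p⁻¹ ≈ 1#) (rr⁻¹≈1 : r * r⁻¹ ≈ 1#) (r⁻¹²≈xᴹ : r⁻¹ * r⁻¹ ≈ x ^ M) where

    weight : ℕ → Carrier
    weight zero    = 1#
    weight (suc j) = x ^ j * r * weight j

    private
      weight-suc : ∀ {j k} → j ≡ suc k → weight j ≈ x ^ k * r * weight k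
      weight-suc refl = ≈-refl

    -- By the two cover counts and r x^M = r⁻¹, the covers above z contribute x^N - x^dim z and
    -- those below x^dim z - 1, both times p⁻¹ r⁻¹ `weight (d z)`. The dependence on dim z cancels
    -- in the sum.
    weight-eigen : ∀ z → sum (λ y → weight (d y) * (fromℕ (c y z) + x ^ d y * fromℕ (c z y))) ≈ (x ^ N - 1#) * p⁻¹ * r⁻¹ * weight (d z)
    weight-eigen z = begin
      sum (λ y → W y * (fromℕ (c y z) + x ^ d y * fromℕ (c z y)))
        ≈⟨ sum-cong-≋ (λ y → ≈-trans (distribˡ _ _ _) (+-cong (above y) (below y))) ⟩
      sum (λ y → x ^ d z * r * W z * fromℕ (c y z) + r⁻¹ * W z * fromℕ (c z y))
        ≈⟨ ∑-distrib-+ (λ y → x ^ d z * r * W z * fromℕ (c y z)) (λ y → r⁻¹ * W z * fromℕ (c z y)) ⟩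
      sum (λ y → x ^ d z * r * W z * fromℕ (c y z)) + sum (λ y → r⁻¹ * W z * fromℕ (c z y))
        ≈⟨ +-cong (pull (x ^ d z * r * W z) (λ y → c y z)) (pull (r⁻¹ * W z) (c z)) ⟩
      x ^ d z * r * W z * fromℕ (∑ λ y → c y z) + r⁻¹ * W z * fromℕ (∑ (c z))
        ≈⟨ (solve 10 (λ P P′ R R′ XD XN XM W U D →
              (XD :* R :* W :* U :+ R′ :* W :* D) :- (XN :- con (+ 1)) :* P′ :* R′ :* W :=
              :- (XD :* R :* W :* U :+ R′ :* W :* D) :* (P :* P′ :- con (+ 1))
              :+ P′ :* R :* W :* (U :* (P :* XD) :+ XD :* XM :- XN :* XM)
              :+ P′ :* R′ :* W :* (D :* P :+ con (+ 1) :- XD)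
              :+ :- (P′ :* W :* (XN :- XD) :* R) :* (R′ :* R′ :- XM)
              :+ P′ :* W :* (XN :- XD) :* R′ :* (R :* R′ :- con (+ 1)))
            ≈-refl (fromℕ p) p⁻¹ r r⁻¹ (x ^ d z) (x ^ N) (x ^ M) (W z) (fromℕ (∑ λ y → c y z)) (fromℕ (∑ (c z)))
           by _ ⊙ pp⁻¹≈1 ⊕ _ ⊙ upper ⊕ _ ⊙ lower ⊕ _ ⊙ r⁻¹²≈xᴹ ⊕ _ ⊙ rr⁻¹≈1) ⟩
      (x ^ N - 1#) * p⁻¹ * r⁻¹ * W z ∎
      where
      W : Fin n → Carrier
      W y = weight (d y)
      pull : ∀ b (f : Fin n → ℕ) → sum (λ y → b * fromℕ (f y)) ≈ b * fromℕ (∑ f)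
      pull b f = ≈-trans (≈-sym (*-distribˡ-sum b (λ y → fromℕ (f y)))) (*-congˡ (≈-sym (fromℕ-∑ f)))
      above : ∀ y → W y * fromℕ (c y z) ≈ x ^ d z * r * W z * fromℕ (c y z)
      above y with c y z | c-graded y z
      ... | _ | inj₁ refl = ≈-trans (zeroʳ _) (≈-sym (zeroʳ _))
      ... | k | inj₂ dy≡ = *-congʳ (weight-suc dy≡)
      below : ∀ y → W y * (x ^ d y * fromℕ (c z y)) ≈ r⁻¹ * W z * fromℕ (c z y)
      below y with c z y | c-graded z y
      ... | _ | inj₁ refl = ≈-trans (*-congˡ (zeroʳ _)) (≈-trans (zeroʳ _) (≈-sym (zeroʳ _)))
      ... | k | inj₂ dz≡ = ≈-trans
        (solve 5 (λ R R′ X W k → W :* (X :* k) :- R′ :* (X :* R :* W) :* k := :- (X :* W :* k) :* (R :* R′ :- con (+ 1)))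
          ≈-refl r r⁻¹ (x ^ d y) (W y) (fromℕ k) by _ ⊙ rr⁻¹≈1)
        (*-congʳ (*-congˡ (≈-sym (weight-suc dz≡))))
      upper : fromℕ (∑ λ y → c y z) * (fromℕ p * x ^ d z) + x ^ d z * x ^ M ≈ x ^ N * x ^ M
      upper = begin
        fromℕ (∑ λ y → c y z) * (fromℕ p * x ^ d z) + x ^ d z * x ^ M
          ≈⟨ +-cong (≈-trans (*-congˡ (≈-trans (*-congˡ (≈-sym (fromℕ-^ (d z)))) (≈-sym (fromℕ-* p _)))) (≈-sym (fromℕ-* (∑ λ y → c y z) _)))
               (≈-trans (≈-sym (^-homo-* x (d z) M)) (≈-sym (fromℕ-^ (d z ℕ.+ M)))) ⟩
        fromℕ (∑ (λ y → c y z) ℕ.* (p ℕ.* suc p ℕ.^ d z)) + fromℕ (suc p ℕ.^ (d z ℕ.+ M))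
          ≈⟨ fromℕ-+ (∑ (λ y → c y z) ℕ.* (p ℕ.* suc p ℕ.^ d z)) (suc p ℕ.^ (d z ℕ.+ M)) ⟨
        fromℕ (∑ (λ y → c y z) ℕ.* (p ℕ.* suc p ℕ.^ d z) ℕ.+ suc p ℕ.^ (d z ℕ.+ M))
          ≈⟨ reflexive (≡.cong fromℕ (upper-count z)) ⟩
        fromℕ (suc p ℕ.^ (N ℕ.+ M))           ≈⟨ fromℕ-^ (N ℕ.+ M) ⟩
        x ^ (N ℕ.+ M)                         ≈⟨ ^-homo-* x N M ⟩
        x ^ N * x ^ M                         ∎
      lower : fromℕ (∑ (c z)) * fromℕ p + 1# ≈ x ^ d z
      lower = ≈-trans (+-congʳ (≈-sym (fromℕ-* (∑ (c z)) p))) (≈-trans (≈-sym (fromℕ-+ (∑ (c z) ℕ.* p) 1))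
        (≈-trans (reflexive (≡.cong fromℕ (lower-count z))) (fromℕ-^ (d z))))

-- Positivity and reciprocals of Cauchy reals

module Reals where
  open ℝ
  open _≈ʳ_
  open ℤ-Coefficients ℝ-commutativeRing
  open LinearCombinations ℝ-commutativeRing
  module R = CommutativeRing ℝ-commutativeRing
  open import Algebra.Properties.Semiring.Exp R.semiring using (_^_)

  private
    module ℚ-Solver = ℤ-Coefficients ℚ.+-*-commutativeRing
    open ℚ-Solver using () renaming (solve to solveℚ; _:=_ to _≔_; _:+_ to _⊞_; _:*_ to _⊠_; _:-_ to _⊟_; con to con′)

    ∣p∣-∣q∣≤∣p-q∣ : ∀ p q → ℚ.∣ p ∣ ℚ.- ℚ.∣ q ∣ ℚ.≤ ℚ.∣ p ℚ.- q ∣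
    ∣p∣-∣q∣≤∣p-q∣ p q = begin
      ℚ.∣ p ∣ ℚ.- ℚ.∣ q ∣                              ≡⟨ ≡.cong (λ r → ℚ.∣ r ∣ ℚ.- ℚ.∣ q ∣) (solveℚ 2 (λ p q → p ≔ (p ⊟ q) ⊞ q) refl p q) ⟩
      ℚ.∣ (p ℚ.- q) ℚ.+ q ∣ ℚ.- ℚ.∣ q ∣                ≤⟨ ℚ.+-monoˡ-≤ (ℚ.- ℚ.∣ q ∣) (ℚ.∣p+q∣≤∣p∣+∣q∣ (p ℚ.- q) q) ⟩
      (ℚ.∣ p ℚ.- q ∣ ℚ.+ ℚ.∣ q ∣) ℚ.- ℚ.∣ q ∣          ≡⟨ solveℚ 2 (λ r s → r ⊞ s ⊟ s ≔ r) refl ℚ.∣ p ℚ.- q ∣ ℚ.∣ q ∣ ⟩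
      ℚ.∣ p ℚ.- q ∣                                    ∎
      where open ℚ.≤-Reasoning

    ∣∣p∣-∣q∣∣≤∣p-q∣ : ∀ p q → ℚ.∣ ℚ.∣ p ∣ ℚ.- ℚ.∣ q ∣ ∣ ℚ.≤ ℚ.∣ p ℚ.- q ∣
    ∣∣p∣-∣q∣∣≤∣p-q∣ p q with ℚ.∣p∣≡p∨∣p∣≡-p (ℚ.∣ p ∣ ℚ.- ℚ.∣ q ∣)
    ... | inj₁ eq = ≡.subst (ℚ._≤ ℚ.∣ p ℚ.- q ∣) (≡.sym eq) (∣p∣-∣q∣≤∣p-q∣ p q)
    ... | inj₂ eq = ≡.subst₂ ℚ._≤_
      (≡.trans (solveℚ 2 (λ r s → s ⊟ r ≔ con′ (+ 0) ⊟ (r ⊟ s)) refl ℚ.∣ p ∣ ℚ.∣ q ∣) (≡.trans (ℚ.+-identityˡ _) (≡.sym eq)))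
      (≡.trans (≡.sym (ℚ.∣-p∣≡∣p∣ (q ℚ.- p))) (≡.cong ℚ.∣_∣ (≡.trans (≡.sym (ℚ.+-identityˡ _)) (solveℚ 2 (λ p q → con′ (+ 0) ⊟ (q ⊟ p) ≔ p ⊟ q) refl p q))))
      (∣p∣-∣q∣≤∣p-q∣ q p)

    abstract
      abs-cauchy : ∀ x → IsCauchy x → IsCauchy λ i → ℚ.∣ x i ∣
      abs-cauchy x x-cauchy ε 0<ε = let n , x< = x-cauchy ε 0<ε in
        n , λ i j n≤i n≤j → ℚ.≤-<-trans (∣∣p∣-∣q∣∣≤∣p-q∣ (x i) (x j)) (x< i j n≤i n≤j)

    p≤abs : ∀ p → p ℚ.≤ ℚ.∣ p ∣
    p≤abs p with ℚ.≤-total 0ℚ p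
    ... | inj₁ 0≤p = ℚ.≤-reflexive (≡.sym (ℚ.0≤p⇒∣p∣≡p 0≤p))
    ... | inj₂ p≤0 = ℚ.≤-trans p≤0 (ℚ.0≤∣p∣ p)

  abs : ℝ → ℝ
  abs (x , x-cauchy) = (λ i → ℚ.∣ x i ∣) , abs-cauchy x x-cauchy

  abs-cong : ∀ {x y} → x ≈ʳ y → abs x ≈ʳ abs y
  abs-cong {x} {y} x≈y .eventually ε 0<ε = let n , x< = eventually x≈y ε 0<ε in
    n , λ i n≤i → ℚ.≤-<-trans (∣∣p∣-∣q∣∣≤∣p-q∣ (approx x i) (approx y i)) (x< i n≤i)

  abs≈0⇒≈0 : ∀ {x} → abs x ≈ʳ fromℚ 0ℚ → x ≈ʳ fromℚ 0ℚ
  abs≈0⇒≈0 {x} ∣x∣≈0 .eventually ε 0<ε = let n , x< = eventually ∣x∣≈0 ε 0<ε in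
    n , λ i n≤i → ≡.subst (ℚ._< ε) (≡.trans (≡.cong ℚ.∣_∣ (ℚ.+-identityʳ ℚ.∣ approx x i ∣)) (≡.trans (ℚ.∣∣p∣∣≡∣p∣ (approx x i))
      (≡.cong ℚ.∣_∣ (≡.sym (ℚ.+-identityʳ (approx x i)))))) (x< i n≤i)

  fromℚ-+ : ∀ p q → fromℚ (p ℚ.+ q) ≈ʳ fromℚ p +ʳ fromℚ q
  fromℚ-+ p q = pointwise λ _ → refl

  fromℚ-* : ∀ p q → fromℚ (p ℚ.* q) ≈ʳ fromℚ p *ʳ fromℚ q
  fromℚ-* p q = pointwise λ _ → refl

  private
    2x≈0⇒x≈0 : ∀ {x} → x +ʳ x ≈ʳ fromℚ 0ℚ → x ≈ʳ fromℚ 0ℚ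
    2x≈0⇒x≈0 {x} x+x≈0 = R.trans
      (pointwise {x} {fromℚ ½ *ʳ (x +ʳ x)} λ i → ≡.sym (≡.trans (ℚ.*-distribˡ-+ ½ (approx x i) (approx x i))
        (≡.trans (≡.sym (ℚ.*-distribʳ-+ (approx x i) ½ ½)) (ℚ.*-identityˡ (approx x i)))))
      (R.trans (R.*-congˡ x+x≈0) (R.zeroʳ (fromℚ ½)))

  absoluteValue : AbsoluteValue ℝ-commutativeRing
  absoluteValue = record
    { ∣_∣ = abs
    ; ∣∣-cong = abs-cong
    ; ∣xy∣ = λ x y → pointwise λ i → ℚ.∣p*q∣≡∣p∣*∣q∣ (approx x i) (approx y i)
    ; ∣-x∣ = λ x → pointwise λ i → ℚ.∣-p∣≡∣p∣ (approx x i)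
    ; ∣0∣ = pointwise λ _ → refl
    ; ∣∣x∣∣ = λ x → pointwise λ i → ℚ.∣∣p∣∣≡∣p∣ (approx x i)
    ; ∣∣x∣+∣y∣∣ = λ x y → pointwise λ i → ℚ.0≤p⇒∣p∣≡p (ℚ.+-mono-≤ (ℚ.0≤∣p∣ (approx x i)) (ℚ.0≤∣p∣ (approx y i)))
    ; triangle = λ x y → pointwise λ i → ℚ.0≤p⇒∣p∣≡p (≡.subst (ℚ._≤ (ℚ.∣ approx x i ∣ ℚ.+ ℚ.∣ approx y i ∣) ℚ.- ℚ.∣ approx x i ℚ.+ approx y i ∣)
        (ℚ.+-inverseʳ ℚ.∣ approx x i ℚ.+ approx y i ∣) (ℚ.+-monoˡ-≤ (ℚ.- ℚ.∣ approx x i ℚ.+ approx y i ∣) (ℚ.∣p+q∣≤∣p∣+∣q∣ (approx x i) (approx y i))))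
    ; ∣x∣≈0⇒x≈0 = abs≈0⇒≈0
    ; x+x≈0⇒x≈0 = 2x≈0⇒x≈0
    }

  open NonNegativity ℝ-commutativeRing absoluteValue public using (NonNegative; Invertible; nonNegative-*; nonNegative-+; nonNegative-resp)

  -- A positive rational bound valid from some index on. The bound is what makes the sequence of
  -- reciprocals Cauchy.
  record Positive (x : ℝ) : Set where
    constructor positive
    field
      {margin} : ℚ
      0<margin : 0ℚ ℚ.< margin
      {start}  : ℕ
      above    : ∀ i → start ℕ.≤ i → margin ℚ.< approx x i

  open Positive

  private
    *-pos : ∀ {p q} → 0ℚ ℚ.< p → 0ℚ ℚ.< q → 0ℚ ℚ.< p ℚ.* q
    *-pos {p} {q} 0<p 0<q = ℚ.positive⁻¹ (p ℚ.* q) {{ℚ.pos*pos⇒pos p {{ℚ.positive 0<p}} q {{ℚ.positive 0<q}}}}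

    *-mono-<-pos : ∀ {p q r s} → 0ℚ ℚ.< p → 0ℚ ℚ.< s → p ℚ.< q → r ℚ.< s → p ℚ.* r ℚ.< q ℚ.* s
    *-mono-<-pos {p} {q} {r} {s} 0<p 0<s p<q r<s = ℚ.<-trans (ℚ.*-monoʳ-<-pos p {{ℚ.positive 0<p}} r<s) (ℚ.*-monoˡ-<-pos s {{ℚ.positive 0<s}} p<q)

  <ʳ⇒positive : ∀ {x} → fromℚ 0ℚ <ʳ x → Positive x
  <ʳ⇒positive {x} (ε , 0<ε , n , <x) = positive 0<ε λ i n≤i → ≡.subst (ℚ._< approx x i) (ℚ.+-identityˡ ε) (<x i n≤i)

  -- Half of the margin is given up to the difference of the two representatives.
  positive-resp : ∀ {x y} → x ≈ʳ y → Positive x → Positive y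
  positive-resp {x} {y} x≈y x>0 = let ε = margin x>0 ; n , near = eventually x≈y (½ ℚ.* ε) 0<½ε in
    positive {margin = ½ ℚ.* ε} 0<½ε {start x>0 ℕ.⊔ n} λ i ≤i → ≡.subst₂ ℚ._<_
      (≡.trans (≡.cong (ℚ._+ ℚ.- (½ ℚ.* ε)) (≡.sym (≡.trans (≡.sym (ℚ.*-distribʳ-+ ε ½ ½)) (ℚ.*-identityˡ ε))))
        (solveℚ 1 (λ h → h ⊞ h ⊟ h ≔ h) refl (½ ℚ.* ε)))
      (solveℚ 2 (λ a b → a ⊟ (a ⊟ b) ≔ b) refl (approx x i) (approx y i))
      (ℚ.+-mono-< (above x>0 i (ℕ.m⊔n≤o⇒m≤o (start x>0) n ≤i)) (ℚ.neg-antimono-< (ℚ.≤-<-trans (p≤abs (approx x i ℚ.- approx y i)) (near i (ℕ.m⊔n≤o⇒n≤o (start x>0) n ≤i)))))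
    where
    0<½ε : 0ℚ ℚ.< ½ ℚ.* margin x>0
    0<½ε = *-pos (ℚ.positive⁻¹ ½) (0<margin x>0)

  positive-+ : ∀ {x y} → Positive x → Positive y → Positive (x +ʳ y)
  positive-+ x>0 y>0 = positive
    (≡.subst (ℚ._< margin x>0 ℚ.+ margin y>0) (ℚ.+-identityˡ 0ℚ) (ℚ.+-mono-< (0<margin x>0) (0<margin y>0)))
    {start x>0 ℕ.⊔ start y>0} λ i ≤i →
      ℚ.+-mono-< (above x>0 i (ℕ.m⊔n≤o⇒m≤o (start x>0) (start y>0) ≤i)) (above y>0 i (ℕ.m⊔n≤o⇒n≤o (start x>0) (start y>0) ≤i))

  positive-* : ∀ {x y} → Positive x → Positive y → Positive (x *ʳ y)
  positive-* x>0 y>0 = positive (*-pos (0<margin x>0) (0<margin y>0)) {start x>0 ℕ.⊔ start y>0} λ i ≤i →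
    let y> = above y>0 i (ℕ.m⊔n≤o⇒n≤o (start x>0) (start y>0) ≤i) in
    *-mono-<-pos (0<margin x>0) (ℚ.<-trans (0<margin y>0) y>) (above x>0 i (ℕ.m⊔n≤o⇒m≤o (start x>0) (start y>0) ≤i)) y>

  positive-fromℚ : ∀ {p} → 0ℚ ℚ.< p → Positive (fromℚ p)
  positive-fromℚ {p} 0<p = let r , 0<r , r<p = ℚ.<-dense 0<p in positive 0<r {0} λ _ _ → r<p

  positive⇒nonNegative : ∀ {x} → Positive x → NonNegative x
  positive⇒nonNegative {x} x>0 .eventually ε 0<ε = start x>0 , λ i ≤i →
    ≡.subst (ℚ._< ε) (≡.sym (≡.trans (≡.cong (λ r → ℚ.∣ r ℚ.- approx x i ∣) (ℚ.0≤p⇒∣p∣≡p (ℚ.<⇒≤ (ℚ.<-trans (0<margin x>0) (above x>0 i ≤i)))))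
      (≡.cong ℚ.∣_∣ (ℚ.+-inverseʳ (approx x i))))) 0<ε

  private
    -- Total, with default value 0 at 0. A positive real has only finitely many terms at which the
    -- default can occur.
    inv : ℚ → ℚ
    inv p with p ℚ.≟ 0ℚ
    ... | yes _  = 0ℚ
    ... | no p≢0 = (ℚ.1/ p) {{ℚ.≢-nonZero p≢0}}

    *-inv : ∀ {p} → 0ℚ ℚ.< p → p ℚ.* inv p ≡ 1ℚ
    *-inv {p} 0<p with p ℚ.≟ 0ℚ
    ... | yes refl = contradiction 0<p (ℚ.<-irrefl refl)
    ... | no p≢0 = ℚ.*-inverseʳ p {{ℚ.≢-nonZero p≢0}}

    inv-pos : ∀ {p} → 0ℚ ℚ.< p → 0ℚ ℚ.< inv p
    inv-pos {p} 0<p = ℚ.*-cancelˡ-<-nonNeg p {{ℚ.nonNegative (ℚ.<⇒≤ 0<p)}}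
      (≡.subst₂ ℚ._<_ (≡.sym (ℚ.*-zeroʳ p)) (≡.sym (*-inv 0<p)) (ℚ.positive⁻¹ 1ℚ))

    inv-anti : ∀ {p q} → 0ℚ ℚ.< p → p ℚ.< q → inv q ℚ.< inv p
    inv-anti {p} {q} 0<p p<q = ≡.subst₂ ℚ._<_
      (≡.trans (solveℚ 3 (λ p a b → p ⊠ (a ⊠ b) ≔ (p ⊠ a) ⊠ b) refl p (inv p) (inv q)) (≡.trans (≡.cong (ℚ._* inv q) (*-inv 0<p)) (ℚ.*-identityˡ (inv q))))
      (≡.trans (solveℚ 3 (λ q a b → q ⊠ (a ⊠ b) ≔ (q ⊠ b) ⊠ a) refl q (inv p) (inv q)) (≡.trans (≡.cong (ℚ._* inv p) (*-inv 0<q)) (ℚ.*-identityˡ (inv p))))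
      (ℚ.*-monoˡ-<-pos (inv p ℚ.* inv q) {{ℚ.positive (*-pos (inv-pos 0<p) (inv-pos 0<q))}} p<q)
      where
      0<q : 0ℚ ℚ.< q
      0<q = ℚ.<-trans 0<p p<q

    inv-difference : ∀ {p q} → 0ℚ ℚ.< p → 0ℚ ℚ.< q → inv p ℚ.- inv q ≡ (q ℚ.- p) ℚ.* (inv p ℚ.* inv q)
    inv-difference {p} {q} 0<p 0<q = ≡.sym (≡.trans
      (solveℚ 4 (λ p q a b → (q ⊟ p) ⊠ (a ⊠ b) ≔ (q ⊠ b) ⊠ a ⊟ (p ⊠ a) ⊠ b) refl p q (inv p) (inv q))
      (≡.cong₂ ℚ._-_ (≡.trans (≡.cong (ℚ._* inv p) (*-inv 0<q)) (ℚ.*-identityˡ (inv p))) (≡.trans (≡.cong (ℚ._* inv q) (*-inv 0<p)) (ℚ.*-identityˡ (inv q)))))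

    abstract
      inv-cauchy : ∀ {x} → Positive x → IsCauchy λ i → inv (approx x i)
      inv-cauchy {x} x>0 η 0<η = start x>0 ℕ.⊔ n , λ i j ≤i ≤j →
        let xi> = above x>0 i (ℕ.m⊔n≤o⇒m≤o (start x>0) n ≤i)
            xj> = above x>0 j (ℕ.m⊔n≤o⇒m≤o (start x>0) n ≤j)
            0<xi = ℚ.<-trans 0<ε xi> ; 0<xj = ℚ.<-trans 0<ε xj>
            0<u = inv-pos 0<xi ; 0<w = inv-pos 0<xj
            0<uw = *-pos 0<u 0<w in
        ≡.subst₂ ℚ._<_
          (≡.sym (≡.trans (≡.cong ℚ.∣_∣ (inv-difference 0<xi 0<xj)) (≡.trans (ℚ.∣p*q∣≡∣p∣*∣q∣ (approx x j ℚ.- approx x i) _)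
            (≡.cong (ℚ.∣ approx x j ℚ.- approx x i ∣ ℚ.*_) (ℚ.0≤p⇒∣p∣≡p (ℚ.<⇒≤ 0<uw))))))
          (≡.trans (solveℚ 3 (λ e f h → h ⊠ (e ⊠ e) ⊠ (f ⊠ f) ≔ h ⊠ ((e ⊠ f) ⊠ (e ⊠ f))) refl ε (inv ε) η)
            (≡.trans (≡.cong (λ r → η ℚ.* (r ℚ.* r)) (*-inv 0<ε)) (ℚ.*-identityʳ η)))
          (ℚ.<-trans (ℚ.*-monoˡ-<-pos _ {{ℚ.positive 0<uw}} (near j i (ℕ.m⊔n≤o⇒n≤o (start x>0) n ≤j) (ℕ.m⊔n≤o⇒n≤o (start x>0) n ≤i)))
            (ℚ.*-monoʳ-<-pos δ {{ℚ.positive 0<δ}} (*-mono-<-pos 0<u (inv-pos 0<ε) (inv-anti 0<ε xi>) (inv-anti 0<ε xj>))))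
        where
        ε δ : ℚ
        ε = margin x>0
        -- The difference 1/xᵢ - 1/xⱼ equals (xⱼ - xᵢ)/(xᵢ xⱼ), and both xᵢ and xⱼ exceed ε.
        δ = η ℚ.* (ε ℚ.* ε)
        0<ε : 0ℚ ℚ.< ε
        0<ε = 0<margin x>0
        0<δ : 0ℚ ℚ.< δ
        0<δ = *-pos 0<η (*-pos 0<ε 0<ε)
        n : ℕ
        n = proj₁ (isCauchy x δ 0<δ)
        near : ∀ i j → n ℕ.≤ i → n ℕ.≤ j → ℚ.∣ approx x i ℚ.- approx x j ∣ ℚ.< δ
        near = proj₂ (isCauchy x δ 0<δ)

  positive⇒invertible : ∀ {x} → Positive x → ∃ λ y → Positive y × x *ʳ y ≈ʳ fromℚ 1ℚ
  positive⇒invertible {x} x>0 = y , y>0 , inverse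
    where
    y : ℝ
    y = (λ i → inv (approx x i)) , inv-cauchy x>0
    inverse : x *ʳ y ≈ʳ fromℚ 1ℚ
    inverse .eventually ε 0<ε = start x>0 , λ i ≤i →
      ≡.subst (λ r → ℚ.∣ r ℚ.- 1ℚ ∣ ℚ.< ε) (≡.sym (*-inv (ℚ.<-trans (0<margin x>0) (above x>0 i ≤i)))) 0<ε
    n : ℕ
    n = proj₁ (isCauchy x 1ℚ (ℚ.positive⁻¹ 1ℚ))
    -- An upper bound of the terms from index `n` on; its inverse is the margin of the reciprocal.
    K : ℚ
    K = 1ℚ ℚ.+ ℚ.∣ approx x n ∣
    x<K : ∀ i → n ℕ.≤ i → approx x i ℚ.< K
    x<K i n≤i = ≡.subst (ℚ._< K) (solveℚ 2 (λ a b → (a ⊟ b) ⊞ b ≔ a) refl (approx x i) (approx x n))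
      (ℚ.+-mono-<-≤ (ℚ.≤-<-trans (p≤abs _) (proj₂ (isCauchy x 1ℚ (ℚ.positive⁻¹ 1ℚ)) i n n≤i ℕ.≤-refl)) (p≤abs (approx x n)))
    0<K : 0ℚ ℚ.< K
    0<K = ≡.subst (ℚ._< K) (ℚ.+-identityˡ 0ℚ) (ℚ.+-mono-<-≤ (ℚ.positive⁻¹ 1ℚ) (ℚ.0≤∣p∣ (approx x n)))
    y>0 : Positive y
    y>0 = positive (inv-pos 0<K) {start x>0 ℕ.⊔ n} λ i ≤i →
      inv-anti (ℚ.<-trans (0<margin x>0) (above x>0 i (ℕ.m⊔n≤o⇒m≤o (start x>0) n ≤i))) (x<K i (ℕ.m⊔n≤o⇒n≤o (start x>0) n ≤i))

  private
    suc/1 : ∀ n → + suc n ℚ./ 1 ≡ 1ℚ ℚ.+ (+ n ℚ./ 1)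
    suc/1 n = ℚ.toℚᵘ-injective (begin-equality
      ℚ.toℚᵘ (+ suc n ℚ./ 1)                   ≃⟨ ℚ.toℚᵘ-fromℚᵘ (ℚᵘ.mkℚᵘ (+ suc n) 0) ⟩
      ℚᵘ.mkℚᵘ (+ suc n) 0                      ≃⟨ ℚᵘ.*≡* (≡.cong (ℤ._* + 1) (≡.sym (≡.cong (ℤ._+_ (+ 1)) (ℤ.*-identityʳ (+ n))))) ⟩
      ℚᵘ.1ℚᵘ ℚᵘ.+ ℚᵘ.mkℚᵘ (+ n) 0              ≃⟨ ℚᵘ.+-congʳ ℚᵘ.1ℚᵘ (ℚ.toℚᵘ-fromℚᵘ (ℚᵘ.mkℚᵘ (+ n) 0)) ⟨
      ℚ.toℚᵘ 1ℚ ℚᵘ.+ ℚ.toℚᵘ (+ n ℚ./ 1)        ≃⟨ ℚ.toℚᵘ-homo-+ 1ℚ (+ n ℚ./ 1) ⟨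
      ℚ.toℚᵘ (1ℚ ℚ.+ (+ n ℚ./ 1))              ∎)
      where open ℚᵘ.≤-Reasoning

    1/*/1 : ∀ n .{{_ : ℕ.NonZero n}} → (+ 1 ℚ./ n) ℚ.* (+ n ℚ./ 1) ≡ 1ℚ
    1/*/1 (suc k) = ℚ.toℚᵘ-injective (begin-equality
      ℚ.toℚᵘ ((+ 1 ℚ./ suc k) ℚ.* (+ suc k ℚ./ 1))              ≃⟨ ℚ.toℚᵘ-homo-* (+ 1 ℚ./ suc k) (+ suc k ℚ./ 1) ⟩
      ℚ.toℚᵘ (+ 1 ℚ./ suc k) ℚᵘ.* ℚ.toℚᵘ (+ suc k ℚ./ 1)        ≃⟨ ℚᵘ.*-cong (ℚ.toℚᵘ-fromℚᵘ (ℚᵘ.mkℚᵘ (+ 1) k)) (ℚ.toℚᵘ-fromℚᵘ (ℚᵘ.mkℚᵘ (+ suc k) 0)) ⟩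
      ℚᵘ.mkℚᵘ (+ 1) k ℚᵘ.* ℚᵘ.mkℚᵘ (+ suc k) 0                  ≃⟨ ℚᵘ.*≡* (≡.cong +_ (lemma k)) ⟩
      ℚᵘ.1ℚᵘ                                                    ∎)
      where
      open ℚᵘ.≤-Reasoning
      lemma : ∀ k → (suc k ℕ.+ 0) ℕ.* 1 ≡ suc (k ℕ.* 1) ℕ.+ 0
      lemma k = ≡.trans (ℕ.*-identityʳ (suc k ℕ.+ 0)) (≡.cong (λ r → suc r ℕ.+ 0) (≡.sym (ℕ.*-identityʳ k)))

  fromℕ≈fromℚ : ∀ n → fromℕ n ≈ʳ fromℚ (+ n ℚ./ 1)
  fromℕ≈fromℚ zero    = R.refl
  fromℕ≈fromℚ (suc n) = R.trans (fromℕ-suc n) (R.trans (R.+-congˡ (fromℕ≈fromℚ n)) (R.trans (R.sym (fromℚ-+ 1ℚ (+ n ℚ./ 1)))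
    (R.reflexive (≡.cong fromℚ (≡.sym (suc/1 n))))))

  fromℚ-1/ : ∀ n .{{_ : ℕ.NonZero n}} → fromℚ (+ 1 ℚ./ n) *ʳ fromℕ n ≈ʳ fromℚ 1ℚ
  fromℚ-1/ n = R.trans (R.*-congˡ (fromℕ≈fromℚ n)) (R.trans (R.sym (fromℚ-* (+ 1 ℚ./ n) (+ n ℚ./ 1))) (R.reflexive (≡.cong fromℚ (1/*/1 n))))

  positive-1 : Positive (fromℚ 1ℚ)
  positive-1 = positive-fromℚ (ℚ.positive⁻¹ 1ℚ)

  positive-fromℕ : ∀ n → Positive (fromℕ (suc n))
  positive-fromℕ zero    = positive-1
  positive-fromℕ (suc n) = positive-+ (positive-fromℕ n) positive-1

  positive-1/ : ∀ n .{{_ : ℕ.NonZero n}} → Positive (fromℚ (+ 1 ℚ./ n))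
  positive-1/ n = positive-fromℚ (ℚ.positive⁻¹ (+ 1 ℚ./ n) {{ℚ.normalize-pos 1 n}})

  nonNegative-fromℕ : ∀ n → NonNegative (fromℕ n)
  nonNegative-fromℕ zero    = pointwise λ _ → refl
  nonNegative-fromℕ (suc n) = positive⇒nonNegative (positive-fromℕ n)

  positive-^ : ∀ {x} → Positive x → ∀ k → Positive (x ^ k)
  positive-^ x>0 zero    = positive-1
  positive-^ x>0 (suc k) = positive-* x>0 (positive-^ x>0 k)

  positive-abs : ∀ {x y} → Positive (x R.- y) → Positive (abs x R.- y)
  positive-abs {x} {y} x>y = positive (0<margin x>y) {start x>y} λ i ≤i →
    ℚ.<-≤-trans (above x>y i ≤i) (ℚ.+-monoˡ-≤ (ℚ.- approx y i) (p≤abs (approx x i)))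

if-yes : ∀ {p a} {P : Set p} {A : Set a} (P? : Dec P) {u v : A} → P → (if does P? then u else v) ≡ u
if-yes (yes _) _ = refl
if-yes (no ¬p) p = contradiction p ¬p

if-no : ∀ {p a} {P : Set p} {A : Set a} (P? : Dec P) {u v : A} → ¬ P → (if does P? then u else v) ≡ v
if-no (yes p) ¬p = contradiction p ¬p
if-no (no _)  _  = refl

-- The algebra generated by a diagonal matrix

module DiagonalAlgebra (n : ℕ) where
  open ℂ-Ring hiding (zero) renaming (refl to ≈-refl; sym to ≈-sym; trans to ≈-trans)
  open Algebra.Properties.Semiring.Sum semiring using (sum)
  open SingleTerm +-commutativeMonoid
  open Matrices n
  open ℤ-Coefficients ℂ-commutativeRing
  open LinearCombinations ℂ-commutativeRing

  ≈ᴹ-trans : ∀ {B C D} → B ≈ᴹ C → C ≈ᴹ D → B ≈ᴹ D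
  ≈ᴹ-trans B≈C C≈D y z = ≈-trans (B≈C y z) (C≈D y z)

  ≈ᴹ-sym : ∀ {B C} → B ≈ᴹ C → C ≈ᴹ B
  ≈ᴹ-sym B≈C y z = ≈-sym (B≈C y z)

  private
    if-cong : ∀ {p} {P : Set p} (P? : Dec P) {u v} → u ≈ v → (if does P? then u else 0#) ≈ (if does P? then v else 0#)
    if-cong (yes _) u≈v = u≈v
    if-cong (no _)  _   = ≈-refl

    if-+ : ∀ {p} {P : Set p} (P? : Dec P) u v → (if does P? then u else 0#) + (if does P? then v else 0#) ≈ (if does P? then u + v else 0#)
    if-+ (yes _) u v = ≈-refl
    if-+ (no _)  u v = +-identityˡ 0#

    if-* : ∀ {p} {P : Set p} (P? : Dec P) a u → a * (if does P? then u else 0#) ≈ (if does P? then a * u else 0#)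
    if-* (yes _) a u = ≈-refl
    if-* (no _)  a u = zeroʳ a

  diagonal-cong : ∀ {f g} → f ≈ⱽ g → diagonal f ≈ᴹ diagonal g
  diagonal-cong f≈g y z = if-cong (y Fin.≟ z) (f≈g y)

  diagonal-+ : ∀ f g → diagonal f +ᴹ diagonal g ≈ᴹ diagonal (λ y → f y + g y)
  diagonal-+ f g y z = if-+ (y Fin.≟ z) (f y) (g y)

  diagonal-∙ : ∀ a f → a ∙ᴹ diagonal f ≈ᴹ diagonal (λ y → a * f y)
  diagonal-∙ a f y z = if-* (y Fin.≟ z) a (f y)

  diagonal-* : ∀ f g → diagonal f *ᴹ diagonal g ≈ᴹ diagonal (λ y → f y * g y)
  diagonal-* f g y z = ≈-trans
    (sum-single _ y λ x x≢y → ≈-trans (*-congʳ (reflexive (if-no (y Fin.≟ x) (x≢y ∘ ≡.sym)))) (zeroˡ _))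
    (≈-trans (*-congʳ (reflexive (if-yes (y Fin.≟ y) refl))) (if-* (y Fin.≟ z) (f y) (g y)))

  diagonal-· : ∀ f v → diagonal f · v ≈ⱽ λ y → f y * v y
  diagonal-· f v y = ≈-trans
    (sum-single _ y λ x x≢y → ≈-trans (*-congʳ (reflexive (if-no (y Fin.≟ x) (x≢y ∘ ≡.sym)))) (zeroˡ _))
    (*-congʳ (reflexive (if-yes (y Fin.≟ y) refl)))

  +ᴹ-cong : ∀ {B C D E} → B ≈ᴹ C → D ≈ᴹ E → B +ᴹ D ≈ᴹ C +ᴹ E
  +ᴹ-cong B≈C D≈E y z = +-cong (B≈C y z) (D≈E y z)

  *ᴹ-cong : ∀ {B C D E} → B ≈ᴹ C → D ≈ᴹ E → B *ᴹ D ≈ᴹ C *ᴹ E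
  *ᴹ-cong B≈C D≈E y z = Algebra.Properties.Semiring.Sum.sum-cong-≋ semiring λ x → *-cong (B≈C y x) (D≈E x z)

  ∙ᴹ-cong : ∀ a {B C} → B ≈ᴹ C → a ∙ᴹ B ≈ᴹ a ∙ᴹ C
  ∙ᴹ-cong a B≈C y z = *-congˡ (B≈C y z)

  module Graded (d : Fin n → ℕ) (N : ℕ) (d≤N : ∀ y → d y ℕ.≤ N) (κ : ℕ → ℂ)
    (κ-separated : ∀ i j → j ℕ.< i → ∃ λ b → (κ i - κ j) * b ≈ 1#) where

    component : Fin (suc N) → Mat
    component i = diagonal λ y → if does (d y ℕ.≟ toℕ i) then 1# else 0#

    level : Fin n → Fin (suc N)
    level y = Fin.fromℕ< (ℕ.s≤s (d≤N y))

    d≡level : ∀ y → d y ≡ toℕ (level y)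
    d≡level y = ≡.sym (Fin.toℕ-fromℕ< (ℕ.s≤s (d≤N y)))

    combination≈diagonal : ∀ a → sumᴹ (λ i → a i ∙ᴹ component i) ≈ᴹ diagonal (a ∘ level)
    combination≈diagonal a y z = entry (y Fin.≟ z)
      where
      entry : (y≟z : Dec (y ≡ z)) → sum (λ i → a i * (if does y≟z then (if does (d y ℕ.≟ toℕ i) then 1# else 0#) else 0#)) ≈
              (if does y≟z then a (level y) else 0#)
      entry (no _) = sum-zero _ λ i → zeroʳ (a i)
      entry (yes _) = ≈-trans
        (sum-single _ (level y) λ i i≢ → ≈-trans (*-congˡ (reflexive (if-no (d y ℕ.≟ toℕ i)
          λ dy≡i → i≢ (Fin.toℕ-injective (≡.trans (≡.sym dy≡i) (d≡level y)))))) (zeroʳ (a i)))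
        (≈-trans (*-congˡ (reflexive (if-yes (d y ℕ.≟ toℕ (level y)) (d≡level y)))) (*-identityʳ _))

    dualA : Mat
    dualA = diagonal (κ ∘ d)

    private
      IsDiagonal : Mat → Set
      IsDiagonal C = ∃ λ a → C ≈ᴹ diagonal (a ∘ level)

      subalgebra⇒diagonal : ∀ {C} → Subalgebra⟨ dualA ⟩ C → IsDiagonal C
      subalgebra⇒diagonal generator = κ ∘ toℕ , diagonal-cong λ y → reflexive (≡.cong κ (d≡level y))
      subalgebra⇒diagonal unit = (λ _ → 1#) , λ y z → ≈-refl
      subalgebra⇒diagonal (add C∈ D∈) = let a , C≈ = subalgebra⇒diagonal C∈ ; b , D≈ = subalgebra⇒diagonal D∈ in
        (λ i → a i + b i) , ≈ᴹ-trans (+ᴹ-cong C≈ D≈) (diagonal-+ (a ∘ level) (b ∘ level))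
      subalgebra⇒diagonal (multiply C∈ D∈) = let a , C≈ = subalgebra⇒diagonal C∈ ; b , D≈ = subalgebra⇒diagonal D∈ in
        (λ i → a i * b i) , ≈ᴹ-trans (*ᴹ-cong C≈ D≈) (diagonal-* (a ∘ level) (b ∘ level))
      subalgebra⇒diagonal (scale s C∈) = let a , C≈ = subalgebra⇒diagonal C∈ in
        (λ i → s * a i) , ≈ᴹ-trans (∙ᴹ-cong s C≈) (diagonal-∙ s (a ∘ level))
      subalgebra⇒diagonal (respects C≈D C∈) = let a , C≈ = subalgebra⇒diagonal C∈ in a , ≈ᴹ-trans (≈ᴹ-sym C≈D) C≈

      _∈Sub : (ℕ → ℂ) → Set
      f ∈Sub = Subalgebra⟨ dualA ⟩ (diagonal (f ∘ d))

      +-∈Sub : ∀ {f g} → f ∈Sub → g ∈Sub → (λ k → f k + g k) ∈Sub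
      +-∈Sub {f} {g} f∈ g∈ = respects (diagonal-+ (f ∘ d) (g ∘ d)) (add f∈ g∈)

      *-∈Sub : ∀ {f g} → f ∈Sub → g ∈Sub → (λ k → f k * g k) ∈Sub
      *-∈Sub {f} {g} f∈ g∈ = respects (diagonal-* (f ∘ d) (g ∘ d)) (multiply f∈ g∈)

      const-∈Sub : ∀ a → (λ _ → a) ∈Sub
      const-∈Sub a = respects (≈ᴹ-trans (diagonal-∙ a (λ _ → 1#)) (diagonal-cong λ y → *-identityʳ a)) (scale a unit)

      -- The Newton polynomial with nodes κ 0, ..., κ (m - 1), evaluated at κ k. It vanishes on the
      -- levels below m and is invertible from level m on.
      newton : ℕ → ℕ → ℂ
      newton zero    k = 1#
      newton (suc m) k = newton m k * (κ k + - κ m)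

      newton-∈Sub : ∀ m → newton m ∈Sub
      newton-∈Sub zero    = unit
      newton-∈Sub (suc m) = *-∈Sub {newton m} {λ k → κ k + - κ m} (newton-∈Sub m) (+-∈Sub {κ} {λ _ → - κ m} generator (const-∈Sub (- κ m)))

      newton≈0 : ∀ {k} m → k ℕ.< m → newton m k ≈ 0#
      newton≈0 {k} (suc m) k<1+m with ℕ.m≤n⇒m<n∨m≡n (ℕ.s≤s⁻¹ k<1+m)
      ... | inj₁ k<m  = ≈-trans (*-congʳ (newton≈0 m k<m)) (zeroˡ _)
      ... | inj₂ refl = ≈-trans (*-congˡ (-‿inverseʳ (κ k))) (zeroʳ _)

      newton-invertible : ∀ m k → m ℕ.≤ k → ∃ λ b → newton m k * b ≈ 1#
      newton-invertible zero    k _   = 1# , *-identityˡ 1#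
      newton-invertible (suc m) k m<k = let b , nb≈1 = newton-invertible m k (ℕ.<⇒≤ m<k) ; b′ , κb′≈1 = κ-separated k m m<k in
        b * b′ , ≈-trans (solve 4 (λ n κ b b′ → n :* κ :* (b :* b′) := (n :* b) :* (κ :* b′)) ≈-refl _ _ b b′)
                   (≈-trans (*-cong nb≈1 κb′≈1) (*-identityˡ 1#))

      -- The value at level m is corrected by a multiple of `newton m`, which leaves the earlier
      -- levels unchanged.
      interpolate : ∀ m (g : ℕ → ℂ) → ∃ λ f → f ∈Sub × (∀ k → k ℕ.< m → f k ≈ g k)
      interpolate zero    g = (λ _ → 1#) , unit , λ _ ()
      interpolate (suc m) g = let f , f∈ , f≈g = interpolate m g ; b , nb≈1 = newton-invertible m m ℕ.≤-refl ; t = (g m + - f m) * b in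
        (λ k → f k + t * newton m k) , +-∈Sub {f} {λ k → t * newton m k} f∈ (*-∈Sub {λ _ → t} {newton m} (const-∈Sub t) (newton-∈Sub m)) ,
        λ k k<1+m → [ (λ k<m → ≈-trans (+-cong (f≈g k k<m) (≈-trans (*-congˡ (newton≈0 m k<m)) (zeroʳ t))) (+-identityʳ _))
                    , (λ { refl → solve 4 (λ f g n b → f :+ (g :+ :- f) :* b :* n :- g := (g :+ :- f) :* (n :* b :- con (+ 1))) ≈-refl (f k) (g k) (newton k k) b
                                  by _ ⊙ nb≈1 }) ]′ (ℕ.m≤n⇒m<n∨m≡n (ℕ.s≤s⁻¹ k<1+m))
        where open Sum using ([_,_]′)

      component∈ : ∀ i → Subalgebra⟨ dualA ⟩ (component i)
      component∈ i = let f , f∈ , f≈ = interpolate (suc N) (λ k → if does (k ℕ.≟ toℕ i) then 1# else 0#) in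
        respects (diagonal-cong λ y → f≈ (d y) (ℕ.s≤s (d≤N y))) f∈

      sum∈ : ∀ {k} (B : Fin k → Mat) → (∀ i → Subalgebra⟨ dualA ⟩ (B i)) → Subalgebra⟨ dualA ⟩ (sumᴹ B)
      sum∈ {zero}  B B∈ = respects (λ y z → zeroˡ _) (scale 0# unit)
      sum∈ {suc k} B B∈ = add (B∈ zero) (sum∈ (B ∘ suc) (B∈ ∘ suc))

    -- The diagonal matrices constant on levels form an algebra containing `dualA`; conversely the
    -- indicator of each level is an interpolation polynomial in `dualA`.
    dualA-generates : Generates dualA (Span component)
    dualA-generates C = mk⇔
      (λ C∈ → let a , C≈ = subalgebra⇒diagonal C∈ in a , ≈ᴹ-trans C≈ (≈ᴹ-sym (combination≈diagonal a)))
      (λ (a , C≈) → respects (≈ᴹ-sym C≈) (sum∈ (λ i → a i ∙ᴹ component i) λ i → scale (a i) (component∈ i)))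

  subalgebra-resp : ∀ {B B′ C} → B ≈ᴹ B′ → Subalgebra⟨ B ⟩ C → Subalgebra⟨ B′ ⟩ C
  subalgebra-resp B≈B′ generator = respects (≈ᴹ-sym B≈B′) generator
  subalgebra-resp B≈B′ unit = unit
  subalgebra-resp B≈B′ (add C∈ D∈) = add (subalgebra-resp B≈B′ C∈) (subalgebra-resp B≈B′ D∈)
  subalgebra-resp B≈B′ (multiply C∈ D∈) = multiply (subalgebra-resp B≈B′ C∈) (subalgebra-resp B≈B′ D∈)
  subalgebra-resp B≈B′ (scale s C∈) = scale s (subalgebra-resp B≈B′ C∈)
  subalgebra-resp B≈B′ (respects C≈D C∈) = respects C≈D (subalgebra-resp B≈B′ C∈)

-- The two orderings of the eigenspaces

module Orderings {N : ℕ} where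

  -- The relation between i and i + 1. It never joins an integer to a half-integer, so the junction
  -- of the two chains is not a `Next` pair in either ordering.
  data Next : HalfIntegers N → HalfIntegers N → Set where
    integer : ∀ {i j} → toℕ j ≡ suc (toℕ i) → Next (inj₁ i) (inj₁ j)
    half    : ∀ {i j} → toℕ j ≡ suc (toℕ i) → Next (inj₂ i) (inj₂ j)

  private
    2*suc : ∀ {i j} → j ≡ suc i → 2 ℕ.* j ≡ 2 ℕ.+ 2 ℕ.* i
    2*suc {i} refl = ℕ.*-suc 2 i

  twice-next : ∀ {i j} → Next i j → twice j ≡ 2 ℕ.+ twice i
  twice-next (integer eq) = 2*suc eq
  twice-next (half eq)    = ≡.cong suc (2*suc eq)

  twice≤ : ∀ i → twice {N} i ℕ.≤ 2 ℕ.* N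
  twice≤ (inj₁ i) = ℕ.*-monoʳ-≤ 2 (ℕ.s≤s⁻¹ (Fin.toℕ<n i))
  twice≤ (inj₂ i) = ℕ.≤-trans (ℕ.n≤1+n _) (ℕ.≤-trans (ℕ.≤-reflexive (≡.sym (ℕ.*-suc 2 (toℕ i)))) (ℕ.*-monoʳ-≤ 2 (Fin.toℕ<n i)))

  predecessor : ∀ j → (∃ λ i → Next i j) ⊎ (twice {N} j ≡ 0 ⊎ twice {N} j ≡ 1)
  predecessor (inj₁ zero)    = inj₂ (inj₁ refl)
  predecessor (inj₁ (suc i)) = inj₁ (inj₁ (Fin.inject₁ i) , integer (≡.cong suc (≡.sym (Fin.toℕ-inject₁ i))))
  predecessor (inj₂ zero)    = inj₂ (inj₂ refl)
  predecessor (inj₂ (suc i)) = inj₁ (inj₂ (Fin.inject₁ i) , half (≡.cong suc (≡.sym (Fin.toℕ-inject₁ i))))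

  successor : ∀ i → (∃ λ j → Next i j) ⊎ (twice {N} i ≡ 2 ℕ.* N ⊎ suc (twice {N} i) ≡ 2 ℕ.* N)
  successor (inj₁ i) with ℕ.m≤n⇒m<n∨m≡n (ℕ.s≤s⁻¹ (Fin.toℕ<n i))
  ... | inj₁ i<N = inj₁ (inj₁ (Fin.fromℕ< (ℕ.s≤s i<N)) , integer (Fin.toℕ-fromℕ< (ℕ.s≤s i<N)))
  ... | inj₂ i≡N = inj₂ (inj₁ (≡.cong (2 ℕ.*_) i≡N))
  successor (inj₂ i) with ℕ.m≤n⇒m<n∨m≡n (Fin.toℕ<n i)
  ... | inj₁ 1+i<N = inj₁ (inj₂ (Fin.fromℕ< 1+i<N) , half (Fin.toℕ-fromℕ< 1+i<N))
  ... | inj₂ 1+i≡N = inj₂ (inj₂ (≡.trans (≡.sym (ℕ.*-suc 2 (toℕ i))) (≡.cong (2 ℕ.*_) 1+i≡N)))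

  toℕ-splitAt : ∀ m {n} (k : Fin (m ℕ.+ n)) → toℕ k ≡ Sum.[ toℕ , (λ i → m ℕ.+ toℕ i) ] (splitAt m k)
  toℕ-splitAt m {n} k = ≡.trans (≡.cong toℕ (≡.sym (Fin.join-splitAt m n k))) (toℕ-join (splitAt m k))
    where
    toℕ-join : ∀ s → toℕ (Fin.join m n s) ≡ Sum.[ toℕ , (λ i → m ℕ.+ toℕ i) ] s
    toℕ-join (inj₁ i) = Fin.toℕ-↑ˡ i n
    toℕ-join (inj₂ i) = Fin.toℕ-↑ʳ m i

  -- All that tridiagonality requires of an ordering: `Next` pairs occupy consecutive places.
  record Positions (σ : Ordering N) : Set where
    field
      position      : HalfIntegers N → ℕ
      toℕ≡position  : ∀ k → toℕ k ≡ position (Inverse.to σ k)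
      position-next : ∀ {i j} → Next i j → position j ≡ suc (position i)

  integersFirst-positions : Positions (integersFirst N)
  integersFirst-positions = record
    { position = Sum.[ toℕ , (λ i → suc N ℕ.+ toℕ i) ]
    ; toℕ≡position = λ k → ≡.trans (≡.sym (Fin.toℕ-cast _ k)) (toℕ-splitAt (suc N) (Fin.cast _ k))
    ; position-next = λ { (integer eq) → eq ; (half eq) → ≡.trans (≡.cong (suc N ℕ.+_) eq) (ℕ.+-suc (suc N) _) }
    }

  halvesFirst-positions : Positions (halvesFirst N)
  halvesFirst-positions = record
    { position = Sum.[ (λ i → N ℕ.+ toℕ i) , toℕ ]
    ; toℕ≡position = λ k → ≡.trans (≡.sym (Fin.toℕ-cast _ k)) (≡.trans (toℕ-splitAt N (Fin.cast _ k)) (swap (splitAt N (Fin.cast _ k))))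
    ; position-next = λ { (integer eq) → ≡.trans (≡.cong (N ℕ.+_) eq) (ℕ.+-suc N _) ; (half eq) → eq }
    }
    where
    swap : ∀ s → Sum.[ toℕ , (λ i → N ℕ.+ toℕ i) ] s ≡ Sum.[ (λ i → N ℕ.+ toℕ i) , toℕ ] (Sum.swap s)
    swap (inj₁ _) = refl
    swap (inj₂ _) = refl

  module _ {n : ℕ} where
    open Matrices n

    at-∈ : ∀ {k} (V : Fin k → Pred Vec 0ℓ) j {u} → V j u → at V (+ toℕ j) u
    at-∈ {k} V j Vju with toℕ j ℕ.<? k
    ... | yes j<k = ≡.subst (λ i → V i _) (≡.sym (Fin.fromℕ<-toℕ j j<k)) Vju
    ... | no j≮k  = contradiction (Fin.toℕ<n j) j≮k

    at-zero : ∀ {k} (V : Fin k → Pred Vec 0ℓ) → (∀ j {u} → IsZero u → V j u) → ∀ z {u} → IsZero u → at V z u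
    at-zero {k} V V-zero (+ i) u≈0 with i ℕ.<? k
    ... | yes i<k = V-zero (Fin.fromℕ< i<k) u≈0
    ... | no _    = u≈0
    at-zero V V-zero -[1+ _ ] u≈0 = u≈0

    module _ (B : Mat) (E : HalfIntegers N → Pred Vec 0ℓ) (E-zero : ∀ i {u} → IsZero u → E i u) where

      -- Tridiagonality before an ordering is chosen: each outer component belongs to the neighbour
      -- in the chain or vanishes.
      Splits : Set
      Splits = ∀ i v → E i v → ∃ λ u₋ → ∃ λ u₀ → ∃ λ u₊ →
        ((∃ λ j → Next j i × E j u₋) ⊎ IsZero u₋) × E i u₀ × ((∃ λ j → Next i j × E j u₊) ⊎ IsZero u₊) ×
        B · v ≈ⱽ (u₋ +ⱽ u₀) +ⱽ u₊

      -- At an end of a chain the outer component is zero, and the zero vector lies in whatever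
      -- space the ordering has there, be it the other chain's or the zero space.
      splits⇒tridiagonal : Splits → ∀ σ → Positions σ → ActsTridiagonally B (E ∘ Inverse.to σ)
      splits⇒tridiagonal splits σ positions k v Ev =
        let u₋ , u₀ , u₊ , u₋∈ , u₀∈ , u₊∈ , Bv≈ = splits (Inverse.to σ k) v Ev in
        u₋ +ⱽ u₀ , u₊ , (u₋ , u₀ , before u₋∈ , u₀∈ , λ _ → ℂ-Ring.refl) , after u₊∈ , Bv≈
        where
        open Positions positions
        V : Fin (suc (2 ℕ.* N)) → Pred Vec 0ℓ
        V = E ∘ Inverse.to σ
        V-zero : ∀ j {u} → IsZero u → V j u
        V-zero j = E-zero (Inverse.to σ j)
        place : ∀ i {u z} → E i u → z ≡ + position i → at V z u
        place i {u} Ei refl = ≡.subst (λ m → at V (+ m) u)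
          (≡.trans (toℕ≡position (Inverse.from σ i)) (≡.cong position (Inverse.strictlyInverseˡ σ i)))
          (at-∈ V (Inverse.from σ i) (≡.subst (λ j → E j u) (≡.sym (Inverse.strictlyInverseˡ σ i)) Ei))
        before : ∀ {u} → (∃ λ j → Next j (Inverse.to σ k) × E j u) ⊎ IsZero u → at V (ℤ.pred (+ toℕ k)) u
        before (inj₂ u≈0) = at-zero V V-zero (ℤ.pred (+ toℕ k)) u≈0
        before (inj₁ (j , next , Ej)) = place j Ej (≡.trans (≡.cong (λ m → ℤ.pred (+ m)) (≡.trans (toℕ≡position k) (position-next next))) (ℤ.pred-suc (+ position j)))
        after : ∀ {u} → (∃ λ j → Next (Inverse.to σ k) j × E j u) ⊎ IsZero u → at V (ℤ.suc (+ toℕ k)) u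
        after (inj₂ u≈0) = at-zero V V-zero (ℤ.suc (+ toℕ k)) u≈0
        after (inj₁ (j , next , Ej)) = place j Ej (≡.cong +_ (≡.trans (≡.cong suc (toℕ≡position k)) (≡.sym (position-next next))))

-- With x = q, S = q^(M/2), a = q^(N-i) and b = q^i, these are the formal eigenvalues
-- θ at i - 1 (below), i (eigenvalue) and i + 1 (above).
module Spectrum {c ℓ : Level} (K : CommutativeRing c ℓ) (x x⁻¹ p p⁻¹ S : CommutativeRing.Carrier K)
  (x⁻¹x≈1 : CommutativeRing._≈_ K (CommutativeRing._*_ K x⁻¹ x) (CommutativeRing.1# K))
  (pp⁻¹≈1 : CommutativeRing._≈_ K (CommutativeRing._*_ K p p⁻¹) (CommutativeRing.1# K))
  (x≈1+p : CommutativeRing._≈_ K x (CommutativeRing._+_ K (CommutativeRing.1# K) p))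
  where
  open CommutativeRing K hiding (zero) renaming (refl to ≈-refl; sym to ≈-sym; trans to ≈-trans)
  open ℤ-Coefficients K
  open LinearCombinations K

  eigenvalue below above : Carrier → Carrier → Carrier
  eigenvalue a b = (a - b) * p⁻¹ * S
  below a b = eigenvalue (x * a) (x⁻¹ * b)
  above a b = eigenvalue (x⁻¹ * a) (x * b)

  eigenvalue-cong : ∀ {a a′ b b′} → a ≈ a′ → b ≈ b′ → eigenvalue a b ≈ eigenvalue a′ b′
  eigenvalue-cong a≈a′ b≈b′ = *-congʳ (*-congʳ (+-cong a≈a′ (-‿cong b≈b′)))

  -- The symmetry of the spectrum under replacing i by N - i. It reduces the far ends of the chains
  -- to the near ones.
  above≈-below : ∀ a b → above a b ≈ - below b a
  above≈-below a b = solve 6 (λ x x′ p′ S a b → (x′ :* a :- x :* b) :* p′ :* S := :- ((x :* b :- x′ :* a) :* p′ :* S)) ≈-refl x x⁻¹ p⁻¹ S a b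

  below+above : ∀ a b → below a b + above a b ≈ (x + x⁻¹) * eigenvalue a b
  below+above a b = solve 6 (λ x x′ p′ S a b →
    (x :* a :- x′ :* b) :* p′ :* S :+ (x′ :* a :- x :* b) :* p′ :* S := (x :+ x′) :* ((a :- b) :* p′ :* S)) ≈-refl x x⁻¹ p⁻¹ S a b

  -- The product (x a - x⁻¹ b)(x⁻¹ a - x b) is (a - b)² - (x - x⁻¹)² a b, and (x - x⁻¹)/p = (x + 1)
  -- x⁻¹ since p = x - 1.
  below*above : ∀ {a b xᴺ xᴹ Q} → a * b ≈ xᴺ → S * S ≈ xᴹ → Q ≈ xᴺ * xᴹ →
    below a b * above a b ≈ eigenvalue a b * eigenvalue a b - (x + 1#) * (x⁻¹ * x⁻¹) * ((x + 1#) * Q)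
  below*above {a} {b} {xᴺ} {xᴹ} {Q} ab≈ SS≈ Q≈ = solve 10 (λ x x′ p p′ S a b xN xM Q →
      let t = x′ :* x ; e = (x :+ con (+ 1)) :* (x :+ con (+ 1)) :* (x′ :* x′) in
      (x :* a :- x′ :* b) :* p′ :* S :* ((x′ :* a :- x :* b) :* p′ :* S)
        :- ((a :- b) :* p′ :* S :* ((a :- b) :* p′ :* S) :- (x :+ con (+ 1)) :* (x′ :* x′) :* ((x :+ con (+ 1)) :* Q)) :=
      ((a :* a :+ b :* b) :* (p′ :* p′ :* S :* S) :+ a :* b :* S :* S :* p′ :* p′ :* (x :* x :- con (+ 2)) :* (t :+ con (+ 1))) :* (t :- con (+ 1))
      :+ e :* (Q :- xN :* xM)
      :+ :- (e :* S :* S) :* (a :* b :- xN)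
      :+ :- (e :* xN) :* (S :* S :- xM)
      :+ :- (a :* b :* S :* S :* e :* (p :* p′ :+ con (+ 1))) :* (p :* p′ :- con (+ 1))
      :+ :- (a :* b :* S :* S :* p′ :* p′ :* e :* (p :+ x :- con (+ 1))) :* (x :- (con (+ 1) :+ p)))
    ≈-refl x x⁻¹ p p⁻¹ S a b xᴺ xᴹ Q
    by _ ⊙ x⁻¹x≈1 ⊕ _ ⊙ Q≈ ⊕ _ ⊙ ab≈ ⊕ _ ⊙ SS≈ ⊕ _ ⊙ pp⁻¹≈1 ⊕ _ ⊙ x≈1+p

  -- In this and the next two identities the left side displays the gap as sums and products of
  -- positive quantities.
  eigenvalue-above : ∀ a b → (p * x⁻¹ * a + p * b) * p⁻¹ * S ≈ eigenvalue a b - above a b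
  eigenvalue-above a b = solve 7 (λ x x′ p p′ S a b →
      (p :* x′ :* a :+ p :* b) :* p′ :* S :- ((a :- b) :* p′ :* S :- (x′ :* a :- x :* b) :* p′ :* S) :=
      a :* p′ :* S :* (x′ :* x :- con (+ 1)) :+ :- ((a :* x′ :+ b) :* p′ :* S) :* (x :- (con (+ 1) :+ p)))
    ≈-refl x x⁻¹ p p⁻¹ S a b by _ ⊙ x⁻¹x≈1 ⊕ _ ⊙ x≈1+p

  below-eigenvalue : ∀ a b → (p * a + p * x⁻¹ * b) * p⁻¹ * S ≈ below a b - eigenvalue a b
  below-eigenvalue a b = solve 7 (λ x x′ p p′ S a b →
      (p :* a :+ p :* x′ :* b) :* p′ :* S :- ((x :* a :- x′ :* b) :* p′ :* S :- (a :- b) :* p′ :* S) :=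
      b :* p′ :* S :* (x′ :* x :- con (+ 1)) :+ :- ((a :+ b :* x′) :* p′ :* S) :* (x :- (con (+ 1) :+ p)))
    ≈-refl x x⁻¹ p p⁻¹ S a b by _ ⊙ x⁻¹x≈1 ⊕ _ ⊙ x≈1+p

  below-above : ∀ a b → (p + p * x⁻¹) * (a + b) * p⁻¹ * S ≈ below a b - above a b
  below-above a b = solve 7 (λ x x′ p p′ S a b →
      (p :+ p :* x′) :* (a :+ b) :* p′ :* S :- ((x :* a :- x′ :* b) :* p′ :* S :- (x′ :* a :- x :* b) :* p′ :* S) :=
      (a :+ b) :* p′ :* S :* (x′ :* x :- con (+ 1)) :+ :- ((con (+ 1) :+ x′) :* (a :+ b) :* p′ :* S) :* (x :- (con (+ 1) :+ p)))
    ≈-refl x x⁻¹ p p⁻¹ S a b by _ ⊙ x⁻¹x≈1 ⊕ _ ⊙ x≈1+p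

  -- The case i = 1/2, with a = q^(N - 1/2) and b = q^(1/2): the formal eigenvalue at -1/2 exceeds
  -- θ₀ because s = q^(1/2) exceeds 1.
  below-top : ∀ {s a b xᴺ} → s * s ≈ x → xᴺ ≈ s * a → b ≈ s →
              (s - 1#) * (s * a + x⁻¹ * s) * p⁻¹ * S ≈ below a b - eigenvalue xᴺ 1#
  below-top {s} {a} {b} {xᴺ} ss≈x xᴺ≈sa b≈s = solve 8 (λ x x′ p′ S s a b xN →
      (s :- con (+ 1)) :* (s :* a :+ x′ :* s) :* p′ :* S :- ((x :* a :- x′ :* b) :* p′ :* S :- (xN :- con (+ 1)) :* p′ :* S) :=
      x′ :* p′ :* S :* (b :- s) :+ p′ :* S :* (xN :- s :* a) :+ (a :+ x′) :* p′ :* S :* (s :* s :- x) :+ p′ :* S :* (x′ :* x :- con (+ 1)))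
    ≈-refl x x⁻¹ p⁻¹ S s a b xᴺ by _ ⊙ b≈s ⊕ _ ⊙ xᴺ≈sa ⊕ _ ⊙ ss≈x ⊕ _ ⊙ x⁻¹x≈1

-- From complex to real eigenvectors

module RealPart where
  open Reals using (module R)
  module ℤᴿ = ℤ-Coefficients ℝ-commutativeRing
  module ℤᶜ = ℤ-Coefficients ℂ-commutativeRing
  module Expᴿ = Algebra.Properties.Semiring.Exp R.semiring
  module Expᶜ = Algebra.Properties.Semiring.Exp ℂ-Ring.semiring
  module Sumᴿ = Algebra.Properties.Semiring.Sum R.semiring
  module Sumᶜ = Algebra.Properties.Semiring.Sum ℂ-Ring.semiring
  open ℤᴿ using (solve; _:=_; _:+_; _:*_; _:-_; :-_; con)
  open ℂ

  fromℝ-cong : ∀ {x y} → x ≈ʳ y → fromℝ x ≈ᶜ fromℝ y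
  fromℝ-cong x≈y = x≈y , R.refl

  fromℝ-+ : ∀ x y → fromℝ (x +ʳ y) ≈ᶜ fromℝ x +ᶜ fromℝ y
  fromℝ-+ x y = R.refl , R.sym (R.+-identityˡ _)

  fromℝ-neg : ∀ x → fromℝ (-ʳ x) ≈ᶜ -ᶜ fromℝ x
  fromℝ-neg x = R.refl , solve 0 (con (+ 0) := :- con (+ 0)) R.refl

  fromℝ-∸ : ∀ {z w x y} → z ≈ᶜ fromℝ x → w ≈ᶜ fromℝ y → z +ᶜ -ᶜ w ≈ᶜ fromℝ (x R.- y)
  fromℝ-∸ {x = x} {y} z≈x w≈y = ℂ-Ring.trans
    (ℂ-Ring.+-cong z≈x (ℂ-Ring.trans (ℂ-Ring.-‿cong w≈y) (ℂ-Ring.sym (fromℝ-neg y)))) (ℂ-Ring.sym (fromℝ-+ x (-ʳ y)))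

  fromℝ-* : ∀ x y → fromℝ (x *ʳ y) ≈ᶜ fromℝ x *ᶜ fromℝ y
  fromℝ-* x y =
      solve 2 (λ x y → x :* y := x :* y :+ :- (con (+ 0) :* con (+ 0))) R.refl x y
    , solve 2 (λ x y → con (+ 0) := x :* con (+ 0) :+ con (+ 0) :* y) R.refl x y

  fromℝ-fromℕ : ∀ n → ℤᶜ.fromℕ n ≈ᶜ fromℝ (ℤᴿ.fromℕ n)
  fromℝ-fromℕ zero    = ℂ-Ring.refl
  fromℝ-fromℕ (suc n) = ℂ-Ring.trans (ℤᶜ.fromℕ-suc n) (ℂ-Ring.trans (ℂ-Ring.+-congˡ (fromℝ-fromℕ n))
    (ℂ-Ring.trans (ℂ-Ring.sym (fromℝ-+ R.1# (ℤᴿ.fromℕ n))) (fromℝ-cong (R.sym (ℤᴿ.fromℕ-suc n)))))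

  fromℝ-^ : ∀ {z x} → z ≈ᶜ fromℝ x → ∀ k → z Expᶜ.^ k ≈ᶜ fromℝ (x Expᴿ.^ k)
  fromℝ-^ z≈x zero    = ℂ-Ring.refl
  fromℝ-^ {z} {x} z≈x (suc k) = ℂ-Ring.trans (ℂ-Ring.*-cong z≈x (fromℝ-^ z≈x k)) (ℂ-Ring.sym (fromℝ-* x (x Expᴿ.^ k)))

  fromℝ-*-re : ∀ x z → re (fromℝ x *ᶜ z) ≈ʳ x *ʳ re z
  fromℝ-*-re x (a +i b) = solve 3 (λ x a b → x :* a :+ :- (con (+ 0) :* b) := x :* a) R.refl x a b

  fromℝ-*-im : ∀ x z → im (fromℝ x *ᶜ z) ≈ʳ x *ʳ im z
  fromℝ-*-im x (a +i b) = solve 3 (λ x a b → x :* b :+ con (+ 0) :* a := x :* b) R.refl x a b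

  re-sum : ∀ {n} (f : Fin n → ℂ) → re (Sumᶜ.sum f) ≈ʳ Sumᴿ.sum (re ∘ f)
  re-sum {zero}  f = R.refl
  re-sum {suc n} f = R.+-congˡ (re-sum (f ∘ suc))

  im-sum : ∀ {n} (f : Fin n → ℂ) → im (Sumᶜ.sum f) ≈ʳ Sumᴿ.sum (im ∘ f)
  im-sum {zero}  f = R.refl
  im-sum {suc n} f = R.+-congˡ (im-sum (f ∘ suc))

  module _ {n : ℕ} {A : Fin n → Fin n → ℂ} {B : Fin n → Fin n → ℝ} (A≈B : ∀ y z → A y z ≈ᶜ fromℝ (B y z))
    {ν : ℝ} {w : Fin n → ℂ} (w-eigen : ∀ y → Sumᶜ.sum (λ z → A y z *ᶜ w z) ≈ᶜ fromℝ ν *ᶜ w y) where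

    private
      w-eigen′ : ∀ y → Sumᶜ.sum (λ z → fromℝ (B y z) *ᶜ w z) ≈ᶜ fromℝ ν *ᶜ w y
      w-eigen′ y = ℂ-Ring.trans (Sumᶜ.sum-cong-≋ λ z → ℂ-Ring.*-congʳ (ℂ-Ring.sym (A≈B y z))) (w-eigen y)

    -- Matrix and eigenvalue are real, so real and imaginary parts are eigenvectors separately, and
    -- the norm bound can be applied to each over ℝ.
    re-eigen : ∀ y → Sumᴿ.sum (λ z → B y z *ʳ re (w z)) ≈ʳ ν *ʳ re (w y)
    re-eigen y = R.trans (Sumᴿ.sum-cong-≋ λ z → R.sym (fromℝ-*-re (B y z) (w z)))
      (R.trans (R.sym (re-sum (λ z → fromℝ (B y z) *ᶜ w z))) (R.trans (_≈ᶜ_.re-≈ (w-eigen′ y)) (fromℝ-*-re ν (w y))))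

    im-eigen : ∀ y → Sumᴿ.sum (λ z → B y z *ʳ im (w z)) ≈ʳ ν *ʳ im (w y)
    im-eigen y = R.trans (Sumᴿ.sum-cong-≋ λ z → R.sym (fromℝ-*-im (B y z) (w z)))
      (R.trans (R.sym (im-sum (λ z → fromℝ (B y z) *ᶜ w z))) (R.trans (_≈ᶜ_.im-≈ (w-eigen′ y)) (fromℝ-*-im ν (w y))))

-- The eigenvalues as real numbers

module RealSpectrum (p N M : ℕ) .{{p≢0 : ℕ.NonZero p}} (s : ℝ) (0<s : fromℚ 0ℚ <ʳ s) (s²≈q : s *ʳ s ≈ʳ fromℚ (+ suc p ℚ./ 1)) where
  open Reals
  open ℝ-Ring hiding (zero) renaming (refl to ≈-refl; sym to ≈-sym; trans to ≈-trans)
  open Algebra.Properties.CommutativeSemiring.Exp commutativeSemiring using (_^_; ^-homo-*; ^-assocʳ; ^-congˡ; ^-distrib-*)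
  open ℤ-Coefficients ℝ-commutativeRing
  open LinearCombinations ℝ-commutativeRing

  x x⁻¹ p⁻¹ S : ℝ
  x = fromℕ (suc p)
  x⁻¹ = fromℚ (+ 1 ℚ./ suc p)
  p⁻¹ = fromℚ (+ 1 ℚ./ p)
  S = s ^ M

  x⁻¹x≈1 : x⁻¹ * x ≈ 1#
  x⁻¹x≈1 = fromℚ-1/ (suc p)

  pp⁻¹≈1 : fromℕ p * p⁻¹ ≈ 1#
  pp⁻¹≈1 = ≈-trans (*-comm (fromℕ p) p⁻¹) (fromℚ-1/ p)

  ss≈x : s * s ≈ x
  ss≈x = ≈-trans s²≈q (≈-sym (fromℕ≈fromℚ (suc p)))

  SS≈xᴹ : S * S ≈ x ^ M
  SS≈xᴹ = ≈-trans (≈-sym (^-distrib-* s s M)) (^-congˡ M ss≈x)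

  open Spectrum ℝ-commutativeRing x x⁻¹ (fromℕ p) p⁻¹ S x⁻¹x≈1 pp⁻¹≈1 (fromℕ-suc p) public

  private
    ss*≈x* : ∀ w → s * (s * w) ≈ x * w
    ss*≈x* w = ≈-trans (≈-sym (*-assoc s s w)) (*-congʳ ss≈x)

    x⁻¹-cancel : ∀ {u w} → u ≈ x * w → w ≈ x⁻¹ * u
    x⁻¹-cancel {u} {w} u≈xw = ≈-sym (≈-trans (*-congˡ u≈xw) (≈-trans (≈-sym (*-assoc x⁻¹ x w)) (≈-trans (*-congʳ x⁻¹x≈1) (*-identityˡ w))))

    s²ᴺ≈xᴺ : s ^ (2 ℕ.* N) ≈ x ^ N
    s²ᴺ≈xᴺ = ≈-trans (≈-sym (^-assocʳ s 2 N)) (^-congˡ N (≈-trans (ss*≈x* 1#) (*-identityʳ x)))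

  -- For k = 2i these are q^(N - i) and q^i. The truncated subtraction is exact because k is at most
  -- 2N.
  top bottom : ℕ → ℝ
  top k = s ^ (2 ℕ.* N ℕ.∸ k)
  bottom k = s ^ k

  top*bottom : ∀ {k} → k ℕ.≤ 2 ℕ.* N → top k * bottom k ≈ x ^ N
  top*bottom {k} k≤ = ≈-trans (≈-sym (^-homo-* s (2 ℕ.* N ℕ.∸ k) k)) (≈-trans (reflexive (≡.cong (s ^_) (ℕ.m∸n+n≡m k≤))) s²ᴺ≈xᴺ)

  private
    top-shift : ∀ k → 2 ℕ.+ k ℕ.≤ 2 ℕ.* N → top k ≈ x * top (2 ℕ.+ k)
    top-shift k 2+k≤ = ≈-trans (reflexive (≡.cong (s ^_) shift)) (ss*≈x* _)
      where
      m r : ℕ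
      m = 2 ℕ.* N
      r = m ℕ.∸ (2 ℕ.+ k)
      shift : m ℕ.∸ k ≡ 2 ℕ.+ r
      shift = ≡.trans (≡.cong (ℕ._∸ k) (≡.trans (≡.sym (ℕ.m∸n+n≡m 2+k≤)) (≡.trans (≡.sym (ℕ.+-assoc r 2 k)) (≡.cong (ℕ._+ k) (ℕ.+-comm r 2)))))
        (ℕ.m+n∸n≡m (2 ℕ.+ r) k)

  below-≈ : ∀ {k l} → k ≡ 2 ℕ.+ l → k ℕ.≤ 2 ℕ.* N → eigenvalue (top l) (bottom l) ≈ below (top k) (bottom k)
  below-≈ {l = l} refl k≤ = eigenvalue-cong (top-shift l k≤) (x⁻¹-cancel (ss*≈x* (bottom l)))

  above-≈ : ∀ {k l} → l ≡ 2 ℕ.+ k → l ℕ.≤ 2 ℕ.* N → eigenvalue (top l) (bottom l) ≈ above (top k) (bottom k)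
  above-≈ {k} refl l≤ = eigenvalue-cong (x⁻¹-cancel (top-shift k l≤)) (ss*≈x* (bottom k))

  s>0 : Positive s
  s>0 = <ʳ⇒positive 0<s

  x⁻¹>0 : Positive x⁻¹
  x⁻¹>0 = positive-1/ (suc p)

  S>0 : Positive S
  S>0 = positive-^ s>0 M

  p⁻¹>0 : Positive p⁻¹
  p⁻¹>0 = positive-1/ p

  p>0 : Positive (fromℕ p)
  p>0 = lemma p
    where
    lemma : ∀ p .{{_ : ℕ.NonZero p}} → Positive (fromℕ p)
    lemma (suc p) = positive-fromℕ p

  -- Since s² - 1 = p, the difference is p times the inverse of s + 1.
  s-1>0 : Positive (s - 1#)
  s-1>0 = let y , y>0 , [s+1]y≈1 = positive⇒invertible (positive-+ s>0 positive-1) in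
    positive-resp
      (solve 4 (λ s x p y → p :* y :- (s :- con (+ 1)) :=
          (s :- con (+ 1)) :* ((s :+ con (+ 1)) :* y :- con (+ 1)) :+ :- y :* (s :* s :- x) :+ :- y :* (x :- (con (+ 1) :+ p)))
        ≈-refl s x (fromℕ p) y
       by _ ⊙ [s+1]y≈1 ⊕ _ ⊙ ss≈x ⊕ _ ⊙ fromℕ-suc p)
      (positive-* p>0 y>0)

  module _ {a b : ℝ} (a>0 : Positive a) (b>0 : Positive b) where

    eigenvalue-above>0 : Positive (eigenvalue a b - above a b)
    eigenvalue-above>0 = positive-resp (eigenvalue-above a b)
      (positive-* (positive-* (positive-+ (positive-* (positive-* p>0 x⁻¹>0) a>0) (positive-* p>0 b>0)) p⁻¹>0) S>0)

    below-eigenvalue>0 : Positive (below a b - eigenvalue a b)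
    below-eigenvalue>0 = positive-resp (below-eigenvalue a b)
      (positive-* (positive-* (positive-+ (positive-* p>0 a>0) (positive-* (positive-* p>0 x⁻¹>0) b>0)) p⁻¹>0) S>0)

    below-above>0 : Positive (below a b - above a b)
    below-above>0 = positive-resp (below-above a b)
      (positive-* (positive-* (positive-* (positive-+ p>0 (positive-* p>0 x⁻¹>0)) (positive-+ a>0 b>0)) p⁻¹>0) S>0)

  -- This is θ₀.
  μ : ℝ
  μ = eigenvalue (x ^ N) 1#

  -- The values (q^(N - i), q^i) at the heads i = 0 and i = 1/2 of the two chains. At the tails i =
  -- N and i = N - 1/2 the same values occur with a and b exchanged.
  Extreme : ℝ → ℝ → Set
  Extreme a b = (a ≈ x ^ N × b ≈ 1#) ⊎ (x ^ N ≈ s * a × b ≈ s)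

  extreme-below>μ : ∀ {a b} → Positive a → Positive b → Extreme a b → Positive (below a b - μ)
  extreme-below>μ a>0 b>0 (inj₁ (a≈ , b≈)) = positive-resp (+-congˡ (-‿cong (eigenvalue-cong a≈ b≈))) (below-eigenvalue>0 a>0 b>0)
  extreme-below>μ a>0 b>0 (inj₂ (xᴺ≈ , b≈)) = positive-resp (below-top ss≈x xᴺ≈ b≈)
    (positive-* (positive-* (positive-* s-1>0 (positive-+ (positive-* s>0 a>0) (positive-* x⁻¹>0 s>0))) p⁻¹>0) S>0)

  extreme-first : ∀ {k} → k ℕ.≤ 2 ℕ.* N → k ≡ 0 ⊎ k ≡ 1 → Extreme (top k) (bottom k)
  extreme-first _   (inj₁ refl) = inj₁ (s²ᴺ≈xᴺ , ≈-refl)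
  extreme-first 1≤m (inj₂ refl) = inj₂ (≈-trans (≈-sym s²ᴺ≈xᴺ) (reflexive (≡.cong (s ^_) (≡.sym (ℕ.m+[n∸m]≡n 1≤m)))) , *-identityʳ s)

  extreme-last : ∀ {k} → k ≡ 2 ℕ.* N ⊎ suc k ≡ 2 ℕ.* N → Extreme (bottom k) (top k)
  extreme-last {k} (inj₁ k≡m)   = inj₁ (≈-trans (reflexive (≡.cong (s ^_) k≡m)) s²ᴺ≈xᴺ ,
    reflexive (≡.cong (s ^_) (≡.trans (≡.cong (ℕ._∸ k) (≡.sym k≡m)) (ℕ.n∸n≡0 k))))
  extreme-last {k} (inj₂ 1+k≡m) = inj₂ (≈-trans (≈-sym s²ᴺ≈xᴺ) (reflexive (≡.cong (s ^_) (≡.sym 1+k≡m))) ,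
    ≈-trans (reflexive (≡.cong (s ^_) (≡.trans (≡.cong (ℕ._∸ k) (≡.sym 1+k≡m)) (ℕ.m+n∸n≡m 1 k)))) (*-identityʳ s))

  -- As s s = x, the factor s x⁻¹ is the inverse of s; so this is q^(-M/2).
  r : ℝ
  r = (s * x⁻¹) ^ M

  rS≈1 : r * S ≈ 1#
  rS≈1 = ≈-trans (≈-sym (^-distrib-* (s * x⁻¹) s M)) (≈-trans (^-congˡ M
    (solve 3 (λ s x x′ → s :* x′ :* s :- con (+ 1) := x′ :* (s :* s :- x) :+ con (+ 1) :* (x′ :* x :- con (+ 1))) ≈-refl s x x⁻¹
      by _ ⊙ ss≈x ⊕ _ ⊙ x⁻¹x≈1)) (1^ M))
    where
    1^ : ∀ k → 1# ^ k ≈ 1#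
    1^ zero    = ≈-refl
    1^ (suc k) = ≈-trans (*-identityˡ _) (1^ k)

  r>0 : Positive r
  r>0 = positive-^ (positive-* s>0 x⁻¹>0) M

-- A* as a dual adjacency matrix

module DualAdjacency {c ℓ₁ ℓ₂ m ℓm : Level}
  (F : HeytingField c ℓ₁ ℓ₂) {p : ℕ} (∣F∣≡q : F HasOrder (suc p)) {N M : ℕ}
  (H : VectorSpace F m ℓm) (dimH : LinearAlgebra.HasDimension F H U (N ℕ.+ M))
  (h : LinearAlgebra.Subspace F H) (dimh : LinearAlgebra.HasDimension F H (λ x → LinearAlgebra._∈_ F H x h) M)
  (√q : ℝ) (0<√q : fromℚ 0ℚ <ʳ √q) (√q²≈q : √q *ʳ √q ≈ʳ fromℚ (+ suc p ℚ./ 1))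
  where

  open AttenuatedSpace F ∣F∣≡q {N} {M} H dimH h
  open AttenuatedPoset F ∣F∣≡q {N} {M} H dimH h dimh
    using (C; ω; d; d≤N; C-graded; C-ω; Cᵀ-ω; commutator; upper-count; lower-count)
  open FiniteLinearAlgebra F ∣F∣≡q H dimH using (1<q)
  open Counting using (⟨_⟩)
  open Reals
  open RealPart
  open Orderings {N}
  open ℂ-Ring hiding (zero) renaming (refl to ≈-refl; sym to ≈-sym; trans to ≈-trans)
  open Algebra.Properties.Semiring.Sum semiring using (sum; sum-cong-≋; ∑-distrib-+; *-distribˡ-sum)
  open Expᶜ using (_^_)
  open ℤᶜ using (fromℕ)

  private
    instance
      p≢0 : ℕ.NonZero p
      p≢0 = ℕ.>-nonZero (ℕ.s≤s⁻¹ 1<q)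

    X-size : ℕ
    X-size = length members

    q : ℕ
    q = suc p

  open RealSpectrum p N M √q 0<√q √q²≈q
  module Poset = UniformPoset ℂ-commutativeRing C ω d p N M C-graded C-ω Cᵀ-ω commutator
  module Op = Operators ℂ-commutativeRing X-size

  xᶜ x⁻¹ᶜ : ℂ
  xᶜ = Poset.x
  x⁻¹ᶜ = fromℝ x⁻¹

  xᶜ≈ : xᶜ ≈ fromℝ x
  xᶜ≈ = fromℝ-fromℕ q

  x⁻¹xᶜ≈1 : x⁻¹ᶜ * xᶜ ≈ 1#
  x⁻¹xᶜ≈1 = ≈-trans (*-congˡ xᶜ≈) (≈-trans (≈-sym (fromℝ-* x⁻¹ x)) (fromℝ-cong x⁻¹x≈1))

  𝒜 : Vec → Vec
  𝒜 = Poset.𝒜 x⁻¹ᶜ x⁻¹xᶜ≈1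

  private
    entry : ∀ {ℓp ℓq} {P : Set ℓp} {Q : Set ℓq} (P? : Dec P) (Q? : Dec Q) → ¬ (P × Q) → ∀ {u u′} → u ≈ u′ →
            (if does P? then 1# else if does Q? then u else 0#) ≈ fromℕ ⟨ P? ⟩ + u′ * fromℕ ⟨ Q? ⟩
    entry (yes P) (yes Q) ¬PQ u≈ = contradiction (P , Q) ¬PQ
    entry (yes _) (no _)  _   u≈ = ≈-sym (≈-trans (+-congˡ (zeroʳ _)) (+-identityʳ 1#))
    entry (no _)  (yes _) _   u≈ = ≈-trans u≈ (≈-sym (≈-trans (+-identityˡ _) (*-identityʳ _)))
    entry (no _)  (no _)  _   u≈ = ≈-sym (≈-trans (+-congˡ (zeroʳ _)) (+-identityˡ 0#))

  A-entry : ∀ y z → A y z ≈ fromℕ (C y z) + xᶜ ^ d y * fromℕ (C z y)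
  A-entry y z = entry (covers? y z) (covers? z y)
    (λ ((_ , dy) , (_ , dz)) → ℕ.1+n≰n (ℕ.≤-trans (ℕ.n≤1+n _) (ℕ.≤-reflexive (≡.trans (≡.cong suc (≡.sym dz)) (≡.sym dy)))))
    (≈-trans (fromℝ-cong (R.sym (fromℕ≈fromℚ (q ℕ.^ d y)))) (≈-trans (≈-sym (fromℝ-fromℕ (q ℕ.^ d y))) (Poset.fromℕ-^ (d y))))

  A·≈𝒜 : ∀ v → A · v ≈ⱽ 𝒜 v
  A·≈𝒜 v y = ≈-trans
    (sum-cong-≋ λ z → ≈-trans (*-congʳ (A-entry y z)) (≈-trans (distribʳ (v z) _ _) (+-congˡ (*-assoc (xᶜ ^ d y) (fromℕ (C z y)) (v z)))))
    (≈-trans (∑-distrib-+ (λ z → fromℕ (C y z) * v z) (λ z → xᶜ ^ d y * (fromℕ (C z y) * v z)))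
      (+-congˡ (≈-sym (*-distribˡ-sum (xᶜ ^ d y) (λ z → fromℕ (C z y) * v z)))))

  B : X → X → ℝ
  B y z = ℤᴿ.fromℕ (C y z) +ʳ x Expᴿ.^ d y *ʳ ℤᴿ.fromℕ (C z y)

  A≈B : ∀ y z → A y z ≈ fromℝ (B y z)
  A≈B y z = ≈-trans (A-entry y z) (≈-trans
    (+-cong (fromℝ-fromℕ (C y z)) (≈-trans (*-cong (fromℝ-^ xᶜ≈ (d y)) (fromℝ-fromℕ (C z y))) (≈-sym (fromℝ-* _ _))))
    (≈-sym (fromℝ-+ _ _)))

  x>0 : Positive x
  x>0 = positive-fromℕ p

  B≥0 : ∀ y z → NonNegative (B y z)
  B≥0 y z = nonNegative-+ {ℤᴿ.fromℕ (C y z)} (nonNegative-fromℕ (C y z))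
    (nonNegative-* {x Expᴿ.^ d y} (positive⇒nonNegative (positive-^ x>0 (d y))) (nonNegative-fromℕ (C z y)))

  open ColumnSums ℝ-commutativeRing C d p N M C-graded upper-count lower-count

  perron : ℕ → ℝ
  perron = weight p⁻¹ S r pp⁻¹≈1 rS≈1 SS≈xᴹ

  perron>0 : ∀ j → Positive (perron j)
  perron>0 zero    = positive-1
  perron>0 (suc j) = positive-* (positive-* (positive-^ x>0 j) r>0) (perron>0 j)

  beyond-μ : ∀ {ν} → Positive (abs ν R.- μ) → ∀ {u} → 𝒜 u ≈ⱽ fromℝ ν ∙ⱽ u → IsZero u
  beyond-μ {ν} ν>μ {u} u-eigen y = bound (ℂ.re ∘ u) (re-eigen {A = A} {B = B} A≈B {w = u} A-eigen) y
                                 , bound (ℂ.im ∘ u) (im-eigen {A = A} {B = B} A≈B {w = u} A-eigen) y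
    where
    A-eigen : ∀ y → (A · u) y ≈ fromℝ ν * u y
    A-eigen y = ≈-trans (A·≈𝒜 u y) (u-eigen y)
    bound : ∀ (w : X → ℝ) → (∀ y → Sumᴿ.sum (λ z → B y z *ʳ w z) ≈ʳ ν *ʳ w y) → ∀ y → w y ≈ʳ R.0#
    bound = NonNegativity.eigenvalue-bound ℝ-commutativeRing absoluteValue B B≥0 (perron ∘ d)
      (λ y → positive⇒nonNegative (perron>0 (d y)))
      (λ y → let b , _ , inverse = positive⇒invertible (perron>0 (d y)) in b , inverse)
      μ (weight-eigen p⁻¹ S r pp⁻¹≈1 rS≈1 SS≈xᴹ) {ν} (positive⇒nonNegative ν>μ)
      (let b , _ , inverse = positive⇒invertible ν>μ in b , inverse)

  E : HalfIntegers N → Vec → Set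
  E = E_V √q

  𝒜-eigen⇒E : ∀ i {ν u} → fromℝ ν ≈ fromℝ (θ √q i) → 𝒜 u ≈ⱽ fromℝ ν ∙ⱽ u → E i u
  𝒜-eigen⇒E i {u = u} ν≈θ u-eigen y = ≈-trans (A·≈𝒜 u y) (≈-trans (u-eigen y) (*-congʳ ν≈θ))

  E-zero : ∀ i {u} → IsZero u → E i u
  E-zero i {u} u≈0 y = ≈-trans (SingleTerm.sum-zero +-commutativeMonoid _ λ z → ≈-trans (*-congˡ (u≈0 z)) (zeroʳ (A y z)))
    (≈-sym (≈-trans (*-congˡ (u≈0 y)) (zeroʳ _)))

  κ : ℕ → ℂ
  κ k = x⁻¹ᶜ ^ k

  private
    module Posetᴿ = UniformPoset ℝ-commutativeRing C ω d p N M C-graded C-ω Cᵀ-ω commutator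

  -- Both sides are inverse to q^k, and inverses are unique.
  A*-entry : ∀ k → fromℝ (fromℚ ((+ 1 ℚ./ (q ℕ.^ k)) {{ℕ.m^n≢0 q k}})) ≈ κ k
  A*-entry k = ≈-trans (fromℝ-cong inverse-unique) (≈-sym (fromℝ-^ ≈-refl k))
    where
    open LinearCombinations ℝ-commutativeRing
    open ℤᴿ using (solve; _:=_; _:+_; _:*_; _:-_; :-_; con)
    u : ℝ
    u = fromℚ ((+ 1 ℚ./ (q ℕ.^ k)) {{ℕ.m^n≢0 q k}})
    inverse-unique : u ≈ʳ x⁻¹ Expᴿ.^ k
    inverse-unique = solve 4 (λ u v g g′ → u :- v := :- u :* (v :* g′ :- con (+ 1)) :+ v :* (u :* g :- con (+ 1)) :+ :- (u :* v) :* (g :- g′))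
      R.refl u (x⁻¹ Expᴿ.^ k) (ℤᴿ.fromℕ (q ℕ.^ k)) (x Expᴿ.^ k)
      by _ ⊙ Posetᴿ.x⁻ᵏxᵏ≈1 x⁻¹ x⁻¹x≈1 k ⊕ _ ⊙ fromℚ-1/ (q ℕ.^ k) {{ℕ.m^n≢0 q k}} ⊕ _ ⊙ Posetᴿ.fromℕ-^ k

  positive⇒invertibleᶜ : ∀ {z w} → Positive z → w ≈ fromℝ z → ∃ λ b → w * b ≈ 1#
  positive⇒invertibleᶜ {z} z>0 w≈z = let y , _ , zy≈1 = positive⇒invertible z>0 in
    fromℝ y , ≈-trans (*-congʳ w≈z) (≈-trans (≈-sym (fromℝ-* z y)) (fromℝ-cong zy≈1))

  negative⇒invertibleᶜ : ∀ {z w} → Positive z → - w ≈ fromℝ z → ∃ λ b → w * b ≈ 1#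
  negative⇒invertibleᶜ {z} {w} z>0 -w≈z = let b , -wb≈1 = positive⇒invertibleᶜ z>0 -w≈z in
    - b , ≈-trans (ℤᶜ.solve 2 (λ w b → w ℤᶜ.:* ℤᶜ.:- b ℤᶜ.:= ℤᶜ.:- w ℤᶜ.:* b) ≈-refl w b) -wb≈1

  -- The gap telescopes into steps x⁻ⁱ - x⁻ⁱ⁻¹ = p x⁻¹ x⁻ⁱ.
  power-gap>0 : ∀ j k → Positive (x⁻¹ Expᴿ.^ j R.- x⁻¹ Expᴿ.^ (suc k ℕ.+ j))
  power-gap>0 j k = gap k
    where
    open LinearCombinations ℝ-commutativeRing
    open ℤᴿ using (solve; _:=_; _:+_; _:*_; _:-_; :-_; con)
    step : ∀ i → Positive (x⁻¹ Expᴿ.^ i R.- x⁻¹ Expᴿ.^ suc i)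
    step i = positive-resp
      (solve 4 (λ p x x′ w → p :* x′ :* w :- (w :- x′ :* w) :=
          w :* (x′ :* x :- con (+ 1)) :+ :- (x′ :* w) :* (x :- (con (+ 1) :+ p)))
        R.refl (ℤᴿ.fromℕ p) x x⁻¹ (x⁻¹ Expᴿ.^ i) by _ ⊙ x⁻¹x≈1 ⊕ _ ⊙ ℤᴿ.fromℕ-suc p)
      (positive-* (positive-* p>0 x⁻¹>0) (positive-^ x⁻¹>0 i))
    gap : ∀ k → Positive (x⁻¹ Expᴿ.^ j R.- x⁻¹ Expᴿ.^ (suc k ℕ.+ j))
    gap zero    = step j
    gap (suc k) = positive-resp (solve 3 (λ u v w → (u :- v) :+ (v :- w) := u :- w) R.refl
        (x⁻¹ Expᴿ.^ j) (x⁻¹ Expᴿ.^ (suc k ℕ.+ j)) (x⁻¹ Expᴿ.^ (suc (suc k) ℕ.+ j)))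
      (positive-+ (gap k) (step (suc k ℕ.+ j)))

  κ-separated : ∀ i j → j ℕ.< i → ∃ λ b → (κ i - κ j) * b ≈ 1#
  κ-separated i j j<i = negative⇒invertibleᶜ
    (≡.subst (λ l → Positive (x⁻¹ Expᴿ.^ j R.- x⁻¹ Expᴿ.^ l)) suc[i∸1+j]+j≡i (power-gap>0 j (i ℕ.∸ suc j)))
    (≈-trans (ℤᶜ.solve 2 (λ a b → ℤᶜ.:- (a ℤᶜ.:- b) ℤᶜ.:= b ℤᶜ.:- a) ≈-refl (κ i) (κ j))
      (fromℝ-∸ (fromℝ-^ ≈-refl j) (fromℝ-^ ≈-refl i)))
    where
    suc[i∸1+j]+j≡i : suc (i ℕ.∸ suc j) ℕ.+ j ≡ i
    suc[i∸1+j]+j≡i = ≡.trans (≡.sym (ℕ.+-suc (i ℕ.∸ suc j) j)) (ℕ.m∸n+n≡m j<i)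

  A*-generates : Generates A* M*
  A*-generates Y = mk⇔
    (λ Y∈ → Equivalence.to (dualA-generates Y) (subalgebra-resp A*≈ Y∈))
    (λ Y∈ → subalgebra-resp (≈ᴹ-sym A*≈) (Equivalence.from (dualA-generates Y) Y∈))
    where
    open DiagonalAlgebra X-size
    open Graded d N d≤N κ κ-separated
    A*≈ : A* ≈ᴹ dualA
    A*≈ = diagonal-cong λ y → A*-entry (d y)

  private
    ρᴿ : ℝ
    ρᴿ = (x +ʳ R.1#) *ʳ (x⁻¹ *ʳ x⁻¹) *ʳ ((x +ʳ R.1#) *ʳ x Expᴿ.^ (N ℕ.+ M))

    h* : ∀ {w w′ z z′} → w ≈ fromℝ z → w′ ≈ fromℝ z′ → w * w′ ≈ fromℝ (z *ʳ z′)
    h* {z = z} {z′} w≈ w′≈ = ≈-trans (*-cong w≈ w′≈) (≈-sym (fromℝ-* z z′))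

    h+ : ∀ {w w′ z z′} → w ≈ fromℝ z → w′ ≈ fromℝ z′ → w + w′ ≈ fromℝ (z +ʳ z′)
    h+ {z = z} {z′} w≈ w′≈ = ≈-trans (+-cong w≈ w′≈) (≈-sym (fromℝ-+ z z′))

    ρᶜ≈ρᴿ : Poset.ρ x⁻¹ᶜ x⁻¹xᶜ≈1 ≈ fromℝ ρᴿ
    ρᶜ≈ρᴿ = h* {z = (x +ʳ R.1#) *ʳ (x⁻¹ *ʳ x⁻¹)} (h* {z = x +ʳ R.1#} (h+ {z = x} xᶜ≈ ≈-refl) (h* {z = x⁻¹} {x⁻¹} ≈-refl ≈-refl))
      (h* {z = x +ʳ R.1#} (h+ {z = x} xᶜ≈ ≈-refl) (fromℝ-^ xᶜ≈ (N ℕ.+ M)))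

  -- The formal neighbours θᵢ₋₁ and θᵢ₊₁ exist as numbers for every i, so the splitting is uniform.
  -- Only afterwards is each outer component placed in the neighbouring eigenspace or, beyond an end
  -- of the chain, shown to vanish.
  A*-splits : Splits A* E E-zero
  A*-splits i v Ev =
    let u₋ , u₀ , u₊ , u₋-eigen , u₀-eigen , u₊-eigen , dual≈ =
          Poset.dual-splits x⁻¹ᶜ x⁻¹xᶜ≈1 {fromℝ (eigenvalue a b)} {v} v-eigen (fromℝ (below a b)) (fromℝ (above a b))
            (proj₁ inverse₋) (proj₁ inverse₊) (proj₁ inverse₀) (proj₂ inverse₋) (proj₂ inverse₊) (proj₂ inverse₀) sum≈ product≈
    in u₋ , u₀ , u₊ , lower u₋-eigen (predecessor i) , 𝒜-eigen⇒E i {eigenvalue a b} ≈-refl u₀-eigen , upper u₊-eigen (successor i) ,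
       λ y → ≈-trans (DiagonalAlgebra.diagonal-· X-size (λ y → fromℝ (fromℚ ((+ 1 ℚ./ (q ℕ.^ d y)) {{ℕ.m^n≢0 q (d y)}}))) v y)
               (≈-trans (*-congʳ (A*-entry (d y))) (dual≈ y))
    where
    k : ℕ
    k = twice i
    a b : ℝ
    a = top k
    b = bottom k
    a>0 : Positive a
    a>0 = positive-^ s>0 (2 ℕ.* N ℕ.∸ k)
    b>0 : Positive b
    b>0 = positive-^ s>0 k
    v-eigen : 𝒜 v ≈ⱽ fromℝ (eigenvalue a b) ∙ⱽ v
    v-eigen y = ≈-trans (≈-sym (A·≈𝒜 v y)) (Ev y)
    inverse₋ : ∃ λ z → (fromℝ (eigenvalue a b) - fromℝ (below a b)) * z ≈ 1#
    inverse₋ = negative⇒invertibleᶜ (below-eigenvalue>0 a>0 b>0) (≈-trans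
      (ℤᶜ.solve 2 (λ a b → ℤᶜ.:- (a ℤᶜ.:- b) ℤᶜ.:= b ℤᶜ.:- a) ≈-refl (fromℝ (eigenvalue a b)) (fromℝ (below a b)))
      (fromℝ-∸ ≈-refl ≈-refl))
    inverse₊ : ∃ λ z → (fromℝ (eigenvalue a b) - fromℝ (above a b)) * z ≈ 1#
    inverse₊ = positive⇒invertibleᶜ (eigenvalue-above>0 a>0 b>0) (fromℝ-∸ ≈-refl ≈-refl)
    inverse₀ : ∃ λ z → (fromℝ (below a b) - fromℝ (above a b)) * z ≈ 1#
    inverse₀ = positive⇒invertibleᶜ (below-above>0 a>0 b>0) (fromℝ-∸ ≈-refl ≈-refl)
    sum≈ : fromℝ (below a b) + fromℝ (above a b) ≈ (xᶜ + x⁻¹ᶜ) * fromℝ (eigenvalue a b)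
    sum≈ = ≈-trans (≈-sym (fromℝ-+ (below a b) (above a b))) (≈-trans (fromℝ-cong (below+above a b))
      (≈-sym (h* {z = x +ʳ x⁻¹} (h+ {z = x} {x⁻¹} xᶜ≈ ≈-refl) ≈-refl)))
    product≈ : fromℝ (below a b) * fromℝ (above a b) ≈ fromℝ (eigenvalue a b) * fromℝ (eigenvalue a b) - Poset.ρ x⁻¹ᶜ x⁻¹xᶜ≈1
    product≈ = ≈-trans (≈-sym (fromℝ-* (below a b) (above a b)))
      (≈-trans (fromℝ-cong (below*above (top*bottom (twice≤ i)) SS≈xᴹ (Expᴿ.^-homo-* x N M)))
        (≈-sym (fromℝ-∸ (h* {z = eigenvalue a b} {eigenvalue a b} ≈-refl ≈-refl) ρᶜ≈ρᴿ)))
    lower : ∀ {u} → 𝒜 u ≈ⱽ fromℝ (below a b) ∙ⱽ u → (∃ λ j → Next j i) ⊎ (k ≡ 0 ⊎ k ≡ 1) → (∃ λ j → Next j i × E j u) ⊎ IsZero u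
    lower u-eigen (inj₁ (j , next)) = inj₁ (j , next , 𝒜-eigen⇒E j {below a b} (fromℝ-cong (R.sym (below-≈ (twice-next next) (twice≤ i)))) u-eigen)
    lower u-eigen (inj₂ first) = inj₂ (beyond-μ {below a b} (positive-abs (extreme-below>μ a>0 b>0 (extreme-first (twice≤ i) first))) u-eigen)
    upper : ∀ {u} → 𝒜 u ≈ⱽ fromℝ (above a b) ∙ⱽ u → (∃ λ j → Next i j) ⊎ (k ≡ 2 ℕ.* N ⊎ suc k ≡ 2 ℕ.* N) → (∃ λ j → Next i j × E j u) ⊎ IsZero u
    upper u-eigen (inj₁ (j , next)) = inj₁ (j , next , 𝒜-eigen⇒E j {above a b} (fromℝ-cong (R.sym (above-≈ (twice-next next) (twice≤ j)))) u-eigen)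
    -- By `above≈-below` the value has the same absolute value as `below b a`, to which the bound
    -- for a head of a chain applies.
    upper u-eigen (inj₂ last) = inj₂ (beyond-μ {above a b} (positive-resp
      (R.+-congʳ (R.sym (R.trans (abs-cong (above≈-below a b)) (AbsoluteValue.∣-x∣ absoluteValue (below b a)))))
      (positive-abs (extreme-below>μ b>0 a>0 (extreme-last last)))) u-eigen)

  A*-isDualAdjacencyMatrix : ∀ σ → Positions σ → IsDualAdjacencyMatrix √q σ A*
  A*-isDualAdjacencyMatrix σ positions = A*-generates , splits⇒tridiagonal A* E E-zero A*-splits σ positions

corollary10p3 : ∀ {c ℓ₁ ℓ₂ m ℓm} (F : HeytingField c ℓ₁ ℓ₂) (q : ℕ) (∣F∣≡q : F HasOrder q)
    (N M : ℕ) .{{_ : ℕ.NonZero N}} .{{_ : ℕ.NonZero M}}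
    (H : VectorSpace F m ℓm) (dimH : LinearAlgebra.HasDimension F H U (N ℕ.+ M))
    (h : LinearAlgebra.Subspace F H)
    (dimh : LinearAlgebra.HasDimension F H (λ x → LinearAlgebra._∈_ F H x h) M)
    (√q : ℝ) (0<√q : fromℚ 0ℚ <ʳ √q) (√q²≈q : √q *ʳ √q ≈ʳ fromℚ (+ q ℚ./ 1)) →
    let open AttenuatedSpace F ∣F∣≡q {N} {M} H dimH h in
    IsDualAdjacencyMatrix √q (integersFirst N) A* × IsDualAdjacencyMatrix √q (halvesFirst N) A*
corollary10p3 F zero ∣F∣≡q = contradiction (Inverse.to ∣F∣≡q (HeytingField.0# F)) λ ()
corollary10p3 F (suc p) ∣F∣≡q N M H dimH h dimh √q 0<√q √q²≈q =
    A*-isDualAdjacencyMatrix (integersFirst N) integersFirst-positions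
  , A*-isDualAdjacencyMatrix (halvesFirst N) halvesFirst-positions
  where
  open DualAdjacency F ∣F∣≡q {N} {M} H dimH h dimh √q 0<√q √q²≈q
  open Orderings {N}
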